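{- For each $t \in \mathbb{Z}[\frac12]$ with $t>-1$ and all $G,H \in \widetilde{\mathbb{G}}$, $$(G+H)_t=G_t+H_t$$ holds (as an equality of game values).
   Context: Games. $\widetilde{\mathbb{G}}$ is the set of all formal (short, i.e. finite loopfree) normal-play partizan games $G=\{G^L\mid G^R\}$, where $G^L$ (resp. $G^R$) ranges over the finitely many Left (resp. Right) options of $G$; $\tilde b(G)$ is the formal birthday (height of the game tree). Sums and negatives of games are the usual ones; $G\ge 0$ means Left wins $G$ moving second under normal play, $G\ge H$ means $G-H\ge 0$, and $G$ is equal to $H$ (equality of game values) if $G\ge H$ and $H\ge G$. The dyadic rationals $\mathbb{Z}[\frac12]$ are identified in the usual way with the numbers among game values; "equal to an integer/number" means having such a game value. When a dyadic rational is used as a formal game, its canonical form is meant. Cooling and temperature. For $G\in\widetilde{\mathbb{G}}$ and $t\in\mathbb{Z}[\frac12]$, define $\lambda_t(G),\rho_t(G)\in\mathbb{Z}[\frac12]$, $G_t\in\widetilde{\mathbb{G}}$ and $t(G)\in\mathbb{Z}[\frac12]\cup\{ -\infty\}$ by recursion on $\tilde b(G)$ (this recursion is well-defined): - If $G$ is equal to an integer $n$: $\lambda_t(G)=\rho_t(G)=n$, $G_t=n$ (canonical form), $t(G)=-\infty$. - Otherwise let $\widetilde{\lambda}_t(G)=\max_{G^L}\{\rho_t(G^L)-t\}$, $\widetilde{\rho}_t(G)=\min_{G^R}\{\lambda_t(G^R)+t\}$, $\widetilde{G}_t=\{(G^L)_t-t\mid (G^R)_t+t\}$ (with all $G^L$,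 $G^R$), and $t(G)=\min\{t\in\mathbb{Z}[\frac12]\mid \widetilde{\lambda}_t(G)=\widetilde{\rho}_t(G)\}$. If $t\le t(G)$, set $\lambda_t(G)=\widetilde{\lambda}_t(G)$, $\rho_t(G)=\widetilde{\rho}_t(G)$, $G_t=\widetilde{G}_t$. If $t>t(G)$, set $\lambda_t(G)=\rho_t(G)=x$ and $G_t=x$ (canonical form), where $x=\lambda_{t(G)}(G)=\rho_{t(G)}(G)$. -}

module Defs where

open import Algebra.Bundles using (CommutativeRing)
import Algebra.Construct.NaturalChoice.Max as NaturalMax
import Algebra.Construct.NaturalChoice.Min as NaturalMin
open import Algebra.Morphism.Structures using (IsRingMonomorphism)
import Algebra.Morphism.RingMonomorphism as RingMonomorphism
open import Data.Bool.Base using (Bool; true; false; not)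
open import Data.Fin.Base using (Fin; zero; suc; _↑ˡ_; _↑ʳ_; splitAt)
open import Data.Fin.Properties using (all?; any?; splitAt-↑ˡ; splitAt-↑ʳ; ¬∀⟶∃¬)
open import Data.Integer.Base as ℤ using (ℤ; +_; -[1+_])
import Data.Integer.Properties as ℤ
open import Data.List.Base using ([]; _∷_)
open import Data.Maybe.Base using (Maybe; just; nothing)
open import Data.Nat.Base as ℕ using (ℕ; zero; suc)
import Data.Nat.Properties as ℕ
open import Data.Product.Base using (∃; _×_; _,_; proj₁; proj₂)
open import Data.Rational.Unnormalised.Base as ℚᵘ using (ℚᵘ)
import Data.Rational.Unnormalised.Properties as ℚᵘ
open import Data.Sum.Base as Sum using (_⊎_; inj₁; inj₂; [_,_]; [_,_]′)
open import Data.Vec.Functional using (_++_)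
open import Function.Base using (_∘_)
open import Level using (0ℓ)
open import Relation.Binary.Bundles using (TotalOrder)
import Relation.Binary.Morphism.OrderMonomorphism as OrderMonomorphism
open import Relation.Binary.Definitions using (tri<; tri≈; tri>)
open import Relation.Binary.Morphism.Structures using (IsOrderMonomorphism)
open import Relation.Binary.PropositionalEquality.Core
  using (_≡_; refl; sym; trans; cong; cong₂; subst; subst₂)
open import Relation.Nullary using (¬_; Dec; yes; no; contradiction)
open import Relation.Nullary.Decidable using (map′; dec⇒maybe; _×-dec_; _⊎-dec_; decidable-stable)
open import Tactic.RingSolver.Core.AlmostCommutativeRing
  using (AlmostCommutativeRing; fromCommutativeRing)
open import Tactic.RingSolver using (solve-∀)
import Data.Integer.Tactic.RingSolver as ℤSolver

infix 7 _/2^_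

-- m /2^ k denotes m / 2ᵏ, not necessarily in lowest terms; `_≃_` is equality of values.
data 𝔻 : Set where
  _/2^_ : (numerator : ℤ) (exponent : ℕ) → 𝔻

2^_ : ℕ → ℕ
2^ k = 2 ℕ.^ k

toℚᵘ : 𝔻 → ℚᵘ
toℚᵘ (m /2^ k) = (m ℚᵘ./ 2^ k) {{ℕ.m^n≢0 2 k}}

fromℤ : ℤ → 𝔻
fromℤ n = n /2^ 0

0𝔻 -1𝔻 : 𝔻
0𝔻  = fromℤ (+ 0)
-1𝔻 = fromℤ -[1+ 0 ]

infix 4 _≃_ _≤_ _<_ _≤?_
infixl 6 _+_ _-_
infixl 7 _*_
infix 8 -_

record _≃_ (x y : 𝔻) : Set where
  constructor *≃*
  field drop-≃ : toℚᵘ x ℚᵘ.≃ toℚᵘ y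

record _≤_ (x y : 𝔻) : Set where
  constructor *≤*
  field drop-≤ : toℚᵘ x ℚᵘ.≤ toℚᵘ y

record _<_ (x y : 𝔻) : Set where
  constructor *<*
  field drop-< : toℚᵘ x ℚᵘ.< toℚᵘ y

open _≃_ public
open _≤_ public
open _<_ public

_≤?_ : ∀ x y → Dec (x ≤ y)
x ≤? y = map′ *≤* drop-≤ (toℚᵘ x ℚᵘ.≤? toℚᵘ y)

_+_ _*_ : 𝔻 → 𝔻 → 𝔻
(m /2^ k) + (n /2^ l) = (m ℤ.* + (2^ l) ℤ.+ n ℤ.* + (2^ k)) /2^ (k ℕ.+ l)
(m /2^ k) * (n /2^ l) = (m ℤ.* n) /2^ (k ℕ.+ l)

-_ : 𝔻 → 𝔻
- (m /2^ k) = (ℤ.- m) /2^ k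

_-_ : 𝔻 → 𝔻 → 𝔻
x - y = x + - y

/-homo-+ : ∀ m n a b .{{_ : ℕ.NonZero a}} .{{_ : ℕ.NonZero b}} .{{_ : ℕ.NonZero (a ℕ.* b)}} →
            (m ℤ.* + b ℤ.+ n ℤ.* + a) ℚᵘ./ (a ℕ.* b) ≡ (m ℚᵘ./ a) ℚᵘ.+ (n ℚᵘ./ b)
/-homo-+ m n (suc a) (suc b) = refl

/-homo-* : ∀ m n a b .{{_ : ℕ.NonZero a}} .{{_ : ℕ.NonZero b}} .{{_ : ℕ.NonZero (a ℕ.* b)}} →
            (m ℤ.* n) ℚᵘ./ (a ℕ.* b) ≡ (m ℚᵘ./ a) ℚᵘ.* (n ℚᵘ./ b)
/-homo-* m n (suc a) (suc b) = refl

/-homo-neg : ∀ m a .{{_ : ℕ.NonZero a}} → (ℤ.- m) ℚᵘ./ a ≡ ℚᵘ.- (m ℚᵘ./ a)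
/-homo-neg m (suc a) = refl

toℚᵘ-homo-+ : ∀ x y → toℚᵘ (x + y) ℚᵘ.≃ toℚᵘ x ℚᵘ.+ toℚᵘ y
toℚᵘ-homo-+ (m /2^ k) (n /2^ l) = ℚᵘ.≃-reflexive (trans
  (ℚᵘ./-cong {n₁ = m ℤ.* + (2^ l) ℤ.+ n ℤ.* + (2^ k)} refl (ℕ.^-distribˡ-+-* 2 k l))
  (/-homo-+ m n (2^ k) (2^ l)))
  where instance
    _ = ℕ.m^n≢0 2 k
    _ = ℕ.m^n≢0 2 l
    _ = ℕ.m^n≢0 2 (k ℕ.+ l)
    _ = ℕ.m*n≢0 (2^ k) (2^ l)

toℚᵘ-homo-* : ∀ x y → toℚᵘ (x * y) ℚᵘ.≃ toℚᵘ x ℚᵘ.* toℚᵘ y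
toℚᵘ-homo-* (m /2^ k) (n /2^ l) = ℚᵘ.≃-reflexive (trans
  (ℚᵘ./-cong {n₁ = m ℤ.* n} refl (ℕ.^-distribˡ-+-* 2 k l))
  (/-homo-* m n (2^ k) (2^ l)))
  where instance
    _ = ℕ.m^n≢0 2 k
    _ = ℕ.m^n≢0 2 l
    _ = ℕ.m^n≢0 2 (k ℕ.+ l)
    _ = ℕ.m*n≢0 (2^ k) (2^ l)

toℚᵘ-homo-neg : ∀ x → toℚᵘ (- x) ℚᵘ.≃ ℚᵘ.- toℚᵘ x
toℚᵘ-homo-neg (m /2^ k) = ℚᵘ.≃-reflexive (/-homo-neg m (2^ k))
  where instance
    _ = ℕ.m^n≢0 2 k

toℚᵘ-isRingMonomorphism : IsRingMonomorphism
  (record { _≈_ = _≃_; _+_ = _+_; _*_ = _*_; -_ = -_; 0# = 0𝔻; 1# = fromℤ (+ 1) })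
  (CommutativeRing.rawRing ℚᵘ.+-*-commutativeRing) toℚᵘ
toℚᵘ-isRingMonomorphism = record
  { isRingHomomorphism = record
    { isSemiringHomomorphism = record
      { isNearSemiringHomomorphism = record
        { +-isMonoidHomomorphism = record
          { isMagmaHomomorphism = record
            { isRelHomomorphism = record { cong = drop-≃ }
            ; homo = toℚᵘ-homo-+ }
          ; ε-homo = ℚᵘ.≃-refl }
        ; *-homo = toℚᵘ-homo-* }
      ; 1#-homo = ℚᵘ.≃-refl }
    ; -‿homo = toℚᵘ-homo-neg }
  ; injective = *≃* }

𝔻-commutativeRing : CommutativeRing 0ℓ 0ℓ
𝔻-commutativeRing = record
  { isCommutativeRing = RingMonomorphism.isCommutativeRing
      toℚᵘ-isRingMonomorphism ℚᵘ.+-*-isCommutativeRing }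

𝔻-totalOrder : TotalOrder 0ℓ 0ℓ 0ℓ
𝔻-totalOrder = record
  { isTotalOrder = OrderMonomorphism.isTotalOrder toℚᵘ-isOrderMonomorphism ℚᵘ.≤-isTotalOrder }
  where
  toℚᵘ-isOrderMonomorphism : IsOrderMonomorphism _≃_ ℚᵘ._≃_ _≤_ ℚᵘ._≤_ toℚᵘ
  toℚᵘ-isOrderMonomorphism = record
    { isOrderHomomorphism = record { cong = drop-≃ ; mono = drop-≤ }
    ; injective = *≃* ; cancel = *≤* }

open NaturalMax 𝔻-totalOrder public using (_⊔_)
open NaturalMin 𝔻-totalOrder public using (_⊓_)

max min : ∀ {n} → (Fin (suc n) → 𝔻) → 𝔻
max {zero}  f = f zero
max {suc n} f = f zero ⊔ max (f ∘ suc)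
min {zero}  f = f zero
min {suc n} f = f zero ⊓ min (f ∘ suc)

data Game : Set where
  node : ∀ {m n} (L : Fin m → Game) (R : Fin n → Game) → Game

infixl 6 _⊕_
infix 8 ⊖_

⊖_ : Game → Game
⊖ node L R = node (λ j → ⊖ R j) (λ i → ⊖ L i)

_⊕_ : Game → Game → Game
G@(node L R) ⊕ H@(node L′ R′) =
  node ((λ i → L i ⊕ H) ++ (λ i → G ⊕ L′ i)) ((λ j → R j ⊕ H) ++ (λ j → G ⊕ R′ j))

mutual
  LeftWinsMovingSecond : Game → Set
  LeftWinsMovingSecond (node L R) = ∀ j → LeftWinsMovingFirst (R j)

  LeftWinsMovingFirst : Game → Set
  LeftWinsMovingFirst (node L R) = ∃ λ i → LeftWinsMovingSecond (L i)

infix 4 _≥ᴳ_ _≈ᴳ_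

_≥ᴳ_ _≈ᴳ_ : Game → Game → Set
G ≥ᴳ H = LeftWinsMovingSecond (G ⊕ ⊖ H)
G ≈ᴳ H = G ≥ᴳ H × H ≥ᴳ G

integer : ℤ → Game
integer (+ zero)       = node {0} {0} (λ ()) (λ ())
integer (+ suc n)      = node {1} {0} (λ _ → integer (+ n)) (λ ())
integer -[1+ zero ]    = node {0} {1} (λ ()) (λ _ → integer (+ zero))
integer -[1+ suc n ]   = node {0} {1} (λ ()) (λ _ → integer -[1+ n ])

-- For odd m = 2q + 1 the canonical form of m / 2ᵏ⁺¹ is { q / 2ᵏ | (q + 1) / 2ᵏ }.
canonicalForm : ℤ → ℕ → Game
canonicalForm m zero = integer m
canonicalForm m (suc k) with m ℤ.%ℕ 2
... | zero  = canonicalForm (m ℤ./ℕ 2) k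
... | suc _ = node {1} {1} (λ _ → canonicalForm (m ℤ./ℕ 2) k)
                           (λ _ → canonicalForm (ℤ.suc (m ℤ./ℕ 2)) k)

canonical : 𝔻 → Game
canonical (m /2^ k) = canonicalForm m k

IsInteger : Game → Set
IsInteger G = ∃ λ n → G ≈ᴳ integer n

IsLeast : (𝔻 → Set) → 𝔻 → Set
IsLeast P x = P x × (∀ y → P y → x ≤ y)

-- λ̃ₜ and ρ̃ₜ only matter for games not equal to an integer. Those have options for both
-- players (`options-nonempty`), so the extrema range over nonempty families.
record Cooling : Set where
  field
    λₜ ρₜ : 𝔻 → Game → 𝔻
    cool  : 𝔻 → Game → Game
    -- `nothing` stands for −∞.
    temp  : Game → Maybe 𝔻

  λ̃ₜ : ∀ {m} → 𝔻 → (Fin (suc m) → Game) → 𝔻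
  λ̃ₜ t L = max (λ i → ρₜ t (L i) - t)

  ρ̃ₜ : ∀ {n} → 𝔻 → (Fin (suc n) → Game) → 𝔻
  ρ̃ₜ t R = min (λ j → λₜ t (R j) + t)

  field
    integer-temp : ∀ {G} n → G ≈ᴳ integer n → temp G ≡ nothing
    integer-λₜ   : ∀ {G} n t → G ≈ᴳ integer n → λₜ t G ≃ fromℤ n
    integer-ρₜ   : ∀ {G} n t → G ≈ᴳ integer n → ρₜ t G ≃ fromℤ n
    integer-cool : ∀ {G} n t → G ≈ᴳ integer n → cool t G ≡ integer n

    temp-least : ∀ {m n} (L : Fin (suc m) → Game) (R : Fin (suc n) → Game) →
                 ¬ IsInteger (node L R) →
                 ∃ λ τ → temp (node L R) ≡ just τ × IsLeast (λ t → λ̃ₜ t L ≃ ρ̃ₜ t R) τ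

    below-λₜ   : ∀ {m n} (L : Fin (suc m) → Game) (R : Fin (suc n) → Game) {τ} t →
                 temp (node L R) ≡ just τ → t ≤ τ → λₜ t (node L R) ≃ λ̃ₜ t L
    below-ρₜ   : ∀ {m n} (L : Fin (suc m) → Game) (R : Fin (suc n) → Game) {τ} t →
                 temp (node L R) ≡ just τ → t ≤ τ → ρₜ t (node L R) ≃ ρ̃ₜ t R
    below-cool : ∀ {m n} (L : Fin (suc m) → Game) (R : Fin (suc n) → Game) {τ} t →
                 temp (node L R) ≡ just τ → t ≤ τ →
                 cool t (node L R) ≡ node (λ i → cool t (L i) ⊕ canonical (- t))
                                          (λ j → cool t (R j) ⊕ canonical t)

    above-λₜ   : ∀ {G τ} t → temp G ≡ just τ → τ < t → λₜ t G ≃ λₜ τ G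
    above-ρₜ   : ∀ {G τ} t → temp G ≡ just τ → τ < t → ρₜ t G ≃ λₜ τ G
    above-cool : ∀ {G τ} t → temp G ≡ just τ → τ < t → cool t G ≡ canonical (λₜ τ G)

∃-split : ∀ {m n} {f : Fin m → Game} {g : Fin n → Game} (P : Game → Set) (s : Fin m ⊎ Fin n) →
          P ([ f , g ] s) → (∃ λ i → P (f i)) ⊎ (∃ λ j → P (g j))
∃-split P (inj₁ i) p = inj₁ (i , p)
∃-split P (inj₂ j) p = inj₂ (j , p)

mutual
  _⊒_ _▷_ : Game → Game → Set
  G@(node L R) ⊒ H@(node L′ R′) = (∀ j → R j ▷ H) × (∀ i → G ▷ L′ i)
  G@(node L R) ▷ H@(node L′ R′) = (∃ λ i → L i ⊒ H) ⊎ (∃ λ j → G ⊒ R′ j)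

infix 4 _⊒_ _▷_ _⊒?_ _▷?_

mutual
  ≥ᴳ⇒⊒ : ∀ G H → G ≥ᴳ H → G ⊒ H
  ≥ᴳ⇒⊒ G@(node {m} {n} L R) H@(node {m′} {n′} L′ R′) p =
    (λ j → first⇒▷ (R j) H (subst LeftWinsMovingFirst (cong [ _ , _ ] (splitAt-↑ˡ n j m′)) (p (j ↑ˡ m′)))) ,
    (λ i → first⇒▷ G (L′ i) (subst LeftWinsMovingFirst (cong [ _ , _ ] (splitAt-↑ʳ n m′ i)) (p (n ↑ʳ i))))

  first⇒▷ : ∀ G H → LeftWinsMovingFirst (G ⊕ ⊖ H) → G ▷ H
  first⇒▷ G@(node {m} {n} L R) H@(node {m′} {n′} L′ R′) (k , p) =
    Sum.map (λ (i , q) → i , ≥ᴳ⇒⊒ (L i) H q) (λ (j , q) → j , ≥ᴳ⇒⊒ G (R′ j) q)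
            (∃-split LeftWinsMovingSecond (splitAt m k) p)

mutual
  ⊒⇒≥ᴳ : ∀ G H → G ⊒ H → G ≥ᴳ H
  ⊒⇒≥ᴳ G@(node {m} {n} L R) H@(node {m′} {n′} L′ R′) (p , q) k with splitAt n {m′} k
  ... | inj₁ j = ▷⇒first (R j) H (p j)
  ... | inj₂ i = ▷⇒first G (L′ i) (q i)

  ▷⇒first : ∀ G H → G ▷ H → LeftWinsMovingFirst (G ⊕ ⊖ H)
  ▷⇒first G@(node {m} {n} L R) H@(node {m′} {n′} L′ R′) (inj₁ (i , p)) =
    i ↑ˡ n′ , subst LeftWinsMovingSecond (cong [ _ , _ ] (sym (splitAt-↑ˡ m i n′))) (⊒⇒≥ᴳ (L i) H p)
  ▷⇒first G@(node {m} {n} L R) H@(node {m′} {n′} L′ R′) (inj₂ (j , p)) =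
    m ↑ʳ j , subst LeftWinsMovingSecond (cong [ _ , _ ] (sym (splitAt-↑ʳ m n′ j))) (⊒⇒≥ᴳ G (R′ j) p)

mutual
  _⊒?_ : ∀ G H → Dec (G ⊒ H)
  G@(node L R) ⊒? H@(node L′ R′) = all? (λ j → R j ▷? H) ×-dec all? (λ i → G ▷? L′ i)

  _▷?_ : ∀ G H → Dec (G ▷ H)
  G@(node L R) ▷? H@(node L′ R′) = any? (λ i → L i ⊒? H) ⊎-dec any? (λ j → G ⊒? R′ j)

⊒-refl : ∀ G → G ⊒ G
⊒-refl G@(node L R) = (λ j → right (R j) (⊒-refl (R j))) , (λ i → left (L i) (⊒-refl (L i)))
  where
  right : ∀ {m n} {L : Fin m → Game} {R : Fin n → Game} {j} G′ → G′ ⊒ R j → G′ ▷ node L R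
  right {j = j} (node _ _) p = inj₂ (j , p)
  left : ∀ {m n} {L : Fin m → Game} {R : Fin n → Game} {i} G′ → L i ⊒ G′ → node L R ▷ G′
  left {i = i} (node _ _) p = inj₁ (i , p)

mutual
  ⊒-trans : ∀ G H K → G ⊒ H → H ⊒ K → G ⊒ K
  ⊒-trans G@(node L R) H@(node L′ R′) K@(node L″ R″) GH@(p , q) HK@(r , s) =
    (λ j → ▷-⊒-trans (R j) H K (p j) HK) , (λ i → ⊒-▷-trans G H (L″ i) GH (s i))

  ⊒-▷-trans : ∀ G H K → G ⊒ H → H ▷ K → G ▷ K
  ⊒-▷-trans G@(node L R) H@(node L′ R′) K@(node L″ R″) (p , q) (inj₁ (i , r)) =
    ▷-⊒-trans G (L′ i) K (q i) r
  ⊒-▷-trans G@(node L R) H@(node L′ R′) K@(node L″ R″) GH (inj₂ (j , r)) =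
    inj₂ (j , ⊒-trans G H (R″ j) GH r)

  ▷-⊒-trans : ∀ G H K → G ▷ H → H ⊒ K → G ▷ K
  ▷-⊒-trans G@(node L R) H@(node L′ R′) K@(node L″ R″) (inj₁ (i , p)) HK =
    inj₁ (i , ⊒-trans (L i) H K p HK)
  ▷-⊒-trans G@(node L R) H@(node L′ R′) K@(node L″ R″) (inj₂ (j , p)) (r , s) =
    ⊒-▷-trans G (R′ j) K p (r j)

mutual
  ⊒⇒¬▷ : ∀ G H → G ⊒ H → ¬ (H ▷ G)
  ⊒⇒¬▷ G@(node L R) H@(node L′ R′) (p , q) (inj₁ (i , r)) = ▷⇒¬⊒ G (L′ i) (q i) r
  ⊒⇒¬▷ G@(node L R) H@(node L′ R′) (p , q) (inj₂ (j , r)) = ▷⇒¬⊒ (R j) H (p j) r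

  ▷⇒¬⊒ : ∀ G H → G ▷ H → ¬ (H ⊒ G)
  ▷⇒¬⊒ G@(node L R) H@(node L′ R′) (inj₁ (i , p)) (r , s) = ⊒⇒¬▷ (L i) H p (s i)
  ▷⇒¬⊒ G@(node L R) H@(node L′ R′) (inj₂ (j , p)) (r , s) = ⊒⇒¬▷ G (R′ j) p (r j)

mutual
  ¬▷⇒⊒ : ∀ G H → ¬ (H ▷ G) → G ⊒ H
  ¬▷⇒⊒ G@(node L R) H@(node L′ R′) ¬p =
    (λ j → ¬⊒⇒▷ (R j) H (λ q → ¬p (inj₂ (j , q)))) ,
    (λ i → ¬⊒⇒▷ G (L′ i) (λ q → ¬p (inj₁ (i , q))))

  ¬⊒⇒▷ : ∀ G H → ¬ (H ⊒ G) → G ▷ H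
  ¬⊒⇒▷ G@(node L R) H@(node L′ R′) ¬p = decidable-stable (G ▷? H)
    λ ¬q → ¬p (¬▷⇒⊒ H G ¬q)

▷-suc : ∀ G n → G ⊒ integer (ℤ.suc n) → G ▷ integer n
▷-suc (node _ _) (+ n)          (_ , q) = q zero
▷-suc (node _ _) -[1+ zero ]    p = inj₂ (zero , p)
▷-suc (node _ _) -[1+ suc n ]   p = inj₂ (zero , p)

suc-▷ : ∀ G n → integer n ⊒ G → integer (ℤ.suc n) ▷ G
suc-▷ (node _ _) (+ n)        p = inj₁ (zero , p)
suc-▷ (node _ _) -[1+ zero ]  (p , _) = p zero
suc-▷ (node _ _) -[1+ suc n ] (p , _) = p zero

integer-suc▷ : ∀ n → integer (ℤ.suc n) ▷ integer n
integer-suc▷ n = ▷-suc (integer (ℤ.suc n)) n (⊒-refl (integer (ℤ.suc n)))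

integer-suc⊒ : ∀ n → integer (ℤ.suc n) ⊒ integer n
integer-suc⊒ (+ zero)        = (λ ()) , (λ ())
integer-suc⊒ (+ suc n)       = (λ ()) , λ _ →
  ▷-⊒-trans (integer (+ suc (suc n))) (integer (+ suc n)) (integer (+ n))
    (integer-suc▷ (+ suc n)) (integer-suc⊒ (+ n))
integer-suc⊒ -[1+ zero ]     = (λ ()) , (λ ())
integer-suc⊒ -[1+ suc zero ] = (λ _ →
  ⊒-▷-trans (integer (+ 0)) (integer -[1+ 0 ]) (integer -[1+ 1 ])
    (integer-suc⊒ -[1+ 0 ]) (integer-suc▷ -[1+ 1 ])) , (λ ())
integer-suc⊒ -[1+ suc (suc n) ] = (λ _ →
  ⊒-▷-trans (integer -[1+ n ]) (integer -[1+ suc n ]) (integer -[1+ suc (suc n) ])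
    (integer-suc⊒ -[1+ suc n ]) (integer-suc▷ -[1+ suc (suc n) ])) , (λ ())

integer-mono-≤ : ∀ {m n} → m ℤ.≤ n → integer n ⊒ integer m
integer-mono-≤ {m} {n} m≤n = subst (λ k → integer k ⊒ integer m) n≡ (go ℤ.∣ n ℤ.- m ∣)
  where
  n≡ : + ℤ.∣ n ℤ.- m ∣ ℤ.+ m ≡ n
  n≡ = trans (cong (ℤ._+ m) (ℤ.0≤i⇒+∣i∣≡i (ℤ.i≤j⇒0≤j-i m≤n))) (ℤSolver.solve (n ∷ m ∷ []))
  go : ∀ d → integer (+ d ℤ.+ m) ⊒ integer m
  go zero    = subst (λ k → integer k ⊒ integer m) (sym (ℤ.+-identityˡ m)) (⊒-refl (integer m))
  go (suc d) = ⊒-trans (integer (+ suc d ℤ.+ m)) (integer (+ d ℤ.+ m)) (integer m)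
    (subst (λ k → integer k ⊒ integer (+ d ℤ.+ m)) (sym (ℤ.+-assoc (+ 1) (+ d) m))
      (integer-suc⊒ (+ d ℤ.+ m)))
    (go d)

integer-mono-< : ∀ {m n} → m ℤ.< n → integer n ▷ integer m
integer-mono-< {m} {n} m<n = ⊒-▷-trans (integer n) (integer (ℤ.suc m)) (integer m)
  (integer-mono-≤ (ℤ.i<j⇒suc[i]≤j m<n)) (integer-suc▷ m)

integer-cancel-≤ : ∀ {m n} → integer n ⊒ integer m → m ℤ.≤ n
integer-cancel-≤ {m} {n} p = ℤ.≮⇒≥ λ n<m → ▷⇒¬⊒ (integer m) (integer n) (integer-mono-< n<m) p

⊒-integer : ∀ {m n} (L : Fin m → Game) (R : Fin n → Game) k →
            (∀ j → R j ▷ integer k) → node L R ▷ integer (ℤ.pred k) → node L R ⊒ integer k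
⊒-integer L R (+ zero)       p q = p , (λ ())
⊒-integer L R (+ suc k)      p q = p , (λ _ → q)
⊒-integer L R -[1+ zero ]    p q = p , (λ ())
⊒-integer L R -[1+ suc k ]   p q = p , (λ ())

integer-⊒ : ∀ {m n} (L : Fin m → Game) (R : Fin n → Game) k →
            (∀ i → integer k ▷ L i) → integer (ℤ.suc k) ▷ node L R → integer k ⊒ node L R
integer-⊒ L R (+ zero)       p q = (λ ()) , p
integer-⊒ L R (+ suc k)      p q = (λ ()) , p
integer-⊒ L R -[1+ zero ]    p q = (λ _ → q) , p
integer-⊒ L R -[1+ suc k ]   p q = (λ _ → q) , p

▷-integer-≤ : ∀ G {k l} → k ℤ.≤ l → G ▷ integer l → G ▷ integer k
▷-integer-≤ G {k} {l} k≤l p = ▷-⊒-trans G (integer l) (integer k) p (integer-mono-≤ k≤l)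

integer-▷-≤ : ∀ G {k l} → k ℤ.≤ l → integer k ▷ G → integer l ▷ G
integer-▷-≤ G {k} {l} k≤l p = ⊒-▷-trans (integer l) (integer k) G (integer-mono-≤ k≤l) p

module _ {m n} (L : Fin m → Game) (R : Fin n → Game) where
  Separates : ℤ → Set
  Separates k = (∀ i → integer k ▷ L i) × (∀ j → R j ▷ integer k)

  EqualsInteger : Set
  EqualsInteger = ∃ λ k → node L R ⊒ integer k × integer k ⊒ node L R

  separates⁺ : ∀ k → Separates (+ k) → EqualsInteger
  separates⁺ zero    (p , q) = + 0 , (q , (λ ())) , ((λ ()) , p)
  separates⁺ (suc k) (p , q) with all? (λ i → integer (+ k) ▷? L i)
  ... | yes p′ = separates⁺ k (p′ , λ j → ▷-integer-≤ (R j) (ℤ.i≤suc[i] (+ k)) (q j))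
  ... | no ¬p′ = let i , ¬k▷Li = ¬∀⟶∃¬ _ _ (λ i → integer (+ k) ▷? L i) ¬p′ in
    + suc k , (q , λ _ → left i (¬▷⇒⊒ (L i) (integer (+ k)) ¬k▷Li)) , ((λ ()) , p)
    where
    left : ∀ i → L i ⊒ integer (+ k) → node L R ▷ integer (+ k)
    left i r with integer (+ k)
    ... | node _ _ = inj₁ (i , r)

  separates⁻ : ∀ k → Separates -[1+ k ] → EqualsInteger
  separates⁻ k (p , q) with all? (λ j → R j ▷? integer (ℤ.suc -[1+ k ]))
  separates⁻ zero    (p , q) | yes q′ =
    separates⁺ 0 ((λ i → integer-▷-≤ (L i) (ℤ.i≤suc[i] -[1+ 0 ]) (p i)) , q′)
  separates⁻ (suc k) (p , q) | yes q′ =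
    separates⁻ k ((λ i → integer-▷-≤ (L i) (ℤ.i≤suc[i] -[1+ suc k ]) (p i)) , q′)
  separates⁻ k       (p , q) | no ¬q′ =
    let j , ¬Rj▷k = ¬∀⟶∃¬ _ _ (λ j → R j ▷? integer (ℤ.suc -[1+ k ])) ¬q′ in
    -[1+ k ] , ⊒-neg k q ,
    integer-⊒ L R -[1+ k ] p (right j (¬▷⇒⊒ (integer (ℤ.suc -[1+ k ])) (R j) ¬Rj▷k))
    where
    ⊒-neg : ∀ k → (∀ j → R j ▷ integer -[1+ k ]) → node L R ⊒ integer -[1+ k ]
    ⊒-neg zero    q = q , (λ ())
    ⊒-neg (suc k) q = q , (λ ())
    right : ∀ j → integer (ℤ.suc -[1+ k ]) ⊒ R j → integer (ℤ.suc -[1+ k ]) ▷ node L R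
    right j r with integer (ℤ.suc -[1+ k ])
    ... | node _ _ = inj₂ (j , r)

  separates⇒integer : ∀ k → Separates k → EqualsInteger
  separates⇒integer (+ k)    = separates⁺ k
  separates⇒integer -[1+ k ] = separates⁻ k

≈ᴳ⇒⊒ : ∀ G H → G ≈ᴳ H → G ⊒ H × H ⊒ G
≈ᴳ⇒⊒ G H (p , q) = ≥ᴳ⇒⊒ G H p , ≥ᴳ⇒⊒ H G q

⊒⇒≈ᴳ : ∀ G H → G ⊒ H × H ⊒ G → G ≈ᴳ H
⊒⇒≈ᴳ G H (p , q) = ⊒⇒≥ᴳ G H p , ⊒⇒≥ᴳ H G q

lowerBound : ∀ {n} (f : Fin n → ℤ) → ∃ λ k → ∀ j → k ℤ.< f j
lowerBound {zero}  f = + 0 , λ ()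
lowerBound {suc n} f with lowerBound (f ∘ suc)
... | k , k<f = k ℤ.⊓ ℤ.pred (f zero) , λ
  { zero    → ℤ.≤-<-trans (ℤ.i⊓j≤j k _) (ℤ.suc[i]≤j⇒i<j (ℤ.≤-reflexive (ℤ.suc-pred (f zero))))
  ; (suc j) → ℤ.≤-<-trans (ℤ.i⊓j≤i k _) (k<f j) }

upperBound : ∀ {n} (f : Fin n → ℤ) → ∃ λ k → ∀ j → f j ℤ.< k
upperBound f with lowerBound (ℤ.-_ ∘ f)
... | k , k<f = ℤ.- k , λ j → ℤ.neg-cancel-< (subst (ℤ._< ℤ.- f j) (sym (ℤ.neg-involutive k)) (k<f j))

𝔻-ring : AlmostCommutativeRing 0ℓ 0ℓ
𝔻-ring = fromCommutativeRing 𝔻-commutativeRing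
  (λ x → dec⇒maybe (map′ *≃* drop-≃ (toℚᵘ (fromℤ (+ 0)) ℚᵘ.≃? toℚᵘ x)))

open CommutativeRing 𝔻-commutativeRing public using (+-cong; -‿cong)
  renaming (refl to ≃-refl; sym to ≃-sym; trans to ≃-trans)
open TotalOrder 𝔻-totalOrder public using ()
  renaming (refl to ≤-refl; reflexive to ≤-reflexive; trans to ≤-trans; antisym to ≤-antisym;
            total to ≤-total; ≤-respˡ-≈ to ≤-respˡ-≃; ≤-respʳ-≈ to ≤-respʳ-≃)

+-congˡ : ∀ x {y z} → y ≃ z → x + y ≃ x + z
+-congˡ x = +-cong (≃-refl {x})

+-congʳ : ∀ {x y} z → x ≃ y → x + z ≃ y + z
+-congʳ z x≃y = +-cong x≃y (≃-refl {z})

≰⇒≥ : ∀ {x y} → ¬ (x ≤ y) → y ≤ x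
≰⇒≥ {x} {y} x≰y with ≤-total x y
... | inj₁ x≤y = contradiction x≤y x≰y
... | inj₂ y≤x = y≤x

<⇒≱ : ∀ {x y} → x < y → ¬ (y ≤ x)
<⇒≱ (*<* x<y) (*≤* y≤x) = ℚᵘ.<⇒≱ x<y y≤x

≰⇒> : ∀ {x y} → ¬ (x ≤ y) → y < x
≰⇒> x≰y = *<* (ℚᵘ.≰⇒> (x≰y ∘ *≤*))

+-mono-≤ : ∀ {x y u v} → x ≤ y → u ≤ v → x + u ≤ y + v
+-mono-≤ {x} {y} {u} {v} (*≤* p) (*≤* q) = *≤* (ℚᵘ.≤-respˡ-≃ (ℚᵘ.≃-sym (toℚᵘ-homo-+ x u))
  (ℚᵘ.≤-respʳ-≃ (ℚᵘ.≃-sym (toℚᵘ-homo-+ y v)) (ℚᵘ.+-mono-≤ p q)))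

neg-mono-≤ : ∀ {x y} → x ≤ y → - y ≤ - x
neg-mono-≤ {x} {y} (*≤* p) = *≤* (ℚᵘ.≤-respˡ-≃ (ℚᵘ.≃-sym (toℚᵘ-homo-neg y))
  (ℚᵘ.≤-respʳ-≃ (ℚᵘ.≃-sym (toℚᵘ-homo-neg x)) (ℚᵘ.neg-mono-≤ p)))

by-≤ : ∀ {x y a b} → a ≤ b → y - x ≃ b - a → x ≤ y
by-≤ {x} {y} {a} {b} a≤b eq =
  ≤-respˡ-≃ (lhs a x) (≤-respʳ-≃ (≃-trans (+-cong (≃-sym eq) ≃-refl) (rhs x y))
    (≤-respʳ-≃ (mid a b x) (+-mono-≤ a≤b (≤-refl {x - a}))))
  where
  lhs : ∀ a x → a + (x - a) ≃ x
  lhs = solve-∀ 𝔻-ring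
  mid : ∀ a b x → b + (x - a) ≃ (b - a) + x
  mid = solve-∀ 𝔻-ring
  rhs : ∀ x y → (y - x) + x ≃ y
  rhs = solve-∀ 𝔻-ring

by-≤₂ : ∀ {x y a b c d} → a ≤ b → c ≤ d → y - x ≃ (b - a) + (d - c) → x ≤ y
by-≤₂ {x} {y} {a} {b} {c} {d} a≤b c≤d eq = by-≤ (+-mono-≤ a≤b c≤d) (≃-trans eq (lem a b c d))
  where
  lem : ∀ a b c d → (b - a) + (d - c) ≃ (b + d) - (a + c)
  lem = solve-∀ 𝔻-ring

by-≃ : ∀ {x y a b} → a ≃ b → y - x ≃ b - a → x ≃ y
by-≃ {x} {y} {a} {b} a≃b eq = ≤-antisym (by-≤ (≤-reflexive a≃b) eq)
  (by-≤ (≤-reflexive (≃-sym a≃b)) (≃-trans (lem x y) (≃-trans (-‿cong eq) (≃-sym (lem a b)))))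
  where
  lem : ∀ x y → x - y ≃ - (y - x)
  lem = solve-∀ 𝔻-ring

open NaturalMax 𝔻-totalOrder public using (x≤x⊔y; x≤y⊔x; ⊔-lub; ⊔-cong; ⊔-mono-≤; ⊔-sel)
  renaming (x≤y⇒x⊔y≈y to x≤y⇒x⊔y≃y; x≤y⇒y⊔x≈y to x≤y⇒y⊔x≃y)
open NaturalMin 𝔻-totalOrder public using (⊓-sel; ⊓-mono-≤)
  renaming (x⊓y≤x to x⊓y≤x; x⊓y≤y to x⊓y≤y; ⊓-glb to ⊓-glb; x≤y⇒x⊓y≈x to x≤y⇒x⊓y≃x; x≤y⇒y⊓x≈x to x≤y⇒y⊓x≃x)

≤-max : ∀ {n} (f : Fin (suc n) → 𝔻) i → f i ≤ max f
≤-max {zero}  f zero    = ≤-refl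
≤-max {suc n} f zero    = x≤x⊔y (f zero) (max (f ∘ suc))
≤-max {suc n} f (suc i) = ≤-trans (≤-max (f ∘ suc) i) (x≤y⊔x (f zero) (max (f ∘ suc)))

max-lub : ∀ {n} (f : Fin (suc n) → 𝔻) {x} → (∀ i → f i ≤ x) → max f ≤ x
max-lub {zero}  f f≤x = f≤x zero
max-lub {suc n} f f≤x = ⊔-lub (f≤x zero) (max-lub (f ∘ suc) (f≤x ∘ suc))

max-attained : ∀ {n} (f : Fin (suc n) → 𝔻) → ∃ λ i → max f ≃ f i
max-attained {zero}  f = zero , ≃-refl
max-attained {suc n} f with ⊔-sel (f zero) (max (f ∘ suc)) | max-attained (f ∘ suc)
... | inj₁ eq | _       = zero , eq
... | inj₂ eq | i , eq′ = suc i , ≃-trans eq eq′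

min-≤ : ∀ {n} (f : Fin (suc n) → 𝔻) i → min f ≤ f i
min-≤ {zero}  f zero    = ≤-refl
min-≤ {suc n} f zero    = x⊓y≤x (f zero) (min (f ∘ suc))
min-≤ {suc n} f (suc i) = ≤-trans (x⊓y≤y (f zero) (min (f ∘ suc))) (min-≤ (f ∘ suc) i)

min-glb : ∀ {n} (f : Fin (suc n) → 𝔻) {x} → (∀ i → x ≤ f i) → x ≤ min f
min-glb {zero}  f x≤f = x≤f zero
min-glb {suc n} f x≤f = ⊓-glb (x≤f zero) (min-glb (f ∘ suc) (x≤f ∘ suc))

min-attained : ∀ {n} (f : Fin (suc n) → 𝔻) → ∃ λ i → min f ≃ f i
min-attained {zero}  f = zero , ≃-refl
min-attained {suc n} f with ⊓-sel (f zero) (min (f ∘ suc)) | min-attained (f ∘ suc)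
... | inj₁ eq | _       = zero , eq
... | inj₂ eq | i , eq′ = suc i , ≃-trans eq eq′

neg-min : ∀ {n} (f : Fin (suc n) → 𝔻) → - min f ≃ max (λ i → - f i)
neg-min f = ≤-antisym (by-≤ (≤-trans (neg-mono-≤ (≤-reflexive (≃-sym (proj₂ att))))
                                     (≤-max (λ i → - f i) (proj₁ att))) ≃-refl)
                      (max-lub (λ i → - f i) (λ i → neg-mono-≤ (min-≤ f i)))
  where att = min-attained f

/2^-homo-+ : ∀ u v N → (u ℤ.+ v) /2^ N ≃ u /2^ N + v /2^ N
/2^-homo-+ u v N = *≃* (ℚᵘ.≃-trans
  (ℚᵘ.≃-sym (ℚᵘ.*-cancelʳ-/ (2^ N) {u ℤ.+ v} {2^ N}))
  (ℚᵘ.≃-trans (ℚᵘ.≃-reflexive (trans (ℚᵘ./-cong (ℤ.*-distribʳ-+ (+ (2^ N)) u v) refl)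
                                      (/-homo-+ u v (2^ N) (2^ N))))
              (ℚᵘ.≃-sym (toℚᵘ-homo-+ (u /2^ N) (v /2^ N)))))
  where instance
    _ = ℕ.m^n≢0 2 N
    _ = ℕ.m*n≢0 (2^ N) (2^ N)

/2^-mono-≤ : ∀ {u v} N → u ℤ.≤ v → u /2^ N ≤ v /2^ N
/2^-mono-≤ {u} {v} N u≤v = *≤* (ℚᵘ.*≤* (subst₂ ℤ._≤_
  (cong₂ ℤ._*_ (sym (ℚᵘ.↥[n/d]≡n u (2^ N))) (sym (ℚᵘ.↧[n/d]≡d v (2^ N))))
  (cong₂ ℤ._*_ (sym (ℚᵘ.↥[n/d]≡n v (2^ N))) (sym (ℚᵘ.↧[n/d]≡d u (2^ N))))
  (ℤ.*-monoʳ-≤-nonNeg (+ (2^ N)) u≤v)))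
  where instance
    _ = ℕ.m^n≢0 2 N

/2^-mono-< : ∀ {u v} N → u ℤ.< v → u /2^ N < v /2^ N
/2^-mono-< {u} {v} N u<v = *<* (ℚᵘ.*<* (subst₂ ℤ._<_
  (cong₂ ℤ._*_ (sym (ℚᵘ.↥[n/d]≡n u (2^ N))) (sym (ℚᵘ.↧[n/d]≡d v (2^ N))))
  (cong₂ ℤ._*_ (sym (ℚᵘ.↥[n/d]≡n v (2^ N))) (sym (ℚᵘ.↧[n/d]≡d u (2^ N))))
  (ℤ.*-monoʳ-<-pos (+ (2^ N)) {{ℤ.positive (ℤ.+<+ (ℕ.m^n>0 2 N))}} u<v)))
  where instance
    _ = ℕ.m^n≢0 2 N

/2^-cancel-≤ : ∀ {u v} N → u /2^ N ≤ v /2^ N → u ℤ.≤ v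
/2^-cancel-≤ N p = ℤ.≮⇒≥ λ v<u → <⇒≱ (/2^-mono-< N v<u) p

/2^-refine : ∀ u N d → (u ℤ.* + (2^ d)) /2^ (N ℕ.+ d) ≃ u /2^ N
/2^-refine u N d = *≃* (ℚᵘ.≃-trans
  (ℚᵘ.≃-reflexive (ℚᵘ./-cong {n₁ = u ℤ.* + (2^ d)} refl (ℕ.^-distribˡ-+-* 2 N d)))
  (ℚᵘ.*-cancelʳ-/ (2^ d) {u} {2^ N}))
  where instance
    _ = ℕ.m^n≢0 2 N
    _ = ℕ.m^n≢0 2 d
    _ = ℕ.m^n≢0 2 (N ℕ.+ d)
    _ = ℕ.m*n≢0 (2^ N) (2^ d)

fromℤ-on-grid : ∀ n N → (n ℤ.* + (2^ N)) /2^ N ≃ fromℤ n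
fromℤ-on-grid n N = /2^-refine n 0 N

≤-bound : ∀ x → ∃ λ k → x ≤ fromℤ (+ k)
≤-bound (m /2^ N) = ℤ.∣ m ∣ , ≤-trans (/2^-mono-≤ N m≤) (≤-reflexive (fromℤ-on-grid (+ ℤ.∣ m ∣) N))
  where
  i≤∣i∣ : ∀ i → i ℤ.≤ + ℤ.∣ i ∣
  i≤∣i∣ (+ n)    = ℤ.≤-refl
  i≤∣i∣ -[1+ n ] = ℤ.-≤+
  m≤ : m ℤ.≤ + ℤ.∣ m ∣ ℤ.* + (2^ N)
  m≤ = ℤ.≤-trans (i≤∣i∣ m) (subst (+ ℤ.∣ m ∣ ℤ.≤_) (ℤ.pos-* ℤ.∣ m ∣ (2^ N))
    (ℤ.+≤+ (ℕ.m≤m*n ℤ.∣ m ∣ (2^ N) {{ℕ.m^n≢0 2 N}})))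

-- The grid points −1, −1 + 2⁻ᴺ, −1 + 2 · 2⁻ᴺ, …
grid : ℕ → ℕ → 𝔻
grid N i = -1𝔻 + (+ i) /2^ N

step : ℕ → 𝔻
step N = (+ 1) /2^ N

grid-suc : ∀ N i → grid N (suc i) ≃ grid N i + step N
grid-suc N i = ≃-trans (+-congˡ -1𝔻 (/2^-homo-+ (+ 1) (+ i) N))
                       (lem -1𝔻 (step N) ((+ i) /2^ N))
  where
  lem : ∀ a b c → a + (b + c) ≃ (a + c) + b
  lem = solve-∀ 𝔻-ring

0/2^ : ∀ N → (+ 0) /2^ N ≃ 0𝔻
0/2^ N = fromℤ-on-grid (+ 0) N

grid-zero : ∀ N → grid N 0 ≃ -1𝔻
grid-zero N = ≃-trans (+-congˡ -1𝔻 (0/2^ N)) (*≃* (ℚᵘ.*≡* refl))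

step-double : ∀ N → step N ≃ step (suc N) + step (suc N)
step-double N = ≃-trans (≃-sym (/2^-refine (+ 1) N 1))
  (subst (λ k → (+ 2) /2^ k ≃ step (suc N) + step (suc N)) (sym (ℕ.+-comm N 1))
         (/2^-homo-+ (+ 1) (+ 1) (suc N)))

0≤step : ∀ N → 0𝔻 ≤ step N
0≤step N = ≤-respˡ-≃ (0/2^ N) (/2^-mono-≤ N (ℤ.+≤+ ℕ.z≤n))

grid-mono : ∀ N {i j} → i ℕ.≤ j → grid N i ≤ grid N j
grid-mono N i≤j = +-mono-≤ (≤-refl { -1𝔻}) (/2^-mono-≤ N (ℤ.+≤+ i≤j))

OnGrid : ℕ → 𝔻 → Set
OnGrid N x = ∃ λ i → x ≃ grid N i

onGrid-refine : ∀ {N K} → N ℕ.≤ K → ∀ {x} → OnGrid N x → OnGrid K x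
onGrid-refine {N} {K} N≤K (i , x≃) = i ℕ.* (2^ (K ℕ.∸ N)) ,
  ≃-trans x≃ (+-congˡ -1𝔻 (≃-sym eq))
  where
  eq : (+ (i ℕ.* (2^ (K ℕ.∸ N)))) /2^ K ≃ (+ i) /2^ N
  eq = subst₂ (λ u k → u /2^ k ≃ (+ i) /2^ N) (sym (ℤ.pos-* i (2^ (K ℕ.∸ N))))
              (ℕ.m+[n∸m]≡n N≤K) (/2^-refine (+ i) N (K ℕ.∸ N))

midpoint-onGrid : ∀ N i → OnGrid (suc N) (grid N i + step (suc N))
midpoint-onGrid N i with onGrid-refine (ℕ.n≤1+n N) {grid N i} (i , ≃-refl)
... | j , eq = suc j , ≃-trans (+-congʳ (step (suc N)) eq) (≃-sym (grid-suc (suc N) j))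

drop : Bool → 𝔻 → 𝔻
drop false x = 0𝔻
drop true  x = x

drop-nonNeg : ∀ σ {x} → 0𝔻 ≤ x → 0𝔻 ≤ drop σ x
drop-nonNeg false 0≤x = ≤-refl
drop-nonNeg true  0≤x = 0≤x

drop-upper : ∀ σ {x} → 0𝔻 ≤ x → drop σ x ≤ x
drop-upper false 0≤x = 0≤x
drop-upper true  0≤x = ≤-refl

-- On the i-th interval of the grid the function is affine with slope 0 or −1,
-- starting at an integral multiple of the grid width.
Affine : ℕ → (𝔻 → 𝔻) → ℕ → Bool → ℤ → Set
Affine N f i σ v = ∀ t → grid N i ≤ t → t ≤ grid N (suc i) → f t ≃ v /2^ N - drop σ (t - grid N i)

record Wall (h : ℕ) (f : 𝔻 → 𝔻) : Set where
  field
    antitone : ∀ {s t} → s ≤ t → f t ≤ f s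
    lipschitz : ∀ {s t} → s ≤ t → f s ≤ f t + (t - s)
    affine   : ∀ {N} → h ℕ.≤ N → ∀ i → ∃ λ σ → ∃ λ v → Affine N f i σ v

  congruent : ∀ {s t} → s ≃ t → f s ≃ f t
  congruent s≃t = ≤-antisym (antitone (≤-reflexive (≃-sym s≃t))) (antitone (≤-reflexive s≃t))

open Wall public

wall-resp : ∀ {h f g} → (∀ t → f t ≃ g t) → Wall h f → Wall h g
wall-resp f≃g w = record
  { antitone = λ {s} {t} p → ≤-respˡ-≃ (f≃g t) (≤-respʳ-≃ (f≃g s) (antitone w p))
  ; lipschitz = λ {s} {t} p → ≤-respˡ-≃ (f≃g s) (≤-respʳ-≃ (+-cong (f≃g t) ≃-refl) (lipschitz w p))
  ; affine = λ h≤N i → let σ , v , eq = affine w h≤N i in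
      σ , v , λ t p q → ≃-trans (≃-sym (f≃g t)) (eq t p q) }

wall-raise : ∀ {h h′ f} → h ℕ.≤ h′ → Wall h f → Wall h′ f
wall-raise h≤h′ w = record
  { antitone = antitone w ; lipschitz = lipschitz w
  ; affine = λ h′≤N → affine w (ℕ.≤-trans h≤h′ h′≤N) }

wall-const : ∀ n → Wall 0 (λ _ → fromℤ n)
wall-const n = record
  { antitone = λ _ → ≤-refl
  ; lipschitz = λ {s} {t} s≤t → by-≤ s≤t (lem (fromℤ n) s t)
  ; affine = λ {N} _ i → false , n ℤ.* + (2^ N) , λ t _ _ →
      ≃-trans (≃-sym (fromℤ-on-grid n N)) (lem₀ _) }
  where
  lem : ∀ c s t → (c + (t - s)) - c ≃ t - s
  lem = solve-∀ 𝔻-ring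
  lem₀ : ∀ c → c ≃ c - 0𝔻
  lem₀ = solve-∀ 𝔻-ring

drop-not : ∀ σ x → x - drop σ x ≃ drop (not σ) x
drop-not false x = lem x
  where
  lem : ∀ x → x - 0𝔻 ≃ x
  lem = solve-∀ 𝔻-ring
drop-not true  x = lem x
  where
  lem : ∀ x → x - x ≃ 0𝔻
  lem = solve-∀ 𝔻-ring

wall-flip : ∀ {h f} → Wall h f → Wall h (λ t → - f t - t)
wall-flip {h} {f} w = record
  { antitone = λ {s} {t} s≤t → by-≤ (lipschitz w s≤t) (lem₁ (f s) (f t) s t)
  ; lipschitz = λ {s} {t} s≤t → by-≤ (antitone w s≤t) (lem₂ (f s) (f t) s t)
  ; affine = λ {N} h≤N i → let σ , v , eq = affine w h≤N i in
      not σ , (ℤ.- v) ℤ.+ (+ (2^ N) ℤ.+ ℤ.- + i) , λ t p q →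
        ≃-trans (+-congʳ (- t) (-‿cong (eq t p q)))
        (≃-trans (≃-sym (lem₃ (v /2^ N) ((+ i) /2^ N) t (drop σ (t - grid N i))))
                 (+-cong (≃-sym (start N i v)) (-‿cong (drop-not σ (t - grid N i))))) }
  where
  start : ∀ N i v → ((ℤ.- v) ℤ.+ (+ (2^ N) ℤ.+ ℤ.- + i)) /2^ N ≃
                    - (v /2^ N) + (fromℤ (+ 1) + - ((+ i) /2^ N))
  start N i v = ≃-trans (/2^-homo-+ (ℤ.- v) (+ (2^ N) ℤ.+ ℤ.- + i) N)
    (+-congˡ (- (v /2^ N)) (≃-trans (/2^-homo-+ (+ (2^ N)) (ℤ.- + i) N)
      (+-congʳ (- ((+ i) /2^ N)) (subst (λ u → u /2^ N ≃ fromℤ (+ 1)) (ℤ.*-identityˡ (+ (2^ N)))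
                                        (fromℤ-on-grid (+ 1) N)))))
  lem₁ : ∀ a b s t → (- a - s) - (- b - t) ≃ (b + (t - s)) - a
  lem₁ = solve-∀ 𝔻-ring
  lem₂ : ∀ a b s t → ((- b - t) + (t - s)) - (- a - s) ≃ a - b
  lem₂ = solve-∀ 𝔻-ring
  lem₃ : ∀ v i t d → (- v + (fromℤ (+ 1) + - i)) - ((t - (fromℤ -[1+ 0 ] + i)) - d) ≃ - (v - d) - t
  lem₃ = solve-∀ 𝔻-ring

module _ (N : ℕ) (i : ℕ) (t : 𝔻) (lo : grid N i ≤ t) (hi : t ≤ grid N (suc i)) where
  0≤offset : 0𝔻 ≤ t - grid N i
  0≤offset = by-≤ lo (lem t (grid N i))
    where
    lem : ∀ t a → (t - a) - 0𝔻 ≃ t - a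
    lem = solve-∀ 𝔻-ring

  offset≤step : t - grid N i ≤ step N
  offset≤step = by-≤ (≤-respʳ-≃ (grid-suc N i) hi) (lem t (grid N i) (step N))
    where
    lem : ∀ t a s → s - (t - a) ≃ (a + s) - t
    lem = solve-∀ 𝔻-ring

  affine-< : ∀ {u v} σ τ → u ℤ.< v →
             u /2^ N - drop σ (t - grid N i) ≤ v /2^ N - drop τ (t - grid N i)
  affine-< {u} {v} σ τ u<v = ≤-trans
    (by-≤ (drop-nonNeg σ 0≤offset) (lem₁ (u /2^ N) (drop σ d)))
    (by-≤₂ (≤-respˡ-≃ (/2^-homo-+ (+ 1) u N) (/2^-mono-≤ N (ℤ.i<j⇒suc[i]≤j u<v)))
           (≤-trans (drop-upper τ 0≤offset) offset≤step)
           (lem₂ (step N) (u /2^ N) (v /2^ N) (drop τ d)))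
    where
    d = t - grid N i
    lem₁ : ∀ u x → u - (u - x) ≃ x - 0𝔻
    lem₁ = solve-∀ 𝔻-ring
    lem₂ : ∀ s u v y → (v - y) - u ≃ (v - (s + u)) + (s - y)
    lem₂ = solve-∀ 𝔻-ring

  affine-true-≤ : ∀ u σ → u /2^ N - drop true (t - grid N i) ≤ u /2^ N - drop σ (t - grid N i)
  affine-true-≤ u σ = by-≤ (drop-upper σ 0≤offset) (lem (u /2^ N) (t - grid N i) (drop σ (t - grid N i)))
    where
    lem : ∀ u x y → (u - y) - (u - x) ≃ x - y
    lem = solve-∀ 𝔻-ring

  affine-≤-false : ∀ u σ → u /2^ N - drop σ (t - grid N i) ≤ u /2^ N - drop false (t - grid N i)
  affine-≤-false u σ = by-≤ (drop-nonNeg σ 0≤offset) (lem (u /2^ N) (drop σ (t - grid N i)))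
    where
    lem : ∀ u x → (u - 0𝔻) - (u - x) ≃ x - 0𝔻
    lem = solve-∀ 𝔻-ring

wall-⊔ : ∀ {h f g} → Wall h f → Wall h g → Wall h (λ t → f t ⊔ g t)
wall-⊔ {h} {f} {g} w w′ = record
  { antitone = λ s≤t → ⊔-mono-≤ (antitone w s≤t) (antitone w′ s≤t)
  ; lipschitz = λ {s} {t} s≤t → ⊔-lub
      (≤-trans (lipschitz w s≤t) (+-mono-≤ (x≤x⊔y (f t) (g t)) ≤-refl))
      (≤-trans (lipschitz w′ s≤t) (+-mono-≤ (x≤y⊔x (f t) (g t)) ≤-refl))
  ; affine = λ h≤N i → pick i (affine w h≤N i) (affine w′ h≤N i) }
  where
  module _ {N} i {σ τ u v} (p : Affine N f i σ u) (q : Affine N g i τ v) where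
    takeʳ : (∀ t → grid N i ≤ t → t ≤ grid N (suc i) →
             u /2^ N - drop σ (t - grid N i) ≤ v /2^ N - drop τ (t - grid N i)) →
            Affine N (λ t → f t ⊔ g t) i τ v
    takeʳ le t lo hi = ≃-trans (x≤y⇒x⊔y≃y (≤-respˡ-≃ (≃-sym (p t lo hi))
      (≤-respʳ-≃ (≃-sym (q t lo hi)) (le t lo hi)))) (q t lo hi)

    takeˡ : (∀ t → grid N i ≤ t → t ≤ grid N (suc i) →
             v /2^ N - drop τ (t - grid N i) ≤ u /2^ N - drop σ (t - grid N i)) →
            Affine N (λ t → f t ⊔ g t) i σ u
    takeˡ le t lo hi = ≃-trans (x≤y⇒y⊔x≃y (≤-respˡ-≃ (≃-sym (q t lo hi))
      (≤-respʳ-≃ (≃-sym (p t lo hi)) (le t lo hi)))) (p t lo hi)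

  pick : ∀ {N} i → (∃ λ σ → ∃ λ u → Affine N f i σ u) → (∃ λ τ → ∃ λ v → Affine N g i τ v) →
         ∃ λ σ → ∃ λ u → Affine N (λ t → f t ⊔ g t) i σ u
  pick {N} i (σ , u , p) (τ , v , q) with ℤ.<-cmp u v
  ... | tri< u<v _ _ = τ , v , takeʳ i p q (λ t lo hi → affine-< N i t lo hi σ τ u<v)
  ... | tri> _ _ v<u = σ , u , takeˡ i p q (λ t lo hi → affine-< N i t lo hi τ σ v<u)
  pick {N} i (true  , u , p) (τ , .u , q) | tri≈ _ refl _ =
    τ , u , takeʳ i {true} {τ} {u} {u} p q (λ t lo hi → affine-true-≤ N i t lo hi u τ)
  pick {N} i (false , u , p) (τ , .u , q) | tri≈ _ refl _ =
    false , u , takeˡ i {false} {τ} {u} {u} p q (λ t lo hi → affine-≤-false N i t lo hi u τ)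

wall-max : ∀ {h n} {f : Fin (suc n) → 𝔻 → 𝔻} → (∀ i → Wall h (f i)) → Wall h (λ t → max (λ i → f i t))
wall-max {n = zero}  w = w zero
wall-max {n = suc n} w = wall-⊔ (w zero) (wall-max (w ∘ suc))

wall-cut : ∀ {h h′ f τ} → h ℕ.≤ h′ → Wall h f → (∀ {N} → h′ ℕ.≤ N → OnGrid N τ) →
           Wall h′ (λ t → f (t ⊓ τ))
wall-cut {h} {h′} {f} {τ} h≤h′ w onGrid = record
  { antitone = λ {s} {t} s≤t → antitone w (⊓-mono-≤ {s} {t} {τ} s≤t ≤-refl)
  ; lipschitz = λ {s} {t} s≤t → ≤-trans (lipschitz w (⊓-mono-≤ {s} {t} {τ} s≤t ≤-refl))
      (+-mono-≤ ≤-refl (shrink s≤t))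
  ; affine = λ {N} h′≤N i → go h′≤N i (onGrid h′≤N) }
  where
  shrink : ∀ {s t} → s ≤ t → (t ⊓ τ) - (s ⊓ τ) ≤ t - s
  shrink {s} {t} s≤t = [ below , above ]′ (≤-total s τ)
    where
    below : s ≤ τ → (t ⊓ τ) - (s ⊓ τ) ≤ t - s
    below s≤τ = +-mono-≤ (x⊓y≤x t τ) (≤-reflexive (-‿cong (x≤y⇒x⊓y≃x s≤τ)))
    lem₁ : ∀ x y → 0𝔻 - (x - y) ≃ y - x
    lem₁ = solve-∀ 𝔻-ring
    lem₂ : ∀ s t → (t - s) - 0𝔻 ≃ t - s
    lem₂ = solve-∀ 𝔻-ring
    above : τ ≤ s → (t ⊓ τ) - (s ⊓ τ) ≤ t - s
    above τ≤s = ≤-trans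
      (by-≤ (x⊓y≤y t τ) (≃-trans (lem₁ (t ⊓ τ) (s ⊓ τ)) (+-congʳ (- (t ⊓ τ)) (x≤y⇒y⊓x≃x τ≤s))))
      (by-≤ s≤t (lem₂ s t))

  go : ∀ {N} → h′ ℕ.≤ N → ∀ i → OnGrid N τ → ∃ λ σ → ∃ λ v → Affine N (λ t → f (t ⊓ τ)) i σ v
  go {N} h′≤N i (j , τ≃) with ℕ.<-≤-connex i j
  ... | inj₁ i<j = let σ , v , eq = affine w (ℕ.≤-trans h≤h′ h′≤N) i in
    σ , v , λ t lo hi → ≃-trans
      (congruent w (x≤y⇒x⊓y≃x (≤-trans hi (≤-trans (grid-mono N i<j) (≤-reflexive (≃-sym τ≃))))))
      (eq t lo hi)
  ... | inj₂ j≤i = let σ , v , eq = affine w (ℕ.≤-trans h≤h′ h′≤N) j in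
    false , v , λ t lo hi → ≃-trans
      (congruent w (≃-trans (x≤y⇒y⊓x≃x (≤-trans (≤-reflexive τ≃) (≤-trans (grid-mono N j≤i) lo))) τ≃))
      (≃-trans (eq (grid N j) ≤-refl (grid-mono N (ℕ.n≤1+n j)))
               (+-congˡ (v /2^ N) (-‿cong (drop-0 σ (grid N j)))))
    where
    drop-0 : ∀ σ x → drop σ (x - x) ≃ 0𝔻
    drop-0 false x = ≃-refl
    drop-0 true  x = lem x
      where
      lem : ∀ x → x - x ≃ 0𝔻
      lem = solve-∀ 𝔻-ring

search : {P : ℕ → Set} → (∀ i → Dec (P i)) → ¬ P 0 → ∀ n → P n → ∃ λ i → ¬ P i × P (suc i)
search P? ¬P0 zero    Pn = contradiction Pn ¬P0
search P? ¬P0 (suc n) Pn with P? n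
... | yes p = search P? ¬P0 n p
... | no ¬p = n , ¬p , Pn

module Crossing {h : ℕ} {f g : 𝔻 → 𝔻} (wf : Wall h f) (wg : Wall h g)
                (positive : ¬ (f -1𝔻 + g -1𝔻 ≤ 0𝔻))
                {B : 𝔻} (bounded : ∀ t → -1𝔻 ≤ t → f t + g t ≤ B - (t + t)) where

  F : 𝔻 → 𝔻
  F t = f t + g t

  F-antitone : ∀ {s t} → s ≤ t → F t ≤ F s
  F-antitone s≤t = +-mono-≤ (antitone wf s≤t) (antitone wg s≤t)

  F-congruent : ∀ {s t} → s ≃ t → F s ≃ F t
  F-congruent s≃t = +-cong (congruent wf s≃t) (congruent wg s≃t)

  Cross : Set
  Cross = ∃ λ τ → F τ ≃ 0𝔻 × (∀ s → F s ≤ 0𝔻 → τ ≤ s) × (∀ {N} → suc h ℕ.≤ N → OnGrid N τ)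

  bounded-above : ∃ λ n → F (grid h n) ≤ 0𝔻
  bounded-above with ≤-bound B
  ... | k , B≤k = suc k ℕ.* 2^ h , ≤-trans
    (bounded (grid h (suc k ℕ.* 2^ h)) (≤-respˡ-≃ (grid-zero h) (grid-mono h {0} {suc k ℕ.* 2^ h} ℕ.z≤n)))
    (≤-respˡ-≃ (+-congˡ B (-‿cong (+-cong (≃-sym at) (≃-sym at))))
      (by-≤₂ B≤k (/2^-mono-≤ 0 (ℤ.+≤+ (ℕ.z≤n {k}))) (lem B (fromℤ (+ k)))))
    where
    at : grid h (suc k ℕ.* 2^ h) ≃ fromℤ (+ k)
    at = ≃-trans (+-congˡ -1𝔻 (subst (λ u → u /2^ h ≃ fromℤ (+ suc k))
           (sym (ℤ.pos-* (suc k) (2^ h))) (fromℤ-on-grid (+ suc k) h)))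
         (≃-trans (+-congˡ -1𝔻 (/2^-homo-+ (+ 1) (+ k) 0)) (lem′ (fromℤ (+ k))))
      where
      lem′ : ∀ x → fromℤ -[1+ 0 ] + (fromℤ (+ 1) + x) ≃ x
      lem′ = solve-∀ 𝔻-ring
    lem : ∀ b x → 0𝔻 - (b - (x + x)) ≃ (x - b) + (x - 0𝔻)
    lem = solve-∀ 𝔻-ring

  module _ (i : ℕ) (not-yet : ¬ (F (grid h i) ≤ 0𝔻)) where
    finish : ∀ τ β → grid h i ≤ τ → τ ≤ grid h (suc i) → (∀ {N} → suc h ℕ.≤ N → OnGrid N τ) →
             (∀ t → grid h i ≤ t → t ≤ grid h (suc i) → F t ≃ (τ - t) + drop β (τ - t)) → Cross
    finish τ β lo hi onGrid eq = τ , ≃-trans (eq τ lo hi) (at-τ β τ) , least , onGrid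
      where
      at-τ : ∀ β x → (x - x) + drop β (x - x) ≃ 0𝔻
      at-τ false x = lem x
        where
        lem : ∀ x → (x - x) + 0𝔻 ≃ 0𝔻
        lem = solve-∀ 𝔻-ring
      at-τ true x = lem x
        where
        lem : ∀ x → (x - x) + (x - x) ≃ 0𝔻
        lem = solve-∀ 𝔻-ring

      inside : ∀ s → F s ≤ 0𝔻 → grid h i ≤ s → s ≤ grid h (suc i) → τ ≤ s
      inside s Fs≤0 lo′ hi′ with ≤-total τ s
      ... | inj₁ τ≤s = τ≤s
      ... | inj₂ s≤τ = by-≤₂ (≤-respˡ-≃ (eq s lo′ hi′) Fs≤0)
                             (drop-nonNeg β (by-≤ s≤τ (lem₁ s τ)))
                             (lem₂ s τ (drop β (τ - s)))
        where
        lem₁ : ∀ s τ → (τ - s) - 0𝔻 ≃ τ - s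
        lem₁ = solve-∀ 𝔻-ring
        lem₂ : ∀ s τ x → s - τ ≃ (0𝔻 - ((τ - s) + x)) + (x - 0𝔻)
        lem₂ = solve-∀ 𝔻-ring

      least : ∀ s → F s ≤ 0𝔻 → τ ≤ s
      least s Fs≤0 with ≤-total s (grid h i) | ≤-total s (grid h (suc i))
      ... | inj₁ s≤a | _        = contradiction (≤-trans (F-antitone s≤a) Fs≤0) not-yet
      ... | inj₂ a≤s | inj₁ s≤b = inside s Fs≤0 a≤s s≤b
      ... | inj₂ a≤s | inj₂ b≤s = ≤-trans hi b≤s

    a b η : 𝔻
    a = grid h i
    b = grid h (suc i)
    η = step (suc h)

    a≤b : a ≤ b
    a≤b = grid-mono h {i} {suc i} (ℕ.n≤1+n i)

    drop-cong : ∀ σ {x y} → x ≃ y → drop σ x ≃ drop σ y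
    drop-cong false x≃y = ≃-refl
    drop-cong true  x≃y = x≃y

    onGrid-b : ∀ {N} → suc h ℕ.≤ N → OnGrid N b
    onGrid-b le = onGrid-refine (ℕ.≤-trans (ℕ.n≤1+n h) le) (suc i , ≃-refl)

    module _ {σ σ′ u v} (p : Affine h f i σ u) (q : Affine h g i σ′ v) (reached : F b ≤ 0𝔻) where
      k : ℤ
      k = u ℤ.+ v

      F≃ : ∀ t → a ≤ t → t ≤ b → F t ≃ k /2^ h - (drop σ (t - a) + drop σ′ (t - a))
      F≃ t lo hi = ≃-trans (+-cong (p t lo hi) (q t lo hi))
        (≃-trans (lem (u /2^ h) (v /2^ h) (drop σ (t - a)) (drop σ′ (t - a)))
                 (+-congʳ (- (drop σ (t - a) + drop σ′ (t - a))) (≃-sym (/2^-homo-+ u v h))))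
        where
        lem : ∀ u v x y → (u - x) + (v - y) ≃ (u + v) - (x + y)
        lem = solve-∀ 𝔻-ring

      b-a : b - a ≃ step h
      b-a = ≃-trans (+-congʳ (- a) (grid-suc h i)) (lem a (step h))
        where
        lem : ∀ a s → (a + s) - a ≃ s
        lem = solve-∀ 𝔻-ring

      k>0 : + 0 ℤ.< k
      k>0 = ℤ.≰⇒> λ k≤0 → not-yet (≤-trans (≤-reflexive (≃-trans (F≃ a ≤-refl a≤b) (at-a σ σ′)))
                                          (≤-trans (/2^-mono-≤ h k≤0) (≤-reflexive (0/2^ h))))
        where
        lem : ∀ x → x - (0𝔻 + 0𝔻) ≃ x
        lem = solve-∀ 𝔻-ring
        drop-a : ∀ σ → drop σ (a - a) ≃ 0𝔻
        drop-a false = ≃-refl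
        drop-a true  = lem₀ a
          where
          lem₀ : ∀ x → x - x ≃ 0𝔻
          lem₀ = solve-∀ 𝔻-ring
        at-a : ∀ σ σ′ → k /2^ h - (drop σ (a - a) + drop σ′ (a - a)) ≃ k /2^ h
        at-a σ σ′ = ≃-trans (+-congˡ (k /2^ h) (-‿cong (+-cong (drop-a σ) (drop-a σ′)))) (lem (k /2^ h))

      k≤ : k /2^ h ≤ drop σ (step h) + drop σ′ (step h)
      k≤ = by-≤ (≤-respˡ-≃ (≃-trans (F≃ b a≤b ≤-refl)
                  (+-congˡ (k /2^ h) (-‿cong (+-cong (drop-cong σ b-a) (drop-cong σ′ b-a))))) reached)
                (lem (k /2^ h) (drop σ (step h) + drop σ′ (step h)))
        where
        lem : ∀ x y → y - x ≃ 0𝔻 - (x - y)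
        lem = solve-∀ 𝔻-ring

    single : (∀ t → a ≤ t → t ≤ b → F t ≃ step h - (t - a)) → Cross
    single eq = finish b false a≤b ≤-refl onGrid-b λ t lo hi →
      ≃-trans (eq t lo hi) (≃-trans (lem a t (step h)) (+-congʳ 0𝔻 (+-congʳ (- t) (≃-sym (grid-suc h i)))))
      where
      lem : ∀ a t s → s - (t - a) ≃ ((a + s) - t) + 0𝔻
      lem = solve-∀ 𝔻-ring

    double : ∀ k → + 0 ℤ.< k → k ℤ.≤ + 2 →
             (∀ t → a ≤ t → t ≤ b → F t ≃ k /2^ h - ((t - a) + (t - a))) → Cross
    double (+ 1) _ _ eq = finish (a + η) true
      (by-≤ (0≤step (suc h)) (lem₁ a η))
      (≤-respʳ-≃ (≃-sym b≃) (by-≤ (0≤step (suc h)) (lem₂ a η)))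
      (λ le → onGrid-refine le (midpoint-onGrid h i))
      (λ t lo hi → ≃-trans (eq t lo hi) (≃-trans (+-congʳ (- ((t - a) + (t - a))) (step-double h)) (lem₃ a t η)))
      where
      b≃ : b ≃ a + (η + η)
      b≃ = ≃-trans (grid-suc h i) (+-congˡ a (step-double h))
      lem₁ : ∀ a e → (a + e) - a ≃ e - 0𝔻
      lem₁ = solve-∀ 𝔻-ring
      lem₂ : ∀ a e → (a + (e + e)) - (a + e) ≃ e - 0𝔻
      lem₂ = solve-∀ 𝔻-ring
      lem₃ : ∀ a t e → (e + e) - ((t - a) + (t - a)) ≃ ((a + e) - t) + ((a + e) - t)
      lem₃ = solve-∀ 𝔻-ring
    double (+ 2) _ _ eq = finish b true a≤b ≤-refl onGrid-b λ t lo hi →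
      ≃-trans (eq t lo hi)
      (≃-trans (+-congʳ (- ((t - a) + (t - a))) (/2^-homo-+ (+ 1) (+ 1) h))
      (≃-trans (lem a t (step h)) (+-cong (b-t t) (b-t t))))
      where
      b-t : ∀ t → (a + step h) - t ≃ b - t
      b-t t = +-congʳ (- t) (≃-sym (grid-suc h i))
      lem : ∀ a t s → (s + s) - ((t - a) + (t - a)) ≃ ((a + s) - t) + ((a + s) - t)
      lem = solve-∀ 𝔻-ring
    double (+ 0) (ℤ.+<+ ()) _ eq
    double (+ suc (suc (suc k))) _ (ℤ.+≤+ (ℕ.s≤s (ℕ.s≤s ()))) eq

    analyse : ∀ σ σ′ {u v} → Affine h f i σ u → Affine h g i σ′ v → F b ≤ 0𝔻 → Cross
    analyse false false {u} {v} p q r = contradiction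
      (/2^-cancel-≤ h (≤-trans (k≤ {false} {false} {u} {v} p q r) (≤-reflexive (≃-trans lem (≃-sym (0/2^ h))))))
      (ℤ.<⇒≱ (k>0 {false} {false} {u} {v} p q r))
      where
      lem : 0𝔻 + 0𝔻 ≃ 0𝔻
      lem = *≃* (ℚᵘ.*≡* refl)
    analyse true false {u} {v} p q r = single λ t lo hi → ≃-trans (F≃ {true} {false} {u} {v} p q r t lo hi)
      (≃-trans (+-congʳ (- ((t - a) + 0𝔻)) (subst (λ k → k /2^ h ≃ step h) (sym k≡1) ≃-refl))
               (lem (step h) (t - a)))
      where
      lem₀ : ∀ x → x + 0𝔻 ≃ x
      lem₀ = solve-∀ 𝔻-ring
      k≡1 : u ℤ.+ v ≡ + 1
      k≡1 = ℤ.≤-antisym (/2^-cancel-≤ h (≤-trans (k≤ {true} {false} {u} {v} p q r) (≤-reflexive (lem₀ (step h)))))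
                        (ℤ.i<j⇒suc[i]≤j (k>0 {true} {false} {u} {v} p q r))
      lem : ∀ x y → x - (y + 0𝔻) ≃ x - y
      lem = solve-∀ 𝔻-ring
    analyse false true {u} {v} p q r = single λ t lo hi → ≃-trans (F≃ {false} {true} {u} {v} p q r t lo hi)
      (≃-trans (+-congʳ (- (0𝔻 + (t - a))) (subst (λ k → k /2^ h ≃ step h) (sym k≡1) ≃-refl))
               (lem (step h) (t - a)))
      where
      lem₀ : ∀ x → 0𝔻 + x ≃ x
      lem₀ = solve-∀ 𝔻-ring
      k≡1 : u ℤ.+ v ≡ + 1
      k≡1 = ℤ.≤-antisym (/2^-cancel-≤ h (≤-trans (k≤ {false} {true} {u} {v} p q r) (≤-reflexive (lem₀ (step h)))))
                        (ℤ.i<j⇒suc[i]≤j (k>0 {false} {true} {u} {v} p q r))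
      lem : ∀ x y → x - (0𝔻 + y) ≃ x - y
      lem = solve-∀ 𝔻-ring
    analyse true true {u} {v} p q r = double (u ℤ.+ v) (k>0 {true} {true} {u} {v} p q r)
      (/2^-cancel-≤ h (≤-trans (k≤ {true} {true} {u} {v} p q r) (≤-reflexive (≃-sym (/2^-homo-+ (+ 1) (+ 1) h)))))
      (F≃ {true} {true} {u} {v} p q r)

  cross : Cross
  cross =
    let n , Fn≤0 = bounded-above
        i , not-yet , reached = search {λ i → F (grid h i) ≤ 0𝔻} (λ i → F (grid h i) ≤? 0𝔻)
          (λ F0≤0 → positive (≤-respˡ-≃ (F-congruent (grid-zero h)) F0≤0)) n Fn≤0
        σ , u , p = affine wf ℕ.≤-refl i
        σ′ , v , q = affine wg ℕ.≤-refl i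
    in analyse i not-yet σ σ′ {u} {v} p q reached

sup : ∀ {n} → (Fin n → ℕ) → ℕ
sup {zero}  f = 0
sup {suc n} f = f zero ℕ.⊔ sup (f ∘ suc)

≤-sup : ∀ {n} (f : Fin n → ℕ) i → f i ℕ.≤ sup f
≤-sup f zero    = ℕ.m≤m⊔n (f zero) (sup (f ∘ suc))
≤-sup f (suc i) = ℕ.≤-trans (≤-sup (f ∘ suc) i) (ℕ.m≤n⊔m (f zero) (sup (f ∘ suc)))

birthday : Game → ℕ
birthday (node L R) = suc (sup (λ i → birthday (L i)) ℕ.⊔ sup (λ j → birthday (R j)))

⊒⇒▷L : ∀ {m n} {L : Fin m → Game} {R : Fin n → Game} H → H ⊒ node L R → ∀ i → H ▷ L i
⊒⇒▷L (node _ _) (_ , q) = q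

⊒⇒R▷ : ∀ {m n} {L : Fin m → Game} {R : Fin n → Game} H → node L R ⊒ H → ∀ j → R j ▷ H
⊒⇒R▷ (node _ _) (p , _) = p

record Thermograph (G : Game) : Set where
  field
    left right : 𝔻 → 𝔻
    cooled     : 𝔻 → Game
    freeze     : Maybe 𝔻

    left-wall  : Wall (birthday G) left
    right-wall : Wall (birthday G) (λ t → - right t)
    right≤left : ∀ t → right t ≤ left t

    -- At t = −1 the walls are the integers that bound G most tightly.
    ceiling floor  : ℤ
    left-ceiling   : left -1𝔻 ≃ fromℤ ceiling
    right-floor    : right -1𝔻 ≃ fromℤ floor
    ceiling-lower  : ∀ k → integer k ⊒ G → ceiling ℤ.≤ k
    ceiling-upper  : ∀ k → ceiling ℤ.≤ k → integer k ⊒ G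
    floor-upper    : ∀ k → G ⊒ integer k → k ℤ.≤ floor
    floor-lower    : ∀ k → k ℤ.≤ floor → G ⊒ integer k

    integer-case : ∀ n → G ≈ᴳ integer n →
                   freeze ≡ nothing × (∀ t → left t ≃ fromℤ n × right t ≃ fromℤ n × cooled t ≡ integer n)
    above-case   : ∀ {τ} t → freeze ≡ just τ → τ < t →
                   left t ≃ left τ × right t ≃ left τ × cooled t ≡ canonical (left τ)

open Thermograph

integer-injective : ∀ {G m n} → G ⊒ integer m × integer m ⊒ G → G ⊒ integer n × integer n ⊒ G → m ≡ n
integer-injective {G} {m} {n} (p , q) (r , s) = ℤ.≤-antisym
  (integer-cancel-≤ (⊒-trans (integer n) G (integer m) s p))
  (integer-cancel-≤ (⊒-trans (integer m) G (integer n) q r))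

integer-thermograph : ∀ G n → G ⊒ integer n × integer n ⊒ G → Thermograph G
integer-thermograph G n G≈n@(p , q) = record
  { left = λ _ → fromℤ n ; right = λ _ → fromℤ n ; cooled = λ _ → integer n ; freeze = nothing
  ; left-wall = wall-raise ℕ.z≤n (wall-const n)
  ; right-wall = wall-raise ℕ.z≤n (wall-const (ℤ.- n))
  ; right≤left = λ _ → ≤-refl
  ; ceiling = n ; floor = n
  ; left-ceiling = ≃-refl ; right-floor = ≃-refl
  ; ceiling-lower = λ k r → integer-cancel-≤ (⊒-trans (integer k) G (integer n) r p)
  ; ceiling-upper = λ k n≤k → ⊒-trans (integer k) (integer n) G (integer-mono-≤ n≤k) q
  ; floor-upper = λ k r → integer-cancel-≤ (⊒-trans (integer n) G (integer k) q r)
  ; floor-lower = λ k k≤n → ⊒-trans G (integer n) (integer k) p (integer-mono-≤ k≤n)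
  ; integer-case = λ m G≈m → refl , λ _ → at m (integer-injective {G} G≈n (≈ᴳ⇒⊒ G (integer m) G≈m))
  ; above-case = λ _ () }
  where
  at : ∀ m → n ≡ m → fromℤ n ≃ fromℤ m × fromℤ n ≃ fromℤ m × integer n ≡ integer m
  at m refl = ≃-refl , ≃-refl , refl

module Options {m n} (L : Fin m → Game) (R : Fin n → Game)
               (θL : ∀ i → Thermograph (L i)) (θR : ∀ j → Thermograph (R j)) where

  Between : Set
  Between = ∃ λ k → (∀ i → floor (θL i) ℤ.< k) × (∀ j → k ℤ.< ceiling (θR j))

  ▷L : ∀ {i k} → floor (θL i) ℤ.< k → integer k ▷ L i
  ▷L {i} {k} fl<k = ¬⊒⇒▷ (integer k) (L i) λ p → ℤ.<⇒≱ fl<k (floor-upper (θL i) k p)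

  ▷L⁻¹ : ∀ {i k} → integer k ▷ L i → floor (θL i) ℤ.< k
  ▷L⁻¹ {i} {k} p = ℤ.≰⇒> λ k≤fl → ▷⇒¬⊒ (integer k) (L i) p (floor-lower (θL i) k k≤fl)

  R▷ : ∀ {j k} → k ℤ.< ceiling (θR j) → R j ▷ integer k
  R▷ {j} {k} k<c = ¬⊒⇒▷ (R j) (integer k) λ p → ℤ.<⇒≱ k<c (ceiling-lower (θR j) k p)

  R▷⁻¹ : ∀ {j k} → R j ▷ integer k → k ℤ.< ceiling (θR j)
  R▷⁻¹ {j} {k} p = ℤ.≰⇒> λ c≤k → ▷⇒¬⊒ (R j) (integer k) p (ceiling-upper (θR j) k c≤k)

  between⇒integer : Between → ∃ λ k → node L R ⊒ integer k × integer k ⊒ node L R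
  between⇒integer (k , p , q) = separates⇒integer L R k ((λ i → ▷L (p i)) , (λ j → R▷ (q j)))

  integer⇒between : IsInteger (node L R) → Between
  integer⇒between (k , G≈k) = let p , q = ≈ᴳ⇒⊒ (node L R) (integer k) G≈k in
    k , (λ i → ▷L⁻¹ (⊒⇒▷L (integer k) q i)) , (λ j → R▷⁻¹ (⊒⇒R▷ (integer k) p j))

  between-thermograph : Between → Thermograph (node L R)
  between-thermograph b = let k , G≈k = between⇒integer b in integer-thermograph (node L R) k G≈k

module Extrema {m n} (L : Fin (suc m) → Game) (R : Fin (suc n) → Game)
               (θL : ∀ i → Thermograph (L i)) (θR : ∀ j → Thermograph (R j)) where
  open Options L R θL θR

  left~ right~ : 𝔻 → 𝔻
  left~ t  = max (λ i → right (θL i) t - t)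
  right~ t = min (λ j → left (θR j) t + t)

  leftmost : ∃ λ i → left~ -1𝔻 ≃ right (θL i) -1𝔻 - -1𝔻
  leftmost = max-attained (λ i → right (θL i) -1𝔻 - -1𝔻)

  rightmost : ∃ λ j → right~ -1𝔻 ≃ left (θR j) -1𝔻 + -1𝔻
  rightmost = min-attained (λ j → left (θR j) -1𝔻 + -1𝔻)

  c f : ℤ
  c = ℤ.suc (floor (θL (proj₁ leftmost)))
  f = ℤ.pred (ceiling (θR (proj₁ rightmost)))

  option-left : ∀ i → right (θL i) -1𝔻 - -1𝔻 ≃ fromℤ (ℤ.suc (floor (θL i)))
  option-left i = ≃-trans (+-congʳ (fromℤ (+ 1)) (right-floor (θL i)))
    (≃-trans (lem (fromℤ (floor (θL i))) (fromℤ (+ 1))) (≃-sym (/2^-homo-+ (+ 1) (floor (θL i)) 0)))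
    where
    lem : ∀ x y → x + y ≃ y + x
    lem = solve-∀ 𝔻-ring

  option-right : ∀ j → left (θR j) -1𝔻 + -1𝔻 ≃ fromℤ (ℤ.pred (ceiling (θR j)))
  option-right j = ≃-trans (+-congʳ -1𝔻 (left-ceiling (θR j)))
    (≃-trans (lem (fromℤ (ceiling (θR j))) -1𝔻) (≃-sym (/2^-homo-+ -[1+ 0 ] (ceiling (θR j)) 0)))
    where
    lem : ∀ x y → x + y ≃ y + x
    lem = solve-∀ 𝔻-ring

  left~-c : left~ -1𝔻 ≃ fromℤ c
  left~-c = ≃-trans (proj₂ leftmost) (option-left (proj₁ leftmost))

  right~-f : right~ -1𝔻 ≃ fromℤ f
  right~-f = ≃-trans (proj₂ rightmost) (option-right (proj₁ rightmost))

  floor<c : ∀ i → floor (θL i) ℤ.< c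
  floor<c i = ℤ.suc[i]≤j⇒i<j (/2^-cancel-≤ 0 (≤-respˡ-≃ (option-left i)
    (≤-respʳ-≃ left~-c (≤-max (λ i → right (θL i) -1𝔻 - -1𝔻) i))))

  f<ceiling : ∀ j → f ℤ.< ceiling (θR j)
  f<ceiling j = ℤ.≤-<-trans (/2^-cancel-≤ 0 (≤-respˡ-≃ right~-f
    (≤-respʳ-≃ (option-right j) (min-≤ (λ j → left (θR j) -1𝔻 + -1𝔻) j))))
    (ℤ.suc[i]≤j⇒i<j (ℤ.≤-reflexive (ℤ.suc-pred (ceiling (θR j)))))

  between? : Dec Between
  between? = map′ to from (left~ -1𝔻 ≤? right~ -1𝔻)
    where
    to : left~ -1𝔻 ≤ right~ -1𝔻 → Between
    to le = c , floor<c , λ j → ℤ.≤-<-trans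
      (/2^-cancel-≤ 0 (≤-respˡ-≃ left~-c (≤-respʳ-≃ right~-f le))) (f<ceiling j)
    from : Between → left~ -1𝔻 ≤ right~ -1𝔻
    from (k , p , q) = ≤-respˡ-≃ (≃-sym left~-c) (≤-respʳ-≃ (≃-sym right~-f)
      (/2^-mono-≤ 0 (ℤ.≤-trans (ℤ.i<j⇒suc[i]≤j (p (proj₁ leftmost)))
                               (ℤ.i<j⇒i≤pred[j] (q (proj₁ rightmost))))))

  h : ℕ
  h = sup (λ i → birthday (L i)) ℕ.⊔ sup (λ j → birthday (R j))

  left~-wall : Wall h left~
  left~-wall = wall-max {f = λ i t → right (θL i) t - t} λ i →
    wall-resp (λ t → lem (right (θL i) t) t) (wall-flip (wall-raise
      (ℕ.≤-trans (≤-sup (λ i → birthday (L i)) i) (ℕ.m≤m⊔n _ (sup (λ j → birthday (R j)))))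
      (right-wall (θL i))))
    where
    lem : ∀ x t → - (- x) - t ≃ x - t
    lem = solve-∀ 𝔻-ring

  neg-+ : ∀ x t → - x - t ≃ - (x + t)
  neg-+ = solve-∀ 𝔻-ring

  right~-wall : Wall h (λ t → - right~ t)
  right~-wall = wall-resp (λ t → ≃-sym (neg-min (λ j → left (θR j) t + t)))
    (wall-max {f = λ j t → - (left (θR j) t + t)} λ j →
      wall-resp (λ t → neg-+ (left (θR j) t) t) (wall-flip (wall-raise
        (ℕ.≤-trans (≤-sup (λ j → birthday (R j)) j) (ℕ.m≤n⊔m (sup (λ i → birthday (L i))) _))
        (left-wall (θR j)))))

  bL bR : 𝔻
  bL = max (λ i → left (θL i) -1𝔻)
  bR = max (λ j → - right (θR j) -1𝔻)

  bounded : ∀ t → -1𝔻 ≤ t → left~ t + - right~ t ≤ (bL + bR) - (t + t)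
  bounded t -1≤t = ≤-respʳ-≃ (lem bL bR t) (+-mono-≤
    (max-lub (λ i → right (θL i) t - t) λ i → +-mono-≤
      (≤-trans (right≤left (θL i) t) (≤-trans (antitone (left-wall (θL i)) -1≤t)
                                              (≤-max (λ i → left (θL i) -1𝔻) i)))
      ≤-refl)
    (≤-respˡ-≃ (≃-sym (neg-min (λ j → left (θR j) t + t)))
      (max-lub (λ j → - (left (θR j) t + t)) λ j → ≤-respˡ-≃ (neg-+ (left (θR j) t) t) (+-mono-≤
        (≤-trans (neg-mono-≤ (right≤left (θR j) t)) (≤-trans (antitone (right-wall (θR j)) -1≤t)
                                                           (≤-max (λ j → - right (θR j) -1𝔻) j)))
        ≤-refl))))
    where
    lem : ∀ x y t → (x - t) + (y - t) ≃ (x + y) - (t + t)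
    lem = solve-∀ 𝔻-ring

  cooled~ : 𝔻 → Game
  cooled~ t = node (λ i → cooled (θL i) t ⊕ canonical (- t)) (λ j → cooled (θR j) t ⊕ canonical t)

  record Step : Set where
    field
      thermograph : Thermograph (node L R)
      least : ¬ IsInteger (node L R) →
              ∃ λ τ → freeze thermograph ≡ just τ × IsLeast (λ t → left~ t ≃ right~ t) τ
      below : ∀ {τ} t → freeze thermograph ≡ just τ → t ≤ τ →
              left thermograph t ≃ left~ t × right thermograph t ≃ right~ t ×
              cooled thermograph t ≡ cooled~ t

  difference : ∀ {x y} → x ≤ y → x + - y ≤ 0𝔻
  difference {x} {y} x≤y = by-≤ x≤y (lem x y)
    where
    lem : ∀ x y → 0𝔻 - (x + - y) ≃ y - x
    lem = solve-∀ 𝔻-ring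

  difference⁻¹ : ∀ {x y} → 0𝔻 ≤ x + - y → y ≤ x
  difference⁻¹ {x} {y} p = by-≤ p (lem x y)
    where
    lem : ∀ x y → x - y ≃ (x + - y) - 0𝔻
    lem = solve-∀ 𝔻-ring

  difference′ : ∀ {x y} → x + - y ≤ 0𝔻 → x ≤ y
  difference′ {x} {y} p = by-≤ p (lem x y)
    where
    lem : ∀ x y → y - x ≃ 0𝔻 - (x + - y)
    lem = solve-∀ 𝔻-ring

  module NotBetween (¬between : ¬ Between) where
    positive : ¬ (left~ -1𝔻 + - right~ -1𝔻 ≤ 0𝔻)
    positive p = ¬between (c , floor<c , λ j → ℤ.≤-<-trans
      (/2^-cancel-≤ 0 (≤-respˡ-≃ left~-c (≤-respʳ-≃ right~-f (difference′ p)))) (f<ceiling j))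

    open Crossing left~-wall right~-wall positive {bL + bR} bounded using (F-antitone; cross)

    τ : 𝔻
    τ = proj₁ cross

    Fτ≃0 : left~ τ + - right~ τ ≃ 0𝔻
    Fτ≃0 = proj₁ (proj₂ cross)

    meet : left~ τ ≃ right~ τ
    meet = ≤-antisym (difference′ (≤-reflexive Fτ≃0)) (difference⁻¹ (≤-reflexive (≃-sym Fτ≃0)))

    τ-least : ∀ t → left~ t ≃ right~ t → τ ≤ t
    τ-least t eq = proj₁ (proj₂ (proj₂ cross)) t (difference (≤-reflexive eq))

    onGrid : ∀ {N} → suc h ℕ.≤ N → OnGrid N τ
    onGrid = proj₂ (proj₂ (proj₂ cross))

    -1≤τ : -1𝔻 ≤ τ
    -1≤τ = [ (λ p → p) , (λ τ≤-1 → contradiction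
      (≤-trans (F-antitone τ≤-1) (≤-reflexive Fτ≃0)) positive) ]′ (≤-total -1𝔻 τ)

    leftᶜ rightᶜ : 𝔻 → 𝔻
    leftᶜ t  = left~ (t ⊓ τ)
    rightᶜ t = right~ (t ⊓ τ)

    choose : ∀ {t} → Dec (t ≤ τ) → Game
    choose {t} (yes _) = cooled~ t
    choose {t} (no _)  = canonical (leftᶜ τ)

    choose-yes : ∀ {t} (d : Dec (t ≤ τ)) → t ≤ τ → choose d ≡ cooled~ t
    choose-yes (yes _)  _   = refl
    choose-yes (no t≰τ) t≤τ = contradiction t≤τ t≰τ

    choose-no : ∀ {t} (d : Dec (t ≤ τ)) → ¬ (t ≤ τ) → choose d ≡ canonical (leftᶜ τ)
    choose-no (yes t≤τ) t≰τ = contradiction t≤τ t≰τ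
    choose-no (no _)    _   = refl

    right~-congruent : ∀ {s t} → s ≃ t → right~ s ≃ right~ t
    right~-congruent {s} {t} s≃t = ≃-trans (lem (right~ s))
      (≃-trans (-‿cong (congruent right~-wall s≃t)) (≃-sym (lem (right~ t))))
      where
      lem : ∀ x → x ≃ - (- x)
      lem = solve-∀ 𝔻-ring

    hot : ¬ IsInteger (node L R)
    hot i = ¬between (integer⇒between i)

    not-integer : ∀ {k} → node L R ⊒ integer k → ¬ (integer k ⊒ node L R)
    not-integer {k} p q = hot (k , ⊒⇒≈ᴳ (node L R) (integer k) (p , q))

    thermograph : Thermograph (node L R)
    thermograph = record
      { left = leftᶜ ; right = rightᶜ ; cooled = λ t → choose {t} (t ≤? τ) ; freeze = just τ
      ; left-wall = wall-cut (ℕ.n≤1+n h) left~-wall onGrid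
      ; right-wall = wall-cut (ℕ.n≤1+n h) right~-wall onGrid
      ; right≤left = λ t → difference⁻¹ (≤-trans (≤-reflexive (≃-sym Fτ≃0)) (F-antitone (x⊓y≤y t τ)))
      ; ceiling = c ; floor = f
      ; left-ceiling = ≃-trans (congruent left~-wall (x≤y⇒x⊓y≃x -1≤τ)) left~-c
      ; right-floor = ≃-trans (right~-congruent (x≤y⇒x⊓y≃x -1≤τ)) right~-f
      ; ceiling-lower = λ k p → ℤ.i<j⇒suc[i]≤j (▷L⁻¹ (⊒⇒▷L (integer k) p (proj₁ leftmost)))
      ; ceiling-upper = λ k c≤k → integer-⊒ L R k
          (λ i → ▷L (ℤ.<-≤-trans (floor<c i) c≤k))
          (¬⊒⇒▷ (integer (ℤ.suc k)) (node L R) λ p → ¬between (ℤ.suc k ,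
            (λ i → ℤ.<-≤-trans (floor<c i) (ℤ.≤-trans c≤k (ℤ.i≤suc[i] k))) ,
            (λ j → R▷⁻¹ (⊒⇒R▷ (integer (ℤ.suc k)) p j))))
      ; floor-upper = λ k p → ℤ.i<j⇒i≤pred[j] (R▷⁻¹ (⊒⇒R▷ (integer k) p (proj₁ rightmost)))
      ; floor-lower = λ k k≤f → ⊒-integer L R k
          (λ j → R▷ (ℤ.≤-<-trans k≤f (f<ceiling j)))
          (¬⊒⇒▷ (node L R) (integer (ℤ.pred k)) λ p → ¬between (ℤ.pred k ,
            (λ i → ▷L⁻¹ (⊒⇒▷L (integer (ℤ.pred k)) p i)) ,
            (λ j → ℤ.≤-<-trans (ℤ.≤-trans (ℤ.i≤j⇒pred[i]≤j ℤ.≤-refl) k≤f) (f<ceiling j))))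
      ; integer-case = λ k G≈k → contradiction (k , G≈k) hot
      ; above-case = λ { t refl τ<t →
          let t⊓τ≃τ = x≤y⇒y⊓x≃x (≰⇒≥ (<⇒≱ τ<t))
              τ⊓τ≃τ = x≤y⇒x⊓y≃x (≤-refl {τ}) in
          congruent left~-wall (≃-trans t⊓τ≃τ (≃-sym τ⊓τ≃τ)) ,
          ≃-trans (right~-congruent t⊓τ≃τ) (≃-trans (≃-sym meet) (congruent left~-wall (≃-sym τ⊓τ≃τ))) ,
          choose-no (t ≤? τ) (<⇒≱ τ<t) } }

    construct : Step
    construct = record
      { thermograph = thermograph
      ; least = λ _ → τ , refl , meet , τ-least
      ; below = λ { t refl t≤τ →
          congruent left~-wall (x≤y⇒x⊓y≃x t≤τ) , right~-congruent (x≤y⇒x⊓y≃x t≤τ) ,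
          choose-yes (t ≤? τ) t≤τ } }

  construct-dec : Dec Between → Step
  construct-dec (yes b) = record
    { thermograph = between-thermograph b
    ; least = λ ¬int → let k , G≈k = between⇒integer b in
        contradiction (k , ⊒⇒≈ᴳ (node L R) (integer k) G≈k) ¬int
    ; below = λ _ () }
  construct-dec (no ¬b) = NotBetween.construct ¬b

  construct : Step
  construct = construct-dec between?

thermograph : ∀ G → Thermograph G
thermograph (node {zero} {n} L R) =
  Options.between-thermograph L R (λ i → thermograph (L i)) θR
    (let k , k< = lowerBound (λ j → ceiling (θR j)) in k , (λ ()) , k<)
  where
  θR : ∀ j → Thermograph (R j)
  θR j = thermograph (R j)
thermograph (node {suc m} {zero} L R) =
  Options.between-thermograph L R θL (λ j → thermograph (R j))
    (let k , <k = upperBound (λ i → floor (θL i)) in k , <k , (λ ()))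
  where
  θL : ∀ i → Thermograph (L i)
  θL i = thermograph (L i)
thermograph (node {suc m} {suc n} L R) =
  Extrema.Step.thermograph (Extrema.construct L R (λ i → thermograph (L i)) (λ j → thermograph (R j)))

options-nonempty : ∀ {m n} (L : Fin m → Game) (R : Fin n → Game) →
                   ¬ IsInteger (node L R) → ℕ.NonZero m × ℕ.NonZero n
options-nonempty {zero}          L R ¬int = contradiction
  (let k , k< = lowerBound (λ j → ceiling (thermograph (R j)))
       l , p  = Options.between⇒integer L R (λ i → thermograph (L i)) (λ j → thermograph (R j)) (k , (λ ()) , k<)
   in l , ⊒⇒≈ᴳ (node L R) (integer l) p) ¬int
options-nonempty {suc m} {zero}  L R ¬int = contradiction
  (let k , <k = upperBound (λ i → floor (thermograph (L i)))
       l , p  = Options.between⇒integer L R (λ i → thermograph (L i)) (λ j → thermograph (R j)) (k , <k , (λ ()))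
   in l , ⊒⇒≈ᴳ (node L R) (integer l) p) ¬int
options-nonempty {suc m} {suc n} L R ¬int = _ , _

module _ {m n} (L : Fin (suc m) → Game) (R : Fin (suc n) → Game) where
  open Extrema.Step (Extrema.construct L R (λ i → thermograph (L i)) (λ j → thermograph (R j))) public
    using () renaming (least to node-least; below to node-below)

-- Abstract because the clauses of `Cooling` determine everything that is used:
-- by induction on G they fix all four functions up to equality of dyadic values.
abstract
  cooling : Cooling
  cooling = record
    { λₜ = λ t G → left (thermograph G) t
    ; ρₜ = λ t G → right (thermograph G) t
    ; cool = λ t G → cooled (thermograph G) t
    ; temp = λ G → freeze (thermograph G)
    ; integer-temp = λ {G} n p → proj₁ (integer-case (thermograph G) n p)
    ; integer-λₜ = λ {G} n t p → proj₁ (proj₂ (integer-case (thermograph G) n p) t)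
    ; integer-ρₜ = λ {G} n t p → proj₁ (proj₂ (proj₂ (integer-case (thermograph G) n p) t))
    ; integer-cool = λ {G} n t p → proj₂ (proj₂ (proj₂ (integer-case (thermograph G) n p) t))
    ; temp-least = node-least
    ; below-λₜ = λ L R t p t≤τ → proj₁ (node-below L R t p t≤τ)
    ; below-ρₜ = λ L R t p t≤τ → proj₁ (proj₂ (node-below L R t p t≤τ))
    ; below-cool = λ L R t p t≤τ → proj₂ (proj₂ (node-below L R t p t≤τ))
    ; above-λₜ = λ {G} t p τ<t → proj₁ (above-case (thermograph G) t p τ<t)
    ; above-ρₜ = λ {G} t p τ<t → proj₁ (proj₂ (above-case (thermograph G) t p τ<t))
    ; above-cool = λ {G} t p τ<t → proj₂ (proj₂ (above-case (thermograph G) t p τ<t)) }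

open Cooling cooling public

{-# OPTIONS --safe #-}
module Submission where

-- Cooling preserves sums that are ≥ 0; applied to G + H − (G + H) and its negative, this gives
-- additivity. Suppose Σ Gᵢ ≥ 0 and Right moves in Σ (Gᵢ)ₜ. If the move is to (Gᵢᴿ)ₜ + t, Left
-- plays the reply that wins Σ Gᵢ: whether or not the component Gⱼ of the reply is frozen,
-- (Gⱼ)ₜ + t ▷ (Gⱼᴸ)ₜ. A move in a number is useless while some component is not frozen: the
-- latter has an option at most ε above it, for every ε > 0. If all components are frozen, then at
-- the largest of their temperatures some component is not, and there every component exceeds its
-- mast value by at most an infinitesimal, so the mast values have a sum ≥ 0.

open import Defs
open import Data.Fin.Base using (Fin; zero; suc; _↑ˡ_; _↑ʳ_; splitAt)
open import Data.Fin.Properties using (splitAt-↑ˡ; splitAt-↑ʳ)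
open import Data.Integer.Base as ℤ using (ℤ; +_; -[1+_])
import Data.Integer.DivMod as ℤ
import Data.Integer.Properties as ℤ
import Data.Integer.Tactic.RingSolver as ℤSolver
open import Data.List.Base using (List; []; _∷_; _++_; map)
open import Data.List.Properties using (++-identityʳ)
open import Data.List.Relation.Binary.Permutation.Propositional
  using (_↭_; ↭-refl; ↭-sym; ↭-trans; prep; swap) renaming (refl to refl↭; trans to trans↭)
open import Data.List.Relation.Binary.Permutation.Propositional.Properties using (shift; ++-comm)
open import Data.List.Relation.Binary.Pointwise.Base using (Pointwise; []; _∷_)
open import Data.List.Relation.Unary.All as All using (All; []; _∷_)
open import Data.List.Relation.Unary.Any using (Any; here; there)
open import Data.Maybe.Base using (just)
open import Data.Nat.Base as ℕ using (ℕ; zero; suc)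
import Data.Nat.Properties as ℕ
open import Data.Product.Base using (∃; _×_; _,_; proj₁; proj₂)
open import Data.Sum.Base as Sum using (_⊎_; inj₁; inj₂; [_,_])
open import Data.Vec.Functional using () renaming (_++_ to _⧺_)
open import Function.Base using (_∘_)
open import Induction.WellFounded using (Acc; acc)
open import Relation.Binary.PropositionalEquality.Core using (_≡_; refl; sym; trans; cong; subst; subst₂)
open import Relation.Nullary using (¬_; Dec; yes; no; contradiction)
open import Tactic.RingSolver using (solve-∀)

open Thermograph

-- Sums of games as lists

-- Walls alone cannot decide the equality: cooled games with the same walls may differ by
-- infinitesimals, so the induction carries inequalities between whole sums. The reply may fall in
-- any component, hence sums of arbitrary length; as lists they can be reordered by permutations,
-- while `_⊕_` is associative and commutative only up to value.
--
-- The delicate inequality is (Gⱼ)ₜ + t ▷ (Gⱼᴸ)ₜ for a frozen Gⱼ with mast value x and temperature p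
-- < t. If it failed, then (Gⱼᴸ)ₜ ≥ x + t. Since walls have slope at most 1, this yields ρ ≥ x + p
-- for Gⱼᴸ at p, while the definition of p yields ρ ≤ x + p: no contradiction yet. The strict form
-- of the first bound, proved along the game tree, closes the gap.
--
-- An integer n has temperature -∞, but each of its Left options has ρ + 1 ≤ n at -1, so it can be
-- treated as frozen at -1. This is where t > -1 comes from. If all components are integers there is
-- no lower temperature to visit, and cooling leaves their values unchanged.

data LeftOption : Game → Game → Set where
  leftOption : ∀ {m n} {L : Fin m → Game} {R : Fin n → Game} i → LeftOption (node L R) (L i)

data RightOption : Game → Game → Set where
  rightOption : ∀ {m n} {L : Fin m → Game} {R : Fin n → Game} j → RightOption (node L R) (R j)

data Move (Option : Game → Game → Set) : List Game → List Game → Set where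
  here  : ∀ {G G′ Γ} → Option G G′ → Move Option (G ∷ Γ) (G′ ∷ Γ)
  there : ∀ {G Γ Γ′} → Move Option Γ Γ′ → Move Option (G ∷ Γ) (G ∷ Γ′)

LeftMove RightMove : List Game → List Game → Set
LeftMove  = Move LeftOption
RightMove = Move RightOption

infix 4 _◂_

_◂_ : List Game → List Game → Set
Γ′ ◂ Γ = LeftMove Γ Γ′ ⊎ RightMove Γ Γ′

-- A move in the head passes to a structurally smaller game over the same tail; a move in the tail
-- descends in accessibility under the same head.
◂-wellFounded : ∀ Γ → Acc _◂_ Γ
◂-wellFounded []      = acc λ { (inj₁ ()) ; (inj₂ ()) }
◂-wellFounded (G ∷ Γ) = extend G (◂-wellFounded Γ)
  where
  mutual
    extend : ∀ G {Γ} → Acc _◂_ Γ → Acc _◂_ (G ∷ Γ)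
    extend G (acc rs) = acc (extend′ G rs)

    extend′ : ∀ G {Γ Θ} → (∀ {Γ′} → Γ′ ◂ Γ → Acc _◂_ Γ′) → Θ ◂ (G ∷ Γ) → Acc _◂_ Θ
    extend′ (node L R) rs (inj₁ (here (leftOption i)))  = acc (extend′ (L i) rs)
    extend′ G          rs (inj₁ (there m))              = extend G (rs (inj₁ m))
    extend′ (node L R) rs (inj₂ (here (rightOption j))) = acc (extend′ (R j) rs)
    extend′ G          rs (inj₂ (there m))              = extend G (rs (inj₂ m))

-- A list of games stands for their sum.
mutual
  data WinsSecond (Γ : List Game) : Set where
    second : (∀ {Γ′} → RightMove Γ Γ′ → WinsFirst Γ′) → WinsSecond Γ

  data WinsFirst (Γ : List Game) : Set where
    first : ∀ {Γ′} → LeftMove Γ Γ′ → WinsSecond Γ′ → WinsFirst Γ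

reply : ∀ {Γ Γ′} → WinsSecond Γ → RightMove Γ Γ′ → WinsFirst Γ′
reply (second f) = f

Move-↭ : ∀ {O Γ Δ Δ′} → Γ ↭ Δ → Move O Δ Δ′ → ∃ λ Γ′ → Move O Γ Γ′ × Γ′ ↭ Δ′
Move-↭ refl↭          m                 = _ , m , ↭-refl
Move-↭ (prep x p)     (here o)          = _ , here o , prep _ p
Move-↭ (prep x p)     (there m)         = let _ , m′ , q = Move-↭ p m in _ , there m′ , prep x q
Move-↭ (swap x y p)   (here o)          = _ , there (here o) , swap x _ p
Move-↭ (swap x y p)   (there (here o))  = _ , here o , swap _ y p
Move-↭ (swap x y p)   (there (there m)) = let _ , m′ , q = Move-↭ p m in _ , there (there m′) , swap x y q
Move-↭ (trans↭ p₁ p₂) m =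
  let _ , m₁ , q₁ = Move-↭ p₂ m
      _ , m₂ , q₂ = Move-↭ p₁ m₁ in _ , m₂ , ↭-trans q₂ q₁

mutual
  second-↭ : ∀ {Γ Δ} → Γ ↭ Δ → WinsSecond Γ → WinsSecond Δ
  second-↭ p (second f) = second λ m → let _ , m′ , q = Move-↭ p m in first-↭ q (f m′)

  first-↭ : ∀ {Γ Δ} → Γ ↭ Δ → WinsFirst Γ → WinsFirst Δ
  first-↭ p (first m w) = let _ , m′ , q = Move-↭ (↭-sym p) m in first m′ (second-↭ (↭-sym q) w)

data MoveSplit (O : Game → Game → Set) (Γ Δ : List Game) : List Game → Set where
  inˡ : ∀ {Γ′} → Move O Γ Γ′ → MoveSplit O Γ Δ (Γ′ ++ Δ)
  inʳ : ∀ {Δ′} → Move O Δ Δ′ → MoveSplit O Γ Δ (Γ ++ Δ′)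

split : ∀ {O} Γ {Δ Θ} → Move O (Γ ++ Δ) Θ → MoveSplit O Γ Δ Θ
split []      m         = inʳ m
split (G ∷ Γ) (here o)  = inˡ (here o)
split (G ∷ Γ) (there m) with split Γ m
... | inˡ m′ = inˡ (there m′)
... | inʳ m′ = inʳ m′

moveˡ : ∀ {O Γ Γ′} Δ → Move O Γ Γ′ → Move O (Γ ++ Δ) (Γ′ ++ Δ)
moveˡ Δ (here o)  = here o
moveˡ Δ (there m) = there (moveˡ Δ m)

moveʳ : ∀ {O Δ Δ′} Γ → Move O Δ Δ′ → Move O (Γ ++ Δ) (Γ ++ Δ′)
moveʳ []      m = m
moveʳ (G ∷ Γ) m = there (moveʳ Γ m)

mutual
  second-++-second : ∀ {Γ Δ} → WinsSecond Γ → WinsSecond Δ → WinsSecond (Γ ++ Δ)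
  second-++-second {Γ} {Δ} v@(second f) w@(second g) = second λ m → respond (split Γ m)
    where
    respond : ∀ {Θ} → MoveSplit RightOption Γ Δ Θ → WinsFirst Θ
    respond (inˡ m) = first-++-second (f m) w
    respond (inʳ m) = second-++-first v (g m)

  first-++-second : ∀ {Γ Δ} → WinsFirst Γ → WinsSecond Δ → WinsFirst (Γ ++ Δ)
  first-++-second {Δ = Δ} (first m v) w = first (moveˡ Δ m) (second-++-second v w)

  second-++-first : ∀ {Γ Δ} → WinsSecond Γ → WinsFirst Δ → WinsFirst (Γ ++ Δ)
  second-++-first {Γ} v (first m w) = first (moveʳ Γ m) (second-++-second v w)

-- ⊖ ⊖ G is not propositionally equal to G, hence a relation rather than ⊖ itself.
data Dual : Game → Game → Set where
  dual : ∀ {m n} {L : Fin m → Game} {R : Fin n → Game} {L′ : Fin n → Game} {R′ : Fin m → Game} →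
         (∀ i → Dual (L i) (R′ i)) → (∀ j → Dual (R j) (L′ j)) → Dual (node L R) (node L′ R′)

Dual-sym : ∀ {G H} → Dual G H → Dual H G
Dual-sym (dual p q) = dual (λ j → Dual-sym (q j)) (λ i → Dual-sym (p i))

Dual-⊖ : ∀ G → Dual G (⊖ G)
Dual-⊖ (node L R) = dual (λ i → Dual-⊖ (L i)) (λ j → Dual-⊖ (R j))

Dual-map-⊖ : ∀ {G H} → Dual G H → Dual (⊖ G) (⊖ H)
Dual-map-⊖ (dual p q) = dual (λ j → Dual-map-⊖ (q j)) (λ i → Dual-map-⊖ (p i))

Dual-⧺ : ∀ {m n} {f f′ : Fin m → Game} {g g′ : Fin n → Game} →
         (∀ i → Dual (f i) (f′ i)) → (∀ j → Dual (g j) (g′ j)) → ∀ k → Dual ((f ⧺ g) k) ((f′ ⧺ g′) k)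
Dual-⧺ {m} {n} p q k with splitAt m {n} k
... | inj₁ i = p i
... | inj₂ j = q j

Dual-⊕ : ∀ {G G′ H H′} → Dual G G′ → Dual H H′ → Dual (G ⊕ H) (G′ ⊕ H′)
Dual-⊕ (dual p q) (dual p′ q′) = dual
  (Dual-⧺ (λ i → Dual-⊕ (p i) (dual p′ q′)) (λ i → Dual-⊕ (dual p q) (p′ i)))
  (Dual-⧺ (λ j → Dual-⊕ (q j) (dual p′ q′)) (λ j → Dual-⊕ (dual p q) (q′ j)))

-- Mirror strategy: each move of Right is copied in the other component.
Dual⇒second : ∀ {G H} → Dual G H → WinsSecond (G ∷ H ∷ [])
Dual⇒second (dual p q) = second λ
  { (here (rightOption j))         → first (there (here (leftOption j))) (Dual⇒second (q j))
  ; (there (here (rightOption i))) → first (here (leftOption i)) (Dual⇒second (p i)) }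

mutual
  -- Transitivity of the order. Both sums are played at once: a Left reply inside G counts as a
  -- Right move in the dual H of the other sum and is answered there, back and forth, until a reply
  -- falls in Γ or Δ.
  cut : ∀ {G H Γ Δ} → Dual G H → WinsSecond (G ∷ Γ) → WinsSecond (H ∷ Δ) → WinsSecond (Γ ++ Δ)
  cut {Γ = Γ} {Δ = Δ} d v@(second f) w@(second g) = second λ m → respond (split Γ m)
    where
    respond : ∀ {Θ} → MoveSplit RightOption Γ Δ Θ → WinsFirst Θ
    respond (inˡ m) = first-cut d (f (there m)) w
    respond (inʳ m) = cut-first d v (g (there m))

  first-cut : ∀ {G H Γ Δ} → Dual G H → WinsFirst (G ∷ Γ) → WinsSecond (H ∷ Δ) → WinsFirst (Γ ++ Δ)
  first-cut (dual p q) (first (here (leftOption i)) v) (second g) = cut-first (p i) v (g (here (rightOption i)))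
  first-cut {Δ = Δ} d  (first (there m) v)             w          = first (moveˡ Δ m) (cut d v w)

  cut-first : ∀ {G H Γ Δ} → Dual G H → WinsSecond (G ∷ Γ) → WinsFirst (H ∷ Δ) → WinsFirst (Γ ++ Δ)
  cut-first (dual p q) (second f) (first (here (leftOption j)) w) = first-cut (q j) (f (here (rightOption j))) w
  cut-first {Γ = Γ} d  v          (first (there m) w)             = first (moveʳ Γ m) (cut d v w)

-- The first hypothesis makes the sum Γ at least G, so Γ may take the place of G.
replace : ∀ {G Γ Δ} → WinsSecond (⊖ G ∷ Γ) → WinsSecond (G ∷ Δ) → WinsSecond (Γ ++ Δ)
replace {G} = cut (Dual-sym (Dual-⊖ G))

replace-first : ∀ {G Γ Δ} → WinsSecond (⊖ G ∷ Γ) → WinsFirst (G ∷ Δ) → WinsFirst (Γ ++ Δ)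
replace-first {G} = cut-first (Dual-sym (Dual-⊖ G))

first-replace : ∀ {G Γ Δ} → WinsFirst (⊖ G ∷ Γ) → WinsSecond (G ∷ Δ) → WinsFirst (Γ ++ Δ)
first-replace {G} = first-cut (Dual-sym (Dual-⊖ G))

mutual
  second-not-⊖ : ∀ {Γ} → WinsSecond Γ → ¬ WinsFirst (map ⊖_ Γ)
  second-not-⊖ (second f) (first m w) = let _ , m′ , eq = unnegate m in
    first-not-⊖ (f m′) (subst WinsSecond eq w)

  first-not-⊖ : ∀ {Γ} → WinsFirst Γ → ¬ WinsSecond (map ⊖_ Γ)
  first-not-⊖ (first m w) (second f) = second-not-⊖ w (f (negate m))

  unnegate : ∀ {Γ Δ} → LeftMove (map ⊖_ Γ) Δ → ∃ λ Γ′ → RightMove Γ Γ′ × Δ ≡ map ⊖_ Γ′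
  unnegate {node L R ∷ Γ} (here (leftOption j)) = _ , here (rightOption j) , refl
  unnegate {G ∷ Γ}        (there m) = let _ , m′ , eq = unnegate m in _ , there m′ , cong (⊖ G ∷_) eq

  negate : ∀ {Γ Γ′} → LeftMove Γ Γ′ → RightMove (map ⊖_ Γ) (map ⊖_ Γ′)
  negate (here (leftOption i)) = here (rightOption i)
  negate (there m)             = there (negate m)

-- Lists of games compared with `_⊕_`

data SumOption (O : Game → Game → Set) (G H : Game) : Game → Set where
  inˡ : ∀ {G′} → O G G′ → SumOption O G H (G′ ⊕ H)
  inʳ : ∀ {H′} → O H H′ → SumOption O G H (G ⊕ H′)

splitLeft : ∀ G H {K} → LeftOption (G ⊕ H) K → SumOption LeftOption G H K
splitLeft (node {m} L R) (node {m′} L′ R′) (leftOption k) with splitAt m {m′} k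
... | inj₁ i = inˡ (leftOption i)
... | inj₂ i = inʳ (leftOption i)

splitRight : ∀ G H {K} → RightOption (G ⊕ H) K → SumOption RightOption G H K
splitRight (node {_} {n} L R) (node {_} {n′} L′ R′) (rightOption k) with splitAt n {n′} k
... | inj₁ j = inˡ (rightOption j)
... | inj₂ j = inʳ (rightOption j)

joinLeft : ∀ {G H K} → SumOption LeftOption G H K → LeftOption (G ⊕ H) K
joinLeft {G@(node {m} L R)} {H@(node {m′} L′ R′)} (inˡ (leftOption i)) =
  subst (LeftOption (G ⊕ H)) (cong [ _ , _ ] (splitAt-↑ˡ m i m′)) (leftOption (i ↑ˡ m′))
joinLeft {G@(node {m} L R)} {H@(node {m′} L′ R′)} (inʳ (leftOption i)) =
  subst (LeftOption (G ⊕ H)) (cong [ _ , _ ] (splitAt-↑ʳ m m′ i)) (leftOption (m ↑ʳ i))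

joinRight : ∀ {G H K} → SumOption RightOption G H K → RightOption (G ⊕ H) K
joinRight {G@(node {_} {n} L R)} {H@(node {_} {n′} L′ R′)} (inˡ (rightOption j)) =
  subst (RightOption (G ⊕ H)) (cong [ _ , _ ] (splitAt-↑ˡ n j n′)) (rightOption (j ↑ˡ n′))
joinRight {G@(node {_} {n} L R)} {H@(node {_} {n′} L′ R′)} (inʳ (rightOption j)) =
  subst (RightOption (G ⊕ H)) (cong [ _ , _ ] (splitAt-↑ʳ n n′ j)) (rightOption (n ↑ʳ j))

mutual
  merge : ∀ {G H Γ} → WinsSecond (G ∷ H ∷ Γ) → WinsSecond (G ⊕ H ∷ Γ)
  merge {G} {H} {Γ} (second f) = second λ { (here o) → respond (splitRight G H o)
                                          ; (there m) → merge-first (f (there (there m))) }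
    where
    respond : ∀ {K} → SumOption RightOption G H K → WinsFirst (K ∷ Γ)
    respond (inˡ o) = merge-first (f (here o))
    respond (inʳ o) = merge-first (f (there (here o)))

  merge-first : ∀ {G H Γ} → WinsFirst (G ∷ H ∷ Γ) → WinsFirst (G ⊕ H ∷ Γ)
  merge-first (first (here o) w)          = first (here (joinLeft (inˡ o))) (merge w)
  merge-first (first (there (here o)) w)  = first (here (joinLeft (inʳ o))) (merge w)
  merge-first (first (there (there m)) w) = first (there m) (merge w)

mutual
  unmerge : ∀ {G H Γ} → WinsSecond (G ⊕ H ∷ Γ) → WinsSecond (G ∷ H ∷ Γ)
  unmerge (second f) = second λ { (here o)          → unmerge-first (f (here (joinRight (inˡ o))))
                                ; (there (here o))  → unmerge-first (f (here (joinRight (inʳ o))))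
                                ; (there (there m)) → unmerge-first (f (there m)) }

  unmerge-first : ∀ {G H Γ} → WinsFirst (G ⊕ H ∷ Γ) → WinsFirst (G ∷ H ∷ Γ)
  unmerge-first {G} {H} {Γ} (first (here o) w) = respond (splitLeft G H o) w
    where
    respond : ∀ {K} → SumOption LeftOption G H K → WinsSecond (K ∷ Γ) → WinsFirst (G ∷ H ∷ Γ)
    respond (inˡ o) w = first (here o) (unmerge w)
    respond (inʳ o) w = first (there (here o)) (unmerge w)
  unmerge-first (first (there m) w) = first (there (there m)) (unmerge w)

mutual
  second⇒ : ∀ {G} → WinsSecond (G ∷ []) → LeftWinsMovingSecond G
  second⇒ {node L R} (second f) j = first⇒ (f (here (rightOption j)))

  first⇒ : ∀ {G} → WinsFirst (G ∷ []) → LeftWinsMovingFirst G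
  first⇒ (first (here (leftOption i)) w) = i , second⇒ w

mutual
  ⇒second : ∀ {G} → LeftWinsMovingSecond G → WinsSecond (G ∷ [])
  ⇒second {node L R} f = second λ { (here (rightOption j)) → ⇒first (f j) }

  ⇒first : ∀ {G} → LeftWinsMovingFirst G → WinsFirst (G ∷ [])
  ⇒first {node L R} (i , w) = first (here (leftOption i)) (⇒second w)

-- `⊖ (G ⊕ H)` and `⊖ G ⊕ ⊖ H` agree only pointwise on options, but both are dual to `G ⊕ H`, which
-- is cut out.
merge-⊖ : ∀ {G H Γ} → WinsSecond (⊖ G ∷ ⊖ H ∷ Γ) → WinsSecond (Γ ++ ⊖ (G ⊕ H) ∷ [])
merge-⊖ {G} {H} w = cut (Dual-⊕ (Dual-sym (Dual-⊖ G)) (Dual-sym (Dual-⊖ H))) (merge w)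
                        (Dual⇒second (Dual-⊖ (G ⊕ H)))

≥ᴳ⇒second : ∀ {G H} → G ≥ᴳ H → WinsSecond (G ∷ ⊖ H ∷ [])
≥ᴳ⇒second p = unmerge (⇒second p)

second⇒≥ᴳ : ∀ {G H} → WinsSecond (G ∷ ⊖ H ∷ []) → G ≥ᴳ H
second⇒≥ᴳ w = second⇒ (merge w)

exchange : ∀ {G H Γ} → WinsSecond (G ∷ H ∷ Γ) → WinsSecond (H ∷ G ∷ Γ)
exchange = second-↭ (swap _ _ ↭-refl)

-- Numbers

-- Num k X m: X is built like the canonical form of m / 2ᵏ, not necessarily in lowest terms.
data Num : ℕ → Game → ℤ → Set where
  zeroᴺ     : ∀ {L : Fin 0 → Game} {R : Fin 0 → Game} → Num 0 (node L R) (+ 0)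
  positiveᴺ : ∀ {L : Fin 1 → Game} {R : Fin 0 → Game} {n} →
              Num 0 (L zero) (+ n) → Num 0 (node L R) (+ suc n)
  negativeᴺ : ∀ {L : Fin 0 → Game} {R : Fin 1 → Game} {n} →
              Num 0 (R zero) (ℤ.- + n) → Num 0 (node L R) -[1+ n ]
  evenᴺ     : ∀ {k X m} → Num k X m → Num (suc k) X (m ℤ.+ m)
  oddᴺ      : ∀ {L : Fin 1 → Game} {R : Fin 1 → Game} {k m} →
              Num k (L zero) m → Num k (R zero) (ℤ.suc m) → Num (suc k) (node L R) (ℤ.suc (m ℤ.+ m))

Num-⊖ : ∀ {k X m} → Num k X m → Num k (⊖ X) (ℤ.- m)
Num-⊖ zeroᴺ = zeroᴺ
Num-⊖ (positiveᴺ N) = negativeᴺ (Num-⊖ N)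
Num-⊖ (negativeᴺ {n = n} N) = positiveᴺ (subst (Num 0 _) (ℤ.neg-involutive (+ n)) (Num-⊖ N))
Num-⊖ (evenᴺ {m = m} N) = subst (Num _ _) (sym (ℤ.neg-distrib-+ m m)) (evenᴺ (Num-⊖ N))
Num-⊖ (oddᴺ {m = m} N M) = subst (Num _ _) (lem m)
  (oddᴺ (Num-⊖ M) (subst (Num _ _) (lem′ m) (Num-⊖ N)))
  where
  lem : ∀ m → + 1 ℤ.+ ((ℤ.- (+ 1 ℤ.+ m)) ℤ.+ (ℤ.- (+ 1 ℤ.+ m))) ≡ ℤ.- (+ 1 ℤ.+ (m ℤ.+ m))
  lem = ℤSolver.solve-∀
  lem′ : ∀ m → ℤ.- m ≡ + 1 ℤ.+ (ℤ.- (+ 1 ℤ.+ m))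
  lem′ = ℤSolver.solve-∀

double-< : ∀ {m n} → m ℤ.< n → ℤ.suc (m ℤ.+ m) ℤ.< n ℤ.+ n
double-< {m} {n} m<n = ℤ.<-≤-trans
  (ℤ.suc[i]≤j⇒i<j (ℤ.≤-reflexive (lem m)))
  (ℤ.+-mono-≤ (ℤ.i<j⇒suc[i]≤j m<n) (ℤ.i<j⇒suc[i]≤j m<n))
  where
  lem : ∀ m → + 1 ℤ.+ (+ 1 ℤ.+ (m ℤ.+ m)) ≡ (+ 1 ℤ.+ m) ℤ.+ (+ 1 ℤ.+ m)
  lem = ℤSolver.solve-∀

i<suc : ∀ i → i ℤ.< ℤ.suc i
i<suc i = ℤ.suc[i]≤j⇒i<j ℤ.≤-refl

Num-right : ∀ {k X X′ m} → Num k X m → RightOption X X′ → ∃ λ m′ → m ℤ.< m′ × Num k X′ m′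
Num-right (negativeᴺ {n = n} N) (rightOption zero) = ℤ.- + n , lem n , N
  where
  lem : ∀ n → -[1+ n ] ℤ.< ℤ.- + n
  lem zero    = ℤ.-<+
  lem (suc n) = ℤ.-<- (ℕ.n<1+n n)
Num-right (evenᴺ {m = m} N) o = let m′ , m<m′ , N′ = Num-right N o in
  _ , ℤ.<-trans (i<suc (m ℤ.+ m)) (double-< m<m′) , evenᴺ N′
Num-right (oddᴺ {m = m} N M) (rightOption zero) = _ , double-< (i<suc m) , evenᴺ M

Num-left : ∀ {k X X′ m} → Num k X m → LeftOption X X′ → ∃ λ m′ → m′ ℤ.< m × Num k X′ m′
Num-left (positiveᴺ {n = n} N) (leftOption zero) = _ , ℤ.+<+ (ℕ.n<1+n n) , N
Num-left (evenᴺ N) o = let m′ , m<m′ , N′ = Num-left N o in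
  _ , ℤ.<-trans (i<suc (m′ ℤ.+ m′)) (double-< m<m′) , evenᴺ N′
Num-left (oddᴺ {m = m} N M) (leftOption zero) = _ , i<suc (m ℤ.+ m) , evenᴺ N

data Nums (k : ℕ) : List Game → ℤ → Set where
  []  : Nums k [] (+ 0)
  _∷_ : ∀ {X Γ m s} → Num k X m → Nums k Γ s → Nums k (X ∷ Γ) (m ℤ.+ s)

Nums-⊖ : ∀ {k Γ s} → Nums k Γ s → Nums k (map ⊖_ Γ) (ℤ.- s)
Nums-⊖ [] = []
Nums-⊖ (_∷_ {m = m} {s} N Ns) = subst (Nums _ _) (sym (ℤ.neg-distrib-+ m s)) (Num-⊖ N ∷ Nums-⊖ Ns)

Nums-right : ∀ {k Γ Γ′ s} → Nums k Γ s → RightMove Γ Γ′ → ∃ λ s′ → s ℤ.< s′ × Nums k Γ′ s′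
Nums-right (_∷_ {s = s} N Ns) (here o) = let _ , lt , N′ = Num-right N o in _ , ℤ.+-monoˡ-< s lt , N′ ∷ Ns
Nums-right (_∷_ {m = m} N Ns) (there o) = let _ , lt , Ns′ = Nums-right Ns o in _ , ℤ.+-monoʳ-< m lt , N ∷ Ns′

Nums-left : ∀ {k Γ Γ′ s} → Nums k Γ s → LeftMove Γ Γ′ → ∃ λ s′ → s′ ℤ.< s × Nums k Γ′ s′
Nums-left (_∷_ {s = s} N Ns) (here o) = let _ , lt , N′ = Num-left N o in _ , ℤ.+-monoˡ-< s lt , N′ ∷ Ns
Nums-left (_∷_ {m = m} N Ns) (there o) = let _ , lt , Ns′ = Nums-left Ns o in _ , ℤ.+-monoʳ-< m lt , N ∷ Ns′

double : ∀ {k Γ s} → Nums k Γ s → Nums (suc k) Γ (s ℤ.+ s)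
double [] = []
double (_∷_ {m = m} {s} N Ns) = subst (Nums _ _) (lem m s) (evenᴺ N ∷ double Ns)
  where
  lem : ∀ m s → (m ℤ.+ m) ℤ.+ (s ℤ.+ s) ≡ (m ℤ.+ s) ℤ.+ (m ℤ.+ s)
  lem = ℤSolver.solve-∀

-- A Left move that loses exactly one unit 2⁻ᵏ, the least possible loss at level k.
UnitMove : ℕ → List Game → ℤ → Set
UnitMove k Γ s = ∃ λ Γ′ → ∃ λ s′ → LeftMove Γ Γ′ × Nums k Γ′ s′ × s ≡ ℤ.suc s′

unit-there : ∀ {k X Γ m s} → Num k X m → UnitMove k Γ s → UnitMove k (X ∷ Γ) (m ℤ.+ s)
unit-there {m = m} N (_ , s′ , mv , Ns′ , refl) = _ , _ , there mv , N ∷ Ns′ , lem m s′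
  where
  lem : ∀ m s → m ℤ.+ (+ 1 ℤ.+ s) ≡ + 1 ℤ.+ (m ℤ.+ s)
  lem = ℤSolver.solve-∀

integers-unit : ∀ {Γ s} → Nums 0 Γ s → UnitMove 0 Γ s ⊎ s ℤ.≤ + 0
integers-unit [] = inj₂ ℤ.≤-refl
integers-unit (_∷_ {s = s} (positiveᴺ {n = n} N) Ns) =
  inj₁ (_ , _ , here (leftOption zero) , N ∷ Ns , ℤ.+-assoc (+ 1) (+ n) s)
integers-unit (zeroᴺ ∷ Ns)       = Sum.map (unit-there zeroᴺ) (ℤ.+-mono-≤ (ℤ.≤-refl {+ 0})) (integers-unit Ns)
integers-unit (negativeᴺ N ∷ Ns) = Sum.map (unit-there (negativeᴺ N)) (ℤ.+-mono-≤ ℤ.-≤+) (integers-unit Ns)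

-- An odd component has a Left option one unit below it; if no component is odd, all of them already
-- live at level k.
halve : ∀ {k Γ s} → Nums (suc k) Γ s → UnitMove (suc k) Γ s ⊎ (∃ λ s′ → Nums k Γ s′ × s ≡ s′ ℤ.+ s′)
halve [] = inj₂ (+ 0 , [] , refl)
halve (_∷_ {s = s} (oddᴺ {m = m} N M) Ns) =
  inj₁ (_ , _ , here (leftOption zero) , evenᴺ N ∷ Ns , ℤ.+-assoc (+ 1) (m ℤ.+ m) s)
halve (_∷_ (evenᴺ {m = m} N) Ns) =
  Sum.map (unit-there (evenᴺ N)) (λ { (s′ , Ns′ , refl) → _ , N ∷ Ns′ , lem m s′ }) (halve Ns)
  where
  lem : ∀ m s → (m ℤ.+ m) ℤ.+ (s ℤ.+ s) ≡ (m ℤ.+ s) ℤ.+ (m ℤ.+ s)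
  lem = ℤSolver.solve-∀

GoodMove : ℕ → List Game → Set
GoodMove k Γ = ∃ λ Γ′ → ∃ λ s′ → LeftMove Γ Γ′ × Nums k Γ′ s′ × + 0 ℤ.≤ s′

unit⇒good : ∀ {k Γ s} → + 0 ℤ.< s → UnitMove k Γ s → GoodMove k Γ
unit⇒good 0<s (_ , s′ , mv , Ns , refl) = _ , s′ , mv , Ns ,
  subst (+ 0 ℤ.≤_) (ℤ.pred-suc s′) (ℤ.i<j⇒i≤pred[j] 0<s)

-- Descent on the level. A unit move from a positive sum leaves at least 0; where `halve` finds
-- none, the sum is read at the coarser level. At level 0 a positive sum contains a positive
-- integer.
goodMove : ∀ k {Γ s} → Nums k Γ s → + 0 ℤ.< s → GoodMove k Γ
goodMove zero Ns 0<s = [ unit⇒good 0<s , (λ s≤0 → contradiction s≤0 (ℤ.<⇒≱ 0<s)) ] (integers-unit Ns)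
goodMove (suc k) Ns 0<s with halve Ns
... | inj₁ u = unit⇒good 0<s u
... | inj₂ (s′ , Ns′ , refl) =
  let _ , s″ , mv , Ns″ , 0≤s″ = goodMove k Ns′
        (ℤ.≰⇒> λ s′≤0 → ℤ.<⇒≱ 0<s (ℤ.+-mono-≤ s′≤0 s′≤0)) in
  _ , _ , mv , double Ns″ , ℤ.+-mono-≤ 0≤s″ 0≤s″

-- Moving in a number always costs the mover: Right's move makes the sum positive, and a `GoodMove`
-- restores the invariant.
nums-second : ∀ {k Γ s} → Acc _◂_ Γ → Nums k Γ s → + 0 ℤ.≤ s → WinsSecond Γ
nums-second {k} (acc rs) Ns 0≤s = second λ m →
  let s′ , s<s′ , Ns′ = Nums-right Ns m in answer (rs (inj₂ m)) Ns′ (ℤ.≤-<-trans 0≤s s<s′)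
  where
  answer : ∀ {Γ s} → Acc _◂_ Γ → Nums k Γ s → + 0 ℤ.< s → WinsFirst Γ
  answer (acc rs) Ns 0<s = let _ , _ , mv , Ns′ , 0≤s′ = goodMove k Ns 0<s in
    first mv (nums-second (rs (inj₁ mv)) Ns′ 0≤s′)

nums-first : ∀ {k Γ s} → Nums k Γ s → + 0 ℤ.< s → WinsFirst Γ
nums-first {k} Ns 0<s = let Γ′ , _ , mv , Ns′ , 0≤s′ = goodMove k Ns 0<s in
  first mv (nums-second (◂-wellFounded Γ′) Ns′ 0≤s′)

integer-num : ∀ n → Num 0 (integer n) n
integer-num (+ zero)     = zeroᴺ
integer-num (+ suc n)    = positiveᴺ (integer-num (+ n))
integer-num -[1+ zero ]  = negativeᴺ zeroᴺ
integer-num -[1+ suc n ] = negativeᴺ (integer-num -[1+ n ])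

canonicalForm-num : ∀ m k → Num k (canonicalForm m k) m
canonicalForm-num m zero = integer-num m
canonicalForm-num m (suc k) with m ℤ.%ℕ 2 | ℤ.a≡a%ℕn+[a/ℕn]*n m 2 | ℤ.n%ℕd<d m 2
... | zero  | eq | _ = subst (Num _ _) (sym (trans eq (lem (m ℤ./ℕ 2)))) (evenᴺ (canonicalForm-num (m ℤ./ℕ 2) k))
  where
  lem : ∀ q → + 0 ℤ.+ q ℤ.* + 2 ≡ q ℤ.+ q
  lem = ℤSolver.solve-∀
... | suc zero | eq | _ = subst (Num _ _) (sym (trans eq (lem (m ℤ./ℕ 2))))
    (oddᴺ (canonicalForm-num (m ℤ./ℕ 2) k) (canonicalForm-num (ℤ.suc (m ℤ./ℕ 2)) k))
  where
  lem : ∀ q → + 1 ℤ.+ q ℤ.* + 2 ≡ + 1 ℤ.+ (q ℤ.+ q)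
  lem = ℤSolver.solve-∀
... | suc (suc _) | _ | ℕ.s≤s (ℕ.s≤s ())

-- The level is part of the data because summands come with different denominators; `_⊹_` raises
-- both to a common level.
record Numbers (Γ : List Game) (x : 𝔻) : Set where
  constructor numbers
  field
    {level}   : ℕ
    {units}   : ℤ
    nums      : Nums level Γ units
    value     : x ≃ units /2^ level

Numbers-[] : Numbers [] 0𝔻
Numbers-[] = numbers {level = 0} [] ≃-refl

double-value : ∀ s k → (s ℤ.+ s) /2^ suc k ≃ s /2^ k
double-value s k = ≃-trans (/2^-≡ (lem s) (ℕ.+-comm 1 k)) (/2^-refine s k 1)
  where
  lem : ∀ s → s ℤ.+ s ≡ s ℤ.* + 2
  lem = ℤSolver.solve-∀
  /2^-≡ : ∀ {s t k l} → s ≡ t → k ≡ l → s /2^ k ≃ t /2^ l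
  /2^-≡ refl refl = ≃-refl

raise : ∀ d {k Γ s} → Nums k Γ s → ∃ λ s′ → Nums (d ℕ.+ k) Γ s′ × s /2^ k ≃ s′ /2^ (d ℕ.+ k)
raise zero    Ns = _ , Ns , ≃-refl
raise (suc d) {k} Ns = let s′ , Ns′ , eq = raise d Ns in
  _ , double Ns′ , ≃-trans eq (≃-sym (double-value s′ (d ℕ.+ k)))

nums-++ : ∀ {k Γ Δ s t} → Nums k Γ s → Nums k Δ t → Nums k (Γ ++ Δ) (s ℤ.+ t)
nums-++ [] Ms = subst (Nums _ _) (sym (ℤ.+-identityˡ _)) Ms
nums-++ {t = t} (_∷_ {m = m} {s} N Ns) Ms = subst (Nums _ _) (sym (ℤ.+-assoc m s t)) (N ∷ nums-++ Ns Ms)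

infixr 5 _⊹_

_⊹_ : ∀ {Γ Δ x y} → Numbers Γ x → Numbers Δ y → Numbers (Γ ++ Δ) (x + y)
_⊹_ {Δ = Δ} (numbers {k} Ns eq) (numbers {l} Ms eq′) =
  let s , Ns′ , eqˢ = raise l Ns
      t , Ms′ , eqᵗ = raise k Ms in
  numbers {level = l ℕ.+ k}
    (nums-++ Ns′ (subst (λ j → Nums j Δ t) (ℕ.+-comm k l) Ms′))
    (≃-trans (+-cong (≃-trans eq eqˢ) (≃-trans eq′ (≃-trans eqᵗ
      (subst (λ j → t /2^ (k ℕ.+ l) ≃ t /2^ j) (ℕ.+-comm k l) ≃-refl))))
             (≃-sym (/2^-homo-+ s t (l ℕ.+ k))))

canonical-number : ∀ x → Numbers (canonical x ∷ []) x
canonical-number (m /2^ k) = numbers {level = k} {units = m ℤ.+ + 0} (canonicalForm-num m k ∷ [])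
  (subst (λ n → m /2^ k ≃ n /2^ k) (sym (ℤ.+-identityʳ m)) ≃-refl)

Numbers-⊖ : ∀ {Γ x} → Numbers Γ x → Numbers (map ⊖_ Γ) (- x)
Numbers-⊖ (numbers Ns eq) = numbers (Nums-⊖ Ns) (-‿cong eq)

Numbers-right : ∀ {Γ Γ′ x} → Numbers Γ x → RightMove Γ Γ′ → ∃ λ x′ → x < x′ × Numbers Γ′ x′
Numbers-right (numbers {k} Ns eq) m = let s′ , s<s′ , Ns′ = Nums-right Ns m in
  s′ /2^ k , ≰⇒> (λ p → <⇒≱ (/2^-mono-< k s<s′) (≤-respʳ-≃ eq p)) , numbers Ns′ ≃-refl

Numbers-left : ∀ {Γ Γ′ x} → Numbers Γ x → LeftMove Γ Γ′ → ∃ λ x′ → x′ < x × Numbers Γ′ x′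
Numbers-left (numbers {k} Ns eq) m = let s′ , s′<s , Ns′ = Nums-left Ns m in
  s′ /2^ k , ≰⇒> (λ p → <⇒≱ (/2^-mono-< k s′<s) (≤-respˡ-≃ eq p)) , numbers Ns′ ≃-refl

numbers-second : ∀ {Γ x} → Numbers Γ x → 0𝔻 ≤ x → WinsSecond Γ
numbers-second {Γ} (numbers {k} Ns eq) 0≤x = nums-second (◂-wellFounded Γ) Ns
  (/2^-cancel-≤ k (≤-respˡ-≃ (≃-sym (0/2^ k)) (≤-respʳ-≃ eq 0≤x)))

numbers-first : ∀ {Γ x} → Numbers Γ x → 0𝔻 < x → WinsFirst Γ
numbers-first (numbers {k} {s} Ns eq) 0<x = nums-first Ns
  (ℤ.≰⇒> λ s≤0 → <⇒≱ 0<x (≤-respˡ-≃ (≃-sym eq) (≤-respʳ-≃ (0/2^ k) (/2^-mono-≤ k s≤0))))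

-- For negative x, Left would win the negated sum moving first.
second⇒0≤ : ∀ {Γ x} → Numbers Γ x → WinsSecond Γ → 0𝔻 ≤ x
second⇒0≤ {x = x} Ns w with 0𝔻 ≤? x
... | yes 0≤x = 0≤x
... | no  0≰x = contradiction (numbers-first (Numbers-⊖ Ns) (≰⇒> λ p → 0≰x (by-≤ p (lem x)))) (second-not-⊖ w)
  where
  lem : ∀ x → x - 0𝔻 ≃ 0𝔻 - - x
  lem = solve-∀ 𝔻-ring

first⇒0< : ∀ {Γ x} → Numbers Γ x → WinsFirst Γ → 0𝔻 < x
first⇒0< {x = x} Ns w = ≰⇒> λ x≤0 →
  first-not-⊖ w (numbers-second (Numbers-⊖ Ns) (by-≤ x≤0 (lem x)))
  where
  lem : ∀ x → - x - 0𝔻 ≃ 0𝔻 - x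
  lem = solve-∀ 𝔻-ring

half : 𝔻 → 𝔻
half (m /2^ k) = m /2^ suc k

half+half : ∀ x → half x + half x ≃ x
half+half (m /2^ k) = ≃-trans (≃-sym (/2^-homo-+ m m (suc k))) (double-value m k)

half-positive : ∀ {x} → 0𝔻 < x → 0𝔻 < half x
half-positive {x} 0<x = ≰⇒> λ h≤0 → <⇒≱ 0<x (≤-respˡ-≃ (half+half x)
  (≤-trans (+-mono-≤ h≤0 h≤0) (≤-reflexive lem)))
  where
  lem : 0𝔻 + 0𝔻 ≃ 0𝔻
  lem = solve-∀ 𝔻-ring

0≤-limit : ∀ {x} → (∀ ε → 0𝔻 < ε → 0𝔻 ≤ x + ε) → 0𝔻 ≤ x
0≤-limit {x} bound with 0𝔻 ≤? x
... | yes p = p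
... | no ¬p = contradiction (≤-respˡ-≃ (half+half (- x)) (≤-respʳ-≃ lem₀ (+-mono-≤ h≤0 h≤0))) (<⇒≱ 0<-x)
  where
  lem₀ : 0𝔻 + 0𝔻 ≃ 0𝔻
  lem₀ = solve-∀ 𝔻-ring
  lem₁ : ∀ x → x - 0𝔻 ≃ 0𝔻 - - x
  lem₁ = solve-∀ 𝔻-ring
  lem₂ : ∀ x h → 0𝔻 - h ≃ ((x + h) - 0𝔻) + (- x - (h + h))
  lem₂ = solve-∀ 𝔻-ring
  0<-x : 0𝔻 < - x
  0<-x = ≰⇒> λ -x≤0 → ¬p (by-≤ -x≤0 (lem₁ x))
  -- For negative x, taking ε = -x/2 leaves x + ε negative.
  h = half (- x)
  h≤0 : h ≤ 0𝔻
  h≤0 = by-≤₂ (bound h (half-positive 0<-x)) (≤-reflexive (half+half (- x))) (lem₂ x h)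

-- Thermographs and negation

-- Certificates for linear arithmetic: the difference of the two sides is written as a sum of
-- differences known to be positive or nonnegative, and the ring solver checks the identity.
by-< : ∀ {x y a b} → a < b → y - x ≃ b - a → x < y
by-< {x} {y} {a} {b} a<b eq = ≰⇒> λ y≤x → <⇒≱ a<b
  (by-≤ y≤x (≃-trans (lem a b) (≃-trans (-‿cong (≃-sym eq)) (≃-sym (lem x y)))))
  where
  lem : ∀ x y → x - y ≃ - (y - x)
  lem = solve-∀ 𝔻-ring

by-<₂ : ∀ {x y a b c d} → a < b → c ≤ d → y - x ≃ (b - a) + (d - c) → x < y
by-<₂ {x} {y} {a} {b} {c} {d} a<b c≤d eq = ≰⇒> λ y≤x → <⇒≱ a<b
  (by-≤₂ y≤x c≤d (≃-trans (lem a b c d) (≃-trans (+-congʳ (d - c) (-‿cong (≃-sym eq))) (lem′ x y (d - c)))))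
  where
  lem : ∀ a b c d → a - b ≃ - ((b - a) + (d - c)) + (d - c)
  lem = solve-∀ 𝔻-ring
  lem′ : ∀ x y e → - (y - x) + e ≃ (x - y) + e
  lem′ = solve-∀ 𝔻-ring

by-<₃ : ∀ {x y a b c d e f} → a < b → c ≤ d → e ≤ f → y - x ≃ (b - a) + ((d - c) + (f - e)) → x < y
by-<₃ {a = a} {b} {c} {d} {e} {f} a<b c≤d e≤f eq = by-<₂ a<b (+-mono-≤ c≤d e≤f) (≃-trans eq (lem a b c d e f))
  where
  lem : ∀ a b c d e f → (b - a) + ((d - c) + (f - e)) ≃ (b - a) + ((d + f) - (c + e))
  lem = solve-∀ 𝔻-ring

<⇒≤ : ∀ {x y} → x < y → x ≤ y
<⇒≤ x<y = ≰⇒≥ (<⇒≱ x<y)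

max-cong : ∀ {n} {f g : Fin (suc n) → 𝔻} → (∀ i → f i ≃ g i) → max f ≃ max g
max-cong {f = f} {g} eq = ≤-antisym
  (max-lub f λ i → ≤-trans (≤-reflexive (eq i)) (≤-max g i))
  (max-lub g λ i → ≤-trans (≤-reflexive (≃-sym (eq i))) (≤-max f i))

min-cong : ∀ {n} {f g : Fin (suc n) → 𝔻} → (∀ i → f i ≃ g i) → min f ≃ min g
min-cong {f = f} {g} eq = ≤-antisym
  (min-glb g λ i → ≤-trans (min-≤ f i) (≤-reflexive (eq i)))
  (min-glb f λ i → ≤-trans (min-≤ g i) (≤-reflexive (≃-sym (eq i))))

data NonInteger : Game → Set where
  nonInteger : ∀ {m n} {L : Fin (suc m) → Game} {R : Fin (suc n) → Game} →
               ¬ IsInteger (node L R) → NonInteger (node L R)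

module _ {m n} (L : Fin m → Game) (R : Fin n → Game)
         (θL : ∀ i → Thermograph (L i)) (θR : ∀ j → Thermograph (R j)) where
  open Options L R θL θR

  between⇒isInteger : Between → IsInteger (node L R)
  between⇒isInteger b = let k , p = between⇒integer b in k , ⊒⇒≈ᴳ (node L R) (integer k) p

integer? : ∀ G → IsInteger G ⊎ NonInteger G
integer? (node {zero} L R) = inj₁ (between⇒isInteger L R (λ i → thermograph (L i)) θR
  (let k , k< = lowerBound (λ j → ceiling (θR j)) in k , (λ ()) , k<))
  where
  θR = λ j → thermograph (R j)
integer? (node {suc m} {zero} L R) = inj₁ (between⇒isInteger L R θL (λ j → thermograph (R j))
  (let k , <k = upperBound (λ i → floor (θL i)) in k , <k , (λ ())))
  where
  θL = λ i → thermograph (L i)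
integer? (node {suc m} {suc n} L R) = decide (λ i → thermograph (L i)) (λ j → thermograph (R j))
  where
  decide : (∀ i → Thermograph (L i)) → (∀ j → Thermograph (R j)) → IsInteger (node L R) ⊎ NonInteger (node L R)
  decide θL θR = go (Extrema.between? L R θL θR)
    where
    go : Dec (Options.Between L R θL θR) → IsInteger (node L R) ⊎ NonInteger (node L R)
    go (yes b) = inj₁ (between⇒isInteger L R θL θR b)
    go (no ¬b) = inj₂ (nonInteger (¬b ∘ Options.integer⇒between L R θL θR))

-- The clauses of `Cooling` determine the walls, so the properties of those constructed by
-- `thermograph` carry over to the abstract λₜ and ρₜ.
SameWalls : ∀ {G} → Thermograph G → Set
SameWalls {G} θ = ∀ t → λₜ t G ≃ left θ t × ρₜ t G ≃ right θ t

module Unique {m n} (L : Fin (suc m) → Game) (R : Fin (suc n) → Game)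
              (θL : ∀ i → Thermograph (L i)) (θR : ∀ j → Thermograph (R j))
              (sameL : ∀ i → SameWalls (θL i)) (sameR : ∀ j → SameWalls (θR j)) where
  open Extrema L R θL θR using (left~; right~; left~-wall; right~-wall; Step)

  left≃ : ∀ t → λ̃ₜ t L ≃ left~ t
  left≃ t = max-cong λ i → +-congʳ (- t) (proj₂ (sameL i t))

  right≃ : ∀ t → ρ̃ₜ t R ≃ right~ t
  right≃ t = min-cong λ j → +-congʳ t (proj₁ (sameR j t))

  -- Both temperatures are least solutions of the same equation up to `_≃_`, so they agree, and then
  -- so do the clauses below and above them.
  node-sameWalls : (S : Step) → ¬ IsInteger (node L R) → SameWalls (Step.thermograph S)
  node-sameWalls S ¬int = compare (temp-least L R ¬int) (least ¬int)
    where
    open Step S renaming (thermograph to θ)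
    compare : (∃ λ τ → temp (node L R) ≡ just τ × IsLeast (λ t → λ̃ₜ t L ≃ ρ̃ₜ t R) τ) →
              (∃ λ τ → freeze θ ≡ just τ × IsLeast (λ t → left~ t ≃ right~ t) τ) → SameWalls θ
    compare (τ , temp≡ , meet , τ-least) (τ′ , freeze≡ , meet′ , τ′-least) t = go (t ≤? τ)
      where
      τ≃τ′ : τ ≃ τ′
      τ≃τ′ = ≤-antisym (τ-least τ′ (≃-trans (left≃ τ′) (≃-trans meet′ (≃-sym (right≃ τ′)))))
                       (τ′-least τ (≃-trans (≃-sym (left≃ τ)) (≃-trans meet (right≃ τ))))
      at-τ : λ̃ₜ τ L ≃ left θ τ′
      at-τ = ≃-trans (left≃ τ) (≃-trans (congruent left~-wall τ≃τ′)
                                        (≃-sym (proj₁ (below τ′ freeze≡ ≤-refl))))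
      go : Dec (t ≤ τ) → λₜ t (node L R) ≃ left θ t × ρₜ t (node L R) ≃ right θ t
      go (yes t≤τ) = let l , r , _ = below t freeze≡ (≤-trans t≤τ (≤-reflexive τ≃τ′)) in
        ≃-trans (below-λₜ L R t temp≡ t≤τ) (≃-trans (left≃ t) (≃-sym l)) ,
        ≃-trans (below-ρₜ L R t temp≡ t≤τ) (≃-trans (right≃ t) (≃-sym r))
      go (no t≰τ) = let l , r , _ = above-case θ t freeze≡ (≰⇒> λ p → t≰τ (≤-trans p (≤-reflexive (≃-sym τ≃τ′)))) in
        ≃-trans (≃-trans (above-λₜ t temp≡ (≰⇒> t≰τ)) (below-λₜ L R τ temp≡ ≤-refl)) (≃-trans at-τ (≃-sym l)) ,
        ≃-trans (≃-trans (above-ρₜ t temp≡ (≰⇒> t≰τ)) (below-λₜ L R τ temp≡ ≤-refl)) (≃-trans at-τ (≃-sym r))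

  -- For a non-integer the two sides are still apart at -1, and their gap does not shrink as the
  -- temperature falls.
  -1<temp : ¬ IsInteger (node L R) → ∀ {τ} → λ̃ₜ τ L ≃ ρ̃ₜ τ R → -1𝔻 < τ
  -1<temp ¬int {τ} meet = ≰⇒> λ τ≤-1 → positive (≤-trans
    (+-mono-≤ (antitone left~-wall τ≤-1) (antitone right~-wall τ≤-1))
    (Extrema.difference L R θL θR (≤-reflexive (≃-trans (≃-sym (left≃ τ)) (≃-trans meet (right≃ τ))))))
    where
    open Extrema.NotBetween L R θL θR (¬int ∘ between⇒isInteger L R θL θR) using (positive)

integer-sameWalls : ∀ {G} (θ : Thermograph G) → IsInteger G → SameWalls θ
integer-sameWalls θ (k , p) t = let l , r , _ = proj₂ (integer-case θ k p) t in
  ≃-trans (integer-λₜ k t p) (≃-sym l) , ≃-trans (integer-ρₜ k t p) (≃-sym r)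

sameWalls : ∀ G → SameWalls (thermograph G)
sameWalls (node {m} {n} L R) = go (integer? (node L R))
  where
  go : IsInteger (node L R) ⊎ NonInteger (node L R) → SameWalls (thermograph (node L R))
  go (inj₁ int)               = integer-sameWalls (thermograph (node L R)) int
  go (inj₂ (nonInteger ¬int)) = Unique.node-sameWalls L R (λ i → thermograph (L i)) (λ j → thermograph (R j))
    (λ i → sameWalls (L i)) (λ j → sameWalls (R j))
    (Extrema.construct L R (λ i → thermograph (L i)) (λ j → thermograph (R j))) ¬int

λ-antitone : ∀ G {s t} → s ≤ t → λₜ t G ≤ λₜ s G
λ-antitone G {s} {t} s≤t = ≤-respˡ-≃ (≃-sym (proj₁ (sameWalls G t)))
  (≤-respʳ-≃ (≃-sym (proj₁ (sameWalls G s))) (antitone (left-wall (thermograph G)) s≤t))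

λ-cong : ∀ G {s t} → s ≃ t → λₜ s G ≃ λₜ t G
λ-cong G s≃t = ≤-antisym (λ-antitone G (≤-reflexive (≃-sym s≃t))) (λ-antitone G (≤-reflexive s≃t))

ρ-lipschitz : ∀ G {s t} → s ≤ t → ρₜ t G ≤ ρₜ s G + (t - s)
ρ-lipschitz G {s} {t} s≤t = ≤-respˡ-≃ (≃-sym (proj₂ (sameWalls G t)))
  (≤-respʳ-≃ (+-congʳ (t - s) (≃-sym (proj₂ (sameWalls G s))))
    (by-≤ (lipschitz (right-wall (thermograph G)) s≤t) (lem (right (thermograph G) s) (right (thermograph G) t) (t - s))))
  where
  lem : ∀ x y d → (x + d) - y ≃ (- y + d) - - x
  lem = solve-∀ 𝔻-ring

ρ-monotone : ∀ G {s t} → s ≤ t → ρₜ s G ≤ ρₜ t G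
ρ-monotone G {s} {t} s≤t = ≤-respˡ-≃ (≃-sym (proj₂ (sameWalls G s)))
  (≤-respʳ-≃ (≃-sym (proj₂ (sameWalls G t)))
    (by-≤ (antitone (right-wall (thermograph G)) s≤t) (lem (right (thermograph G) s) (right (thermograph G) t))))
  where
  lem : ∀ x y → y - x ≃ - x - - y
  lem = solve-∀ 𝔻-ring

ρ-cong : ∀ G {s t} → s ≃ t → ρₜ s G ≃ ρₜ t G
ρ-cong G s≃t = ≤-antisym (ρ-monotone G (≤-reflexive s≃t)) (ρ-monotone G (≤-reflexive (≃-sym s≃t)))

ρ≤λ : ∀ G t → ρₜ t G ≤ λₜ t G
ρ≤λ G t = ≤-respˡ-≃ (≃-sym (proj₂ (sameWalls G t)))
  (≤-respʳ-≃ (≃-sym (proj₁ (sameWalls G t))) (right≤left (thermograph G) t))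

-- At -1 the right wall of G′ is its floor, the largest integer below or equal to G′, and n ▷ G′
-- forces that integer below n. This makes -1 serve as the freezing point of an integer.
integer-leftOption : ∀ {G G′ n} → G ≈ᴳ integer n → LeftOption G G′ → ρₜ -1𝔻 G′ - -1𝔻 ≤ fromℤ n
integer-leftOption {node L R} {n = n} p (leftOption i) =
  ≤-respˡ-≃ (≃-sym (≃-trans (+-congʳ (- -1𝔻) (≃-trans (proj₂ (sameWalls (L i) -1𝔻)) (right-floor (thermograph (L i)))))
                            (≃-trans (+-comm′ (fromℤ fl) (- -1𝔻)) (≃-sym (/2^-homo-+ (+ 1) fl 0)))))
    (/2^-mono-≤ 0 (ℤ.i<j⇒suc[i]≤j fl<n))
  where
  fl = floor (thermograph (L i))
  fl<n : fl ℤ.< n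
  fl<n = Options.▷L⁻¹ L R (λ i → thermograph (L i)) (λ j → thermograph (R j))
           (⊒⇒▷L (integer n) (proj₂ (≈ᴳ⇒⊒ (node L R) (integer n) p)) i)
  +-comm′ : ∀ x y → x + y ≃ y + x
  +-comm′ = solve-∀ 𝔻-ring

-1<temp : ∀ {m n} (L : Fin (suc m) → Game) (R : Fin (suc n) → Game) → ¬ IsInteger (node L R) →
          ∀ {τ} → λ̃ₜ τ L ≃ ρ̃ₜ τ R → -1𝔻 < τ
-1<temp L R = Unique.-1<temp L R (λ i → thermograph (L i)) (λ j → thermograph (R j))
                (λ i → sameWalls (L i)) (λ j → sameWalls (R j))

integer-number : ∀ n → Numbers (integer n ∷ []) (fromℤ n)
integer-number n = canonical-number (fromℤ n)

⊖-number : ∀ {X x} → Numbers (X ∷ []) x → Numbers (⊖ X ∷ []) (- x)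
⊖-number = Numbers-⊖

Dual-integer : ∀ {G H n} → Dual G H → G ≈ᴳ integer n → H ≈ᴳ integer (ℤ.- n)
Dual-integer {G} {H} {n} d (G≥n , n≥G) = second⇒≥ᴳ H≥ , second⇒≥ᴳ ≥H
  where
  x-x : ∀ x → 0𝔻 ≃ x - x
  x-x = solve-∀ 𝔻-ring
  -x--x : ∀ x → 0𝔻 ≃ - x - - x
  -x--x = solve-∀ 𝔻-ring
  H≥ : WinsSecond (H ∷ ⊖ integer (ℤ.- n) ∷ [])
  H≥ = cut (Dual-⊖ (integer n)) (cut (Dual-sym (Dual-⊖ G)) (exchange (≥ᴳ⇒second n≥G)) (Dual⇒second d))
    (numbers-second (⊖-number (integer-number n) ⊹ ⊖-number (integer-number (ℤ.- n))) (≤-reflexive (-x--x (fromℤ n))))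
  ≥H : WinsSecond (integer (ℤ.- n) ∷ ⊖ H ∷ [])
  ≥H = exchange (cut (Dual-sym (Dual-⊖ (integer n))) (cut (Dual-⊖ G) (≥ᴳ⇒second G≥n) (Dual⇒second (Dual-map-⊖ d)))
    (numbers-second (integer-number n ⊹ integer-number (ℤ.- n)) (≤-reflexive (x-x (fromℤ n)))))

-- The two temperatures come from separate uses of `temp-least`, so they are compared by `_≃_` only.
record Negated {m n} (L : Fin (suc m) → Game) (R : Fin (suc n) → Game) : Set where
  field
    τ τ′  : 𝔻
    temp≡ : temp (node L R) ≡ just τ
    temp⊖ : temp (⊖ node L R) ≡ just τ′
    τ≃τ′  : τ ≃ τ′
    meets : λ̃ₜ τ L ≃ ρ̃ₜ τ R

⊖-Walls : Game → Set
⊖-Walls G = ∀ t → λₜ t (⊖ G) ≃ - ρₜ t G × ρₜ t (⊖ G) ≃ - λₜ t G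

neg-max : ∀ {n} (f : Fin (suc n) → 𝔻) → - max f ≃ min (λ i → - f i)
neg-max f = ≤-antisym
  (min-glb (λ i → - f i) (λ i → neg-mono-≤ (≤-max f i)))
  (≤-trans (min-≤ (λ i → - f i) (proj₁ att)) (neg-mono-≤ (≤-reflexive (proj₂ att))))
  where att = max-attained f

module Negation {m n} (L : Fin (suc m) → Game) (R : Fin (suc n) → Game)
                (negL : ∀ i → ⊖-Walls (L i)) (negR : ∀ j → ⊖-Walls (R j)) where
  neg-sum : ∀ x t → - x - t ≃ - (x + t)
  neg-sum = solve-∀ 𝔻-ring
  neg-diff : ∀ x t → - x + t ≃ - (x - t)
  neg-diff = solve-∀ 𝔻-ring
  neg-neg : ∀ x → x ≃ - - x
  neg-neg = solve-∀ 𝔻-ring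

  λ̃-⊖ : ∀ t → λ̃ₜ t (λ j → ⊖ R j) ≃ - ρ̃ₜ t R
  λ̃-⊖ t = ≃-trans (max-cong λ j → ≃-trans (+-congʳ (- t) (proj₂ (negR j t))) (neg-sum (λₜ t (R j)) t))
                  (≃-sym (neg-min (λ j → λₜ t (R j) + t)))

  ρ̃-⊖ : ∀ t → ρ̃ₜ t (λ i → ⊖ L i) ≃ - λ̃ₜ t L
  ρ̃-⊖ t = ≃-trans (min-cong λ i → ≃-trans (+-congʳ t (proj₁ (negL i t))) (neg-diff (ρₜ t (L i)) t))
                  (≃-sym (neg-max (λ i → ρₜ t (L i) - t)))

  negated : ¬ IsInteger (node L R) → Negated L R
  negated ¬int = compare (temp-least L R ¬int)
    (temp-least (λ j → ⊖ R j) (λ i → ⊖ L i)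
      (λ (k , p) → ¬int (ℤ.- k , Dual-integer (Dual-sym (Dual-⊖ (node L R))) p)))
    where
    compare : (∃ λ τ → temp (node L R) ≡ just τ × IsLeast (λ t → λ̃ₜ t L ≃ ρ̃ₜ t R) τ) →
              (∃ λ τ → temp (⊖ node L R) ≡ just τ ×
                       IsLeast (λ t → λ̃ₜ t (λ j → ⊖ R j) ≃ ρ̃ₜ t (λ i → ⊖ L i)) τ) → Negated L R
    compare (τ , temp≡ , meet , least) (τ′ , temp⊖ , meet′ , least′) = record
      { temp≡ = temp≡ ; temp⊖ = temp⊖ ; meets = meet
      ; τ≃τ′ = ≤-antisym
          (least τ′ (≃-trans (neg-neg (λ̃ₜ τ′ L))
                    (≃-trans (-‿cong (≃-trans (≃-sym (ρ̃-⊖ τ′)) (≃-trans (≃-sym meet′) (λ̃-⊖ τ′))))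
                    (≃-sym (neg-neg (ρ̃ₜ τ′ R))))))
          (least′ τ (≃-trans (λ̃-⊖ τ) (≃-trans (-‿cong (≃-sym meet)) (≃-sym (ρ̃-⊖ τ))))) }

  below-walls : (N : Negated L R) → ∀ t → t ≤ Negated.τ N →
                λₜ t (⊖ node L R) ≃ - ρₜ t (node L R) × ρₜ t (⊖ node L R) ≃ - λₜ t (node L R)
  below-walls N t t≤τ =
    ≃-trans (below-λₜ (λ j → ⊖ R j) (λ i → ⊖ L i) t temp⊖ t≤τ′)
      (≃-trans (λ̃-⊖ t) (-‿cong (≃-sym (below-ρₜ L R t temp≡ t≤τ)))) ,
    ≃-trans (below-ρₜ (λ j → ⊖ R j) (λ i → ⊖ L i) t temp⊖ t≤τ′)
      (≃-trans (ρ̃-⊖ t) (-‿cong (≃-sym (below-λₜ L R t temp≡ t≤τ))))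
    where
    open Negated N
    t≤τ′ = ≤-trans t≤τ (≤-reflexive τ≃τ′)

  frozen-walls : (N : Negated L R) → λₜ (Negated.τ′ N) (⊖ node L R) ≃ - λₜ (Negated.τ N) (node L R)
  frozen-walls N = ≃-trans (proj₁ (below-walls N τ′ (≤-reflexive (≃-sym τ≃τ′))))
    (-‿cong (≃-trans (ρ-cong (node L R) (≃-sym τ≃τ′))
      (≃-trans (below-ρₜ L R τ temp≡ ≤-refl) (≃-trans (≃-sym meets) (≃-sym (below-λₜ L R τ temp≡ ≤-refl))))))
    where open Negated N

  walls : Negated L R → ⊖-Walls (node L R)
  walls N t = go (t ≤? τ)
    where
    open Negated N
    go : Dec (t ≤ τ) → λₜ t (⊖ node L R) ≃ - ρₜ t (node L R) × ρₜ t (⊖ node L R) ≃ - λₜ t (node L R)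
    go (yes t≤τ) = below-walls N t t≤τ
    go (no  t≰τ) =
      ≃-trans (above-λₜ t temp⊖ τ′<t) (≃-trans (frozen-walls N) (-‿cong (≃-sym (above-ρₜ t temp≡ (≰⇒> t≰τ))))) ,
      ≃-trans (above-ρₜ t temp⊖ τ′<t) (≃-trans (frozen-walls N) (-‿cong (≃-sym (above-λₜ t temp≡ (≰⇒> t≰τ)))))
      where τ′<t = ≰⇒> λ p → t≰τ (≤-trans p (≤-reflexive (≃-sym τ≃τ′)))

⊖-walls : ∀ G → ⊖-Walls G
⊖-walls (node {m} {n} L R) = go (integer? (node L R))
  where
  go : IsInteger (node L R) ⊎ NonInteger (node L R) → ⊖-Walls (node L R)
  go (inj₁ (k , p)) t =
    ≃-trans (integer-λₜ (ℤ.- k) t p′) (-‿cong (≃-sym (integer-ρₜ k t p))) ,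
    ≃-trans (integer-ρₜ (ℤ.- k) t p′) (-‿cong (≃-sym (integer-λₜ k t p)))
    where p′ = Dual-integer (Dual-⊖ (node L R)) p
  go (inj₂ (nonInteger ¬int)) =
    Neg.walls (Neg.negated ¬int)
    where module Neg = Negation L R (λ i → ⊖-walls (L i)) (λ j → ⊖-walls (R j))

negated : ∀ {m n} {L : Fin (suc m) → Game} {R : Fin (suc n) → Game} → ¬ IsInteger (node L R) → Negated L R
negated {L = L} {R} = Negation.negated L R (λ i → ⊖-walls (L i)) (λ j → ⊖-walls (R j))

-- Mirror strategy: up to the temperature, the taxes of opposite options cancel; above it, the mast
-- values are opposite. It allows `cool t (⊖ G)` to be replaced by `⊖ cool t G`, which turns bounds
-- by ρ into bounds by λ.
cool-⊖ : ∀ t G → WinsSecond (⊖ cool t G ∷ ⊖ cool t (⊖ G) ∷ [])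
cool-⊖ t (node {m} {n} L R) = go (integer? (node L R))
  where
  -x--x : ∀ x → 0𝔻 ≃ - x - - x
  -x--x = solve-∀ 𝔻-ring
  G = node L R
  values : ∀ {X Y x y} → X ≡ canonical x → Y ≡ canonical y → y ≃ - x → WinsSecond (⊖ X ∷ ⊖ Y ∷ [])
  values {x = x} {y} refl refl y≃-x = numbers-second (⊖-number (canonical-number x) ⊹ ⊖-number (canonical-number y))
    (≤-reflexive (≃-trans (-x--x x) (+-congˡ (- x) (-‿cong (≃-sym y≃-x)))))
  both : ∀ {a b c d} → WinsSecond (⊖ a ∷ ⊖ c ∷ []) → WinsSecond (⊖ b ∷ ⊖ d ∷ []) →
         WinsSecond (⊖ (a ⊕ b) ∷ ⊖ (c ⊕ d) ∷ [])
  both v w = merge-⊖ (merge-⊖ (second-↭ (prep _ (swap _ _ ↭-refl)) (second-++-second v w)))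
  go : IsInteger G ⊎ NonInteger G → WinsSecond (⊖ cool t G ∷ ⊖ cool t (⊖ G) ∷ [])
  go (inj₁ (k , p)) = values {x = fromℤ k} {y = fromℤ (ℤ.- k)} (integer-cool k t p)
    (integer-cool (ℤ.- k) t (Dual-integer (Dual-⊖ G) p)) ≃-refl
  go (inj₂ (nonInteger ¬int)) = compare (t ≤? τ)
    where
    open Negated (negated ¬int)
    compare : Dec (t ≤ τ) → WinsSecond (⊖ cool t G ∷ ⊖ cool t (⊖ G) ∷ [])
    compare (yes t≤τ) = subst₂ (λ A B → WinsSecond (⊖ A ∷ ⊖ B ∷ []))
      (sym (below-cool L R t temp≡ t≤τ))
      (sym (below-cool (λ j → ⊖ R j) (λ i → ⊖ L i) t temp⊖ (≤-trans t≤τ (≤-reflexive τ≃τ′))))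
      (second λ
        { (here (rightOption i)) → first (there (here (leftOption i)))
            (both {cool t (L i)} {canonical (- t)} {cool t (⊖ L i)} {canonical t} (cool-⊖ t (L i)) (exchange opposite))
        ; (there (here (rightOption j))) → first (here (leftOption j))
            (both {cool t (R j)} {canonical t} {cool t (⊖ R j)} {canonical (- t)} (cool-⊖ t (R j)) opposite) })
      where
      opposite = values {x = t} {y = - t} refl refl ≃-refl
    compare (no t≰τ) = values (above-cool t temp≡ (≰⇒> t≰τ))
      (above-cool t temp⊖ (≰⇒> λ p → t≰τ (≤-trans p (≤-reflexive (≃-sym τ≃τ′)))))
      (Negation.frozen-walls L R (λ i → ⊖-walls (L i)) (λ j → ⊖-walls (R j)) (negated ¬int))

-- Bounds on cooled games

data Live (t : 𝔻) : Game → Set where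
  live : ∀ {m n} {L : Fin (suc m) → Game} {R : Fin (suc n) → Game} {τ} →
         temp (node L R) ≡ just τ → t ≤ τ → Live t (node L R)

-- `point` is the temperature, or −1 for integers.
record Cold (t : 𝔻) (G : Game) : Set where
  field
    point x  : 𝔻
    point<t  : point < t
    cool≡    : cool t G ≡ canonical x
    λ-const  : ∀ u → point ≤ u → λₜ u G ≃ x
    ρ-const  : ∀ u → point ≤ u → ρₜ u G ≃ x
    options≤ : ∀ {G′} → LeftOption G G′ → ρₜ point G′ - point ≤ x
    kind     : IsInteger G ⊎ (Live point G × -1𝔻 < point)

  λ≃x : λₜ t G ≃ x
  λ≃x = λ-const t (<⇒≤ point<t)

  ρ≃x : ρₜ t G ≃ x
  ρ≃x = ρ-const t (<⇒≤ point<t)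

integer-cold : ∀ {t G} → -1𝔻 < t → IsInteger G → Cold t G
integer-cold {t} -1<t (n , p) = record
  { point = -1𝔻 ; x = fromℤ n ; point<t = -1<t ; cool≡ = integer-cool n t p
  ; λ-const = λ u _ → integer-λₜ n u p ; ρ-const = λ u _ → integer-ρₜ n u p
  ; options≤ = integer-leftOption p ; kind = inj₁ (n , p) }

frozen-cold : ∀ {m n} (L : Fin (suc m) → Game) (R : Fin (suc n) → Game) → ¬ IsInteger (node L R) →
              ∀ {t τ} → temp (node L R) ≡ just τ → λ̃ₜ τ L ≃ ρ̃ₜ τ R → τ < t → Cold t (node L R)
frozen-cold L R ¬int {t} {τ} temp≡ meet τ<t = record
  { point = τ ; x = λₜ τ G ; point<t = τ<t ; cool≡ = above-cool t temp≡ τ<t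
  ; λ-const = λ u τ≤u → λ-const u τ≤u (u ≤? τ)
  ; ρ-const = λ u τ≤u → ρ-const u τ≤u (u ≤? τ)
  ; options≤ = λ { (leftOption i) → ≤-trans (≤-max (λ i → ρₜ τ (L i) - τ) i)
                                           (≤-reflexive (≃-sym (below-λₜ L R τ temp≡ ≤-refl))) }
  ; kind = inj₂ (live temp≡ ≤-refl , -1<temp L R ¬int meet) }
  where
  G = node L R
  λ-const : ∀ u → τ ≤ u → Dec (u ≤ τ) → λₜ u G ≃ λₜ τ G
  λ-const u τ≤u (yes u≤τ) = λ-cong G (≤-antisym u≤τ τ≤u)
  λ-const u τ≤u (no u≰τ)  = above-λₜ u temp≡ (≰⇒> u≰τ)
  ρ-const : ∀ u → τ ≤ u → Dec (u ≤ τ) → ρₜ u G ≃ λₜ τ G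
  ρ-const u τ≤u (yes u≤τ) = ≃-trans (ρ-cong G (≤-antisym u≤τ τ≤u))
    (≃-trans (below-ρₜ L R τ temp≡ ≤-refl) (≃-trans (≃-sym meet) (≃-sym (below-λₜ L R τ temp≡ ≤-refl))))
  ρ-const u τ≤u (no u≰τ)  = above-ρₜ u temp≡ (≰⇒> u≰τ)

state : ∀ {t} → -1𝔻 < t → ∀ G → Live t G ⊎ Cold t G
state {t} -1<t G = go (integer? G)
  where
  go : ∀ {G} → IsInteger G ⊎ NonInteger G → Live t G ⊎ Cold t G
  go (inj₁ int) = inj₂ (integer-cold -1<t int)
  go (inj₂ (nonInteger {L = L} {R} ¬int)) = compare (temp-least L R ¬int)
    where
    compare : (∃ λ τ → temp (node L R) ≡ just τ × IsLeast (λ t → λ̃ₜ t L ≃ ρ̃ₜ t R) τ) →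
              Live t (node L R) ⊎ Cold t (node L R)
    compare (τ , temp≡ , meet , _) = decide (t ≤? τ)
      where
      decide : Dec (t ≤ τ) → Live t (node L R) ⊎ Cold t (node L R)
      decide (yes t≤τ) = inj₁ (live temp≡ t≤τ)
      decide (no t≰τ)  = inj₂ (frozen-cold L R ¬int temp≡ meet (≰⇒> t≰τ))

cold-number : ∀ {t G} (c : Cold t G) → Numbers (cool t G ∷ []) (Cold.x c)
cold-number c = subst (λ K → Numbers (K ∷ []) (Cold.x c)) (sym (Cold.cool≡ c)) (canonical-number (Cold.x c))

module _ {t : 𝔻} (-1<t : -1𝔻 < t) where
  -- The walls at t act as the Right and Left stops of the cooled game, tested against numbers. The
  -- inequalities are strict because at equality an infinitesimal decides the winner.
  ρ-Bound λ-Bound : Game → Set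
  ρ-Bound G = ∀ {Ξ w} → Numbers Ξ w → 0𝔻 < ρₜ t G + w → WinsSecond (cool t G ∷ Ξ)
  λ-Bound G = ∀ {Ξ w} → Numbers Ξ w → 0𝔻 < λₜ t G + w → WinsFirst (cool t G ∷ Ξ)

  ρ-bound-step : ∀ G → (∀ {G′} → RightOption G G′ → λ-Bound G′) → λ-Bound G → ρ-Bound G
  ρ-bound-step G options λ-bound {Ξ} {w} N 0<ρ+w = [ hot , cold ] (state -1<t G)
    where
    hot : Live t G → WinsSecond (cool t G ∷ Ξ)
    hot (live {L = L} {R} temp≡ t≤τ) = subst (λ K → WinsSecond (K ∷ Ξ)) (sym (below-cool L R t temp≡ t≤τ)) (second λ
      { (here (rightOption j)) → merge-first (options (rightOption j) (canonical-number t ⊹ N)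
          (by-<₂ 0<ρ+w (≤-trans (≤-reflexive (below-ρₜ L R t temp≡ t≤τ)) (min-≤ (λ j → λₜ t (R j) + t) j))
            (lem (λₜ t (R j)) (ρₜ t G) t w)))
      -- Right has moved in the numbers, which raised w; Left now starts in G itself, where λ ≥ ρ
      -- suffices.
      ; (there m) → let w′ , w<w′ , N′ = Numbers-right N m in
          subst (λ K → WinsFirst (K ∷ _)) (below-cool L R t temp≡ t≤τ) (λ-bound N′
            (by-<₃ 0<ρ+w (ρ≤λ G t) (<⇒≤ w<w′) (lem′ (λₜ t G) (ρₜ t G) w w′))) })
      where
      lem : ∀ l r t w → (l + (t + w)) - 0𝔻 ≃ ((r + w) - 0𝔻) + ((l + t) - r)
      lem = solve-∀ 𝔻-ring
      lem′ : ∀ l r w w′ → (l + w′) - 0𝔻 ≃ ((r + w) - 0𝔻) + ((l - r) + (w′ - w))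
      lem′ = solve-∀ 𝔻-ring
    cold : Cold t G → WinsSecond (cool t G ∷ Ξ)
    cold c = numbers-second (cold-number c ⊹ N) (≤-trans (<⇒≤ 0<ρ+w) (≤-reflexive (+-congʳ w (Cold.ρ≃x c))))

  λ-bound-step : ∀ G → (∀ {G′} → LeftOption G G′ → ρ-Bound G′) → λ-Bound G
  λ-bound-step G options {Ξ} {w} N 0<λ+w = [ hot , cold ] (state -1<t G)
    where
    hot : Live t G → WinsFirst (cool t G ∷ Ξ)
    hot (live {L = L} {R} temp≡ t≤τ) = let i , eq = max-attained (λ i → ρₜ t (L i) - t) in
      subst (λ K → WinsFirst (K ∷ Ξ)) (sym (below-cool L R t temp≡ t≤τ))
        (first (here (leftOption i)) (merge (options (leftOption i) (canonical-number (- t) ⊹ N)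
          (by-<₂ 0<λ+w (≤-reflexive (≃-trans (below-λₜ L R t temp≡ t≤τ) eq)) (lem (ρₜ t (L i)) (λₜ t G) t w)))))
      where
      lem : ∀ r l t w → (r + (- t + w)) - 0𝔻 ≃ ((l + w) - 0𝔻) + ((r - t) - l)
      lem = solve-∀ 𝔻-ring
    cold : Cold t G → WinsFirst (cool t G ∷ Ξ)
    cold c = numbers-first (cold-number c ⊹ N) (by-<₂ 0<λ+w (≤-reflexive (Cold.λ≃x c)) (lem (Cold.x c) (λₜ t G) w))
      where
      lem : ∀ x l w → (x + w) - 0𝔻 ≃ ((l + w) - 0𝔻) + (x - l)
      lem = solve-∀ 𝔻-ring

  mutual
    ρ⇒second : ∀ G → ρ-Bound G
    ρ⇒second G@(node L R) = ρ-bound-step G (λ { (rightOption j) → λ⇒first (R j) })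
      (λ-bound-step G λ { (leftOption i) → ρ⇒second (L i) })

    λ⇒first : ∀ G → λ-Bound G
    λ⇒first G@(node L R) = λ-bound-step G λ { (leftOption i) → ρ⇒second (L i) }

  λ⇒second-⊖ : ∀ G {Ξ w} → Numbers Ξ w → λₜ t G < w → WinsSecond (⊖ cool t G ∷ Ξ)
  λ⇒second-⊖ G {Ξ} {w} N λ<w = second-↭ (++-comm Ξ _)
    (cut (Dual-⊖ (cool t (⊖ G))) (ρ⇒second (⊖ G) N
      (by-<₂ λ<w (≤-reflexive (≃-sym (proj₂ (⊖-walls G t)))) (lem (ρₜ t (⊖ G)) (λₜ t G) w)))
      (exchange (cool-⊖ t G)))
    where
    lem : ∀ r l w → (r + w) - 0𝔻 ≃ (w - l) + (r - - l)
    lem = solve-∀ 𝔻-ring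

  -- For every ε > 0 the number λ + ε is at least the cooled game, so it can replace that game in
  -- the sum; then ε tends to 0.
  second⇒λ : ∀ G {Ξ w} → Numbers Ξ w → WinsSecond (cool t G ∷ Ξ) → 0𝔻 ≤ λₜ t G + w
  second⇒λ G {Ξ} {w} N v = 0≤-limit λ ε 0<ε →
    ≤-trans (second⇒0≤ (N ⊹ canonical-number (λₜ t G + ε))
              (cut (Dual-⊖ (cool t G)) v (λ⇒second-⊖ G (canonical-number (λₜ t G + ε)) (by-< 0<ε (lem₁ (λₜ t G) ε)))))
            (≤-reflexive (lem₂ w (λₜ t G) ε))
    where
    lem₁ : ∀ l e → (l + e) - l ≃ e - 0𝔻
    lem₁ = solve-∀ 𝔻-ring
    lem₂ : ∀ w l e → w + (l + e) ≃ (l + w) + e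
    lem₂ = solve-∀ 𝔻-ring

  -- The bounds read off at t hold strictly at every lower temperature s. This is what
  -- excludes Left options of a frozen game that exceed its mast value by an infinitesimal.
  module _ {s : 𝔻} (s<t : s < t) where
    ρ-Strict λ-Strict : Game → Set
    ρ-Strict G = ∀ {Ξ w} → Numbers Ξ w → WinsSecond (cool t G ∷ Ξ) → - w - (t - s) < ρₜ s G
    λ-Strict G = ∀ {Ξ w} → Numbers Ξ w → WinsFirst (cool t G ∷ Ξ) → - w < λₜ s G

    -- For a live G, Right's best option at s is tested; the slack t - s appears because Right is
    -- taxed s instead of t. For a cold G, ρ is constant down to `point` and falls with slope at
    -- most 1 below it, so `point` < t or s < t gives strictness.
    ρ-strict-step : ∀ G → (∀ {G′} → RightOption G G′ → λ-Strict G′) → ρ-Strict G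
    ρ-strict-step G options {Ξ} {w} N v = [ hot , cold ] (state -1<t G)
      where
      hot : Live t G → - w - (t - s) < ρₜ s G
      hot (live {L = L} {R} temp≡ t≤τ) = let j , eq = min-attained (λ j → λₜ s (R j) + s) in
        by-<₂ (options (rightOption j) (canonical-number t ⊹ N)
                (unmerge-first (reply (subst (λ K → WinsSecond (K ∷ Ξ)) (below-cool L R t temp≡ t≤τ) v) (here (rightOption j)))))
              (≤-reflexive (≃-sym (≃-trans (below-ρₜ L R s temp≡ (≤-trans (<⇒≤ s<t) t≤τ)) eq)))
              (lem (ρₜ s G) (λₜ s (R j)) w s t)
        where
        lem : ∀ r l w s t → r - (- w - (t - s)) ≃ (l - - (t + w)) + (r - (l + s))
        lem = solve-∀ 𝔻-ring
      cold : Cold t G → - w - (t - s) < ρₜ s G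
      cold c = go (s ≤? point)
        where
        open Cold c
        0≤x+w : 0𝔻 ≤ x + w
        0≤x+w = second⇒0≤ (cold-number c ⊹ N) v
        lem₁ : ∀ r w s t p x → r - (- w - (t - s)) ≃ (t - p) + (((x + w) - 0𝔻) + ((r + (p - s)) - x))
        lem₁ = solve-∀ 𝔻-ring
        lem₂ : ∀ r w s t x → r - (- w - (t - s)) ≃ (t - s) + (((x + w) - 0𝔻) + (r - x))
        lem₂ = solve-∀ 𝔻-ring
        go : Dec (s ≤ point) → - w - (t - s) < ρₜ s G
        go (yes s≤p) = by-<₃ point<t 0≤x+w
          (≤-trans (≤-reflexive (≃-sym (ρ-const point ≤-refl))) (ρ-lipschitz G s≤p))
          (lem₁ (ρₜ s G) w s t point x)
        go (no s≰p)  = by-<₃ s<t 0≤x+w (≤-reflexive (≃-sym (ρ-const s (≰⇒≥ s≰p)))) (lem₂ (ρₜ s G) w s t x)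

    -- If the winning move is in a live G, Left saves t - s in tax at s, which exactly repays the
    -- slack of the option. If it is in the numbers, their loss of value gives strictness.
    λ-strict-step : ∀ G → (∀ {G′} → LeftOption G G′ → ρ-Strict G′) → λ-Strict G
    λ-strict-step G options {Ξ} {w} N v = [ hot , cold ] (state -1<t G)
      where
      hot : Live t G → - w < λₜ s G
      hot (live {L = L} {R} temp≡ t≤τ) = go (subst (λ K → WinsFirst (K ∷ Ξ)) cool≡ v)
        where
        cool≡ = below-cool L R t temp≡ t≤τ
        lem₁ : ∀ l r w s t → l - - w ≃ (r - (- (- t + w) - (t - s))) + (l - (r - s))
        lem₁ = solve-∀ 𝔻-ring
        lem₂ : ∀ l l′ w w′ → l - - w ≃ (w - w′) + (((l′ + w′) - 0𝔻) + (l - l′))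
        lem₂ = solve-∀ 𝔻-ring
        go : WinsFirst (node (λ i → cool t (L i) ⊕ canonical (- t)) (λ j → cool t (R j) ⊕ canonical t) ∷ Ξ) →
             - w < λₜ s G
        go (first (here (leftOption i)) u) =
          by-<₂ (options (leftOption i) (canonical-number (- t) ⊹ N) (unmerge u))
                (≤-trans (≤-max (λ i → ρₜ s (L i) - s) i)
                         (≤-reflexive (≃-sym (below-λₜ L R s temp≡ (≤-trans (<⇒≤ s<t) t≤τ)))))
                (lem₁ (λₜ s G) (ρₜ s (L i)) w s t)
        go (first (there m) u) = let w′ , w′<w , N′ = Numbers-left N m in
          by-<₃ w′<w (second⇒λ G N′ (subst (λ K → WinsSecond (K ∷ _)) (sym cool≡) u)) (λ-antitone G (<⇒≤ s<t))
                (lem₂ (λₜ s G) (λₜ t G) w w′)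
      cold : Cold t G → - w < λₜ s G
      cold c = by-<₂ (first⇒0< (cold-number c ⊹ N) v)
        (≤-trans (≤-reflexive (≃-sym (Cold.λ≃x c))) (λ-antitone G (<⇒≤ s<t))) (lem (λₜ s G) (Cold.x c) w)
        where
        lem : ∀ l x w → l - - w ≃ ((x + w) - 0𝔻) + (l - x)
        lem = solve-∀ 𝔻-ring

    mutual
      ρ-strict : ∀ G → ρ-Strict G
      ρ-strict G@(node L R) = ρ-strict-step G λ { (rightOption j) → λ-strict (R j) }

      λ-strict : ∀ G → λ-Strict G
      λ-strict G@(node L R) = λ-strict-step G λ { (leftOption i) → ρ-strict (L i) }

  -- In a live G, Left moves to the option and the tax -t cancels the spare t. A cold G is where the
  -- strict bounds are needed.
  taxed-option : ∀ {G G′} → LeftOption G G′ → WinsFirst (⊖ cool t G′ ∷ cool t G ∷ canonical t ∷ [])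
  taxed-option {G} {G′} o = [ hot o , cold ] (state -1<t G)
    where
    C′ = cool t G′
    hot : ∀ {G G′} → LeftOption G G′ → Live t G → WinsFirst (⊖ cool t G′ ∷ cool t G ∷ canonical t ∷ [])
    hot (leftOption i) (live {L = L} {R} temp≡ t≤τ) =
      subst (λ K → WinsFirst (⊖ cool t (L i) ∷ K ∷ canonical t ∷ [])) (sym (below-cool L R t temp≡ t≤τ))
        (first (there (here (leftOption i))) (exchange (merge (second-↭ (prep _ (swap _ _ ↭-refl))
          (second-++-second (Dual⇒second (Dual-⊖ (cool t (L i))))
            (numbers-second (canonical-number (- t) ⊹ canonical-number t) (≤-reflexive (lem t))))))))
      where
      lem : ∀ t → 0𝔻 ≃ - t + t
      lem = solve-∀ 𝔻-ring
    cold : Cold t G → WinsFirst (⊖ C′ ∷ cool t G ∷ canonical t ∷ [])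
    cold c = subst (λ K → WinsFirst (⊖ C′ ∷ K ∷ canonical t ∷ [])) (sym cool≡)
      (first-↭ (++-comm (canonical x ∷ canonical t ∷ []) _)
        (unmerge-first (unmerge-first (⇒first (▷⇒first (canonical x ⊕ canonical t) C′
          (¬⊒⇒▷ (canonical x ⊕ canonical t) C′ too-large))))))
      where
      open Cold c
      y = - (x + t)
      lem₁ : ∀ x t → 0𝔻 ≃ x + (t + - (x + t))
      lem₁ = solve-∀ 𝔻-ring
      lem₂ : ∀ x t p r → x - (r - p) ≃ (- - (x + t) - (t - p)) - r
      lem₂ = solve-∀ 𝔻-ring
      too-large : ¬ (C′ ⊒ canonical x ⊕ canonical t)
      -- With y = -(x + t) the strict bound reads x + `point` < ρ for G′ at `point`, which
      -- `options≤` forbids.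
      too-large p = <⇒≱ (ρ-strict point<t G′ (canonical-number y) C′≥)
        (by-≤ (options≤ o) (≃-sym (lem₂ x t point (ρₜ point G′))))
        where
        C′≥ : WinsSecond (C′ ∷ canonical y ∷ [])
        C′≥ = exchange (cut (Dual-⊖ (canonical x ⊕ canonical t))
          (merge (numbers-second (canonical-number x ⊹ canonical-number t ⊹ canonical-number y) (≤-reflexive (lem₁ x t))))
          (exchange (≥ᴳ⇒second (⊒⇒≥ᴳ C′ (canonical x ⊕ canonical t) p))))

  -- Right can move a live game to within any ε > 0 of its own value, because
  -- ρ of the game, which bounds it from below, is attained as λ of the option.
  cheap-option : ∀ {G} → Live t G → ∃ λ G′ → RightOption G G′ ×
                 (∀ ε → 0𝔻 < ε → WinsSecond (⊖ (cool t G′ ⊕ canonical t) ∷ cool t G ∷ canonical ε ∷ []))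
  cheap-option (live {L = L} {R} temp≡ t≤τ) =
    R j , rightOption j , within
    where
    G = node L R
    j = proj₁ (min-attained (λ j → λₜ t (R j) + t))
    l = λₜ t (R j)
    ρ≃ : ρₜ t G ≃ l + t
    ρ≃ = ≃-trans (below-ρₜ L R t temp≡ t≤τ) (proj₂ (min-attained (λ j → λₜ t (R j) + t)))
    lem₁ : ∀ l t h → (- t + ((l + t) + h)) - l ≃ h - 0𝔻
    lem₁ = solve-∀ 𝔻-ring
    lem₂ : ∀ r l t h e → (r + (- ((l + t) + h) + e)) - 0𝔻 ≃ (h - 0𝔻) + ((r - (l + t)) + (e - (h + h)))
    lem₂ = solve-∀ 𝔻-ring
    within : ∀ ε → 0𝔻 < ε → WinsSecond (⊖ (cool t (R j) ⊕ canonical t) ∷ cool t G ∷ canonical ε ∷ [])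
    within ε 0<ε = cut (Dual-⊖ (canonical z))
      (merge-⊖ {cool t (R j)} {canonical t} (λ⇒second-⊖ (R j) (⊖-number (canonical-number t) ⊹ canonical-number z)
        (by-< (half-positive 0<ε) (lem₁ l t (half ε)))))
      (exchange (ρ⇒second G (⊖-number (canonical-number z) ⊹ canonical-number ε)
        (by-<₃ (half-positive 0<ε) (≤-reflexive (≃-sym ρ≃)) (≤-reflexive (half+half ε)) (lem₂ (ρₜ t G) l t (half ε) ε))))
      where
      -- z lies ε/2 above the right wall of G: z - t exceeds the left wall of the option, and z - ε
      -- is still below the right wall of G.
      z = (l + t) + half ε

-- Cooling sums

Improves : Game → Game → Set
Improves G H = WinsSecond (⊖ G ∷ H ∷ [])

improve : ∀ {Γ Δ} Θ → Pointwise Improves Γ Δ → WinsSecond (Γ ++ Θ) → WinsSecond (Δ ++ Θ)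
improve Θ []       w = w
improve Θ (_∷_ {x = G} {y = H} {xs = Γ} {ys = Δ} v vs) w =
  second-↭ (shift H Δ Θ) (improve (H ∷ Θ) vs (second-↭ (↭-sym (shift H Γ Θ)) (replace v w)))

improve-all : ∀ {Γ Δ} → Pointwise Improves Γ Δ → WinsSecond Γ → WinsSecond Δ
improve-all {Γ} {Δ} vs w = subst WinsSecond (++-identityʳ Δ) (improve [] vs (subst WinsSecond (sym (++-identityʳ Γ)) w))

module _ {t : 𝔻} (-1<t : -1𝔻 < t) where
  C : List Game → List Game
  C = map (cool t)

  shift₂ : ∀ (G H : Game) Γ Δ → G ∷ Γ ++ H ∷ Δ ↭ Γ ++ H ∷ G ∷ Δ
  shift₂ G H Γ Δ = ↭-trans (prep G (shift H Γ Δ))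
    (↭-trans (swap G H ↭-refl) (↭-sym (↭-trans (shift H Γ (G ∷ Δ)) (prep H (shift G Γ Δ)))))

  -- The spare t was added by Right's move and pays for Left's reply. Components passed over on the
  -- way to the reply are collected in Δ.
  answer : ∀ {Γ Γ′} Δ → LeftMove Γ Γ′ → WinsSecond (C Γ′ ++ Δ) → WinsFirst (C Γ ++ canonical t ∷ Δ)
  answer {G ∷ Γ} Δ (here o)  w = first-↭ (prep _ (↭-sym (shift (canonical t) (C Γ) Δ)))
    (first-replace (taxed-option -1<t o) w)
  answer {G ∷ Γ} {_ ∷ Γ′} Δ (there m) w = first-↭ (↭-sym (shift₂ (cool t G) (canonical t) (C Γ) Δ))
    (answer (cool t G ∷ Δ) m (second-↭ (↭-sym (shift (cool t G) (C Γ′) Δ)) w))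

  -- A Right move is remembered only through a lower bound for the position Θ it reaches, in the
  -- form in which it is used: a winning start from the bound transfers to Θ, in any context Δ.
  Thermal Strategic : List Game → List Game → Set
  Thermal Γ Θ = ∃ λ Γ′ → RightMove Γ Γ′ × (∀ Δ → WinsFirst (C Γ′ ++ canonical t ∷ Δ) → WinsFirst (Θ ++ Δ))
  Strategic Γ Θ = ∃ λ ε → 0𝔻 < ε × (∀ Δ → WinsFirst (C Γ ++ canonical ε ∷ Δ) → WinsFirst (Θ ++ Δ))

  under : ∀ {H Γ Θ} G → (∀ Δ → WinsFirst (Γ ++ H ∷ Δ) → WinsFirst (Θ ++ Δ)) →
          ∀ Δ → WinsFirst (G ∷ Γ ++ H ∷ Δ) → WinsFirst (G ∷ Θ ++ Δ)
  under {H} {Γ} {Θ} G f Δ w = first-↭ (shift G Θ Δ) (f (G ∷ Δ) (first-↭ (shift₂ G H Γ Δ) w))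

  classify-option : ∀ {G K} Γ → RightOption (cool t G) K → Thermal (G ∷ Γ) (K ∷ C Γ) ⊎ Strategic (G ∷ Γ) (K ∷ C Γ)
  classify-option {G} {K} Γ o = Sum.map (λ l → hot l o) cold (state -1<t G)
    where
    hot : ∀ {G K} → Live t G → RightOption (cool t G) K → Thermal (G ∷ Γ) (K ∷ C Γ)
    hot {K = K} (live {L = L} {R} temp≡ t≤τ) o = go (subst (λ A → RightOption A K) (below-cool L R t temp≡ t≤τ) o)
      where
      go : RightOption (node (λ i → cool t (L i) ⊕ canonical (- t)) (λ j → cool t (R j) ⊕ canonical t)) K →
           Thermal (node L R ∷ Γ) (K ∷ C Γ)
      go (rightOption j) = R j ∷ Γ , here (rightOption j) , λ Δ w →
        merge-first (first-↭ (prep _ (shift (canonical t) (C Γ) Δ)) w)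
    cold : Cold t G → Strategic (G ∷ Γ) (K ∷ C Γ)
    cold c = let x′ , x<x′ , N′ = Numbers-right (cold-number c) (here o) in
      -- Moving in a number costs Right the positive amount x′ - x, which becomes ε.
      x′ - x , by-< x<x′ (lem₁ x x′) , λ Δ w →
        replace-first (exchange (merge-⊖ {cool t G} {canonical (x′ - x)} (numbers-second
            (⊖-number (cold-number c) ⊹ ⊖-number (canonical-number (x′ - x)) ⊹ N′) (≤-reflexive (lem₂ x x′)))))
          (merge-first (first-↭ (prep _ (shift (canonical (x′ - x)) (C Γ) Δ)) w))
      where
      open Cold c
      lem₁ : ∀ x y → (y - x) - 0𝔻 ≃ y - x
      lem₁ = solve-∀ 𝔻-ring
      lem₂ : ∀ x y → 0𝔻 ≃ - x + (- (y - x) + y)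
      lem₂ = solve-∀ 𝔻-ring

  classify : ∀ Γ {Θ} → RightMove (C Γ) Θ → Thermal Γ Θ ⊎ Strategic Γ Θ
  classify (G ∷ Γ) (here o) = classify-option Γ o
  classify (G ∷ Γ) (there m) = Sum.map
    (λ (Γ′ , m′ , f) → G ∷ Γ′ , there m′ , under (cool t G) f)
    (λ (ε , 0<ε , f) → ε , 0<ε , under (cool t G) f) (classify Γ m)

  cheap-move : ∀ {Γ} → Any (Live t) Γ → ∃ λ Γ′ → RightMove Γ Γ′ ×
               (∀ ε → 0𝔻 < ε → ∀ Δ → WinsFirst (C Γ′ ++ canonical t ∷ Δ) → WinsFirst (C Γ ++ canonical ε ∷ Δ))
  cheap-move {G ∷ Γ} (here l) = let G′ , o , within = cheap-option -1<t l in
    G′ ∷ Γ , here o , λ ε 0<ε Δ w →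
      first-↭ (prep _ (↭-sym (shift (canonical ε) (C Γ) Δ)))
        (replace-first (within ε 0<ε) (merge-first (first-↭ (prep _ (shift (canonical t) (C Γ) Δ)) w)))
  cheap-move {G ∷ Γ} (there a) = let Γ′ , m , f = cheap-move a in
    G ∷ Γ′ , there m , λ ε 0<ε Δ w →
      first-↭ (↭-sym (shift₂ (cool t G) (canonical ε) (C Γ) Δ))
        (f ε 0<ε (cool t G ∷ Δ) (first-↭ (shift₂ (cool t G) (canonical t) (C Γ′) Δ) w))

  hot-case : ∀ {Γ} → (∀ {Γ′ Γ″} → RightMove Γ Γ′ → LeftMove Γ′ Γ″ → WinsSecond Γ″ → WinsSecond (C Γ″)) →
             Any (Live t) Γ → WinsSecond Γ → WinsSecond (C Γ)
  hot-case {Γ} hyp a v = second λ {Θ} m → subst WinsFirst (++-identityʳ Θ) (respond (classify Γ m))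
    where
    after : ∀ {Γ′} → RightMove Γ Γ′ → WinsFirst (C Γ′ ++ canonical t ∷ [])
    after m = go m (reply v m)
      where
      go : ∀ {Γ′} → RightMove Γ Γ′ → WinsFirst Γ′ → WinsFirst (C Γ′ ++ canonical t ∷ [])
      go m (first m′ w) = answer [] m′ (subst WinsSecond (sym (++-identityʳ _)) (hyp m m′ w))
    respond : ∀ {Θ} → Thermal Γ Θ ⊎ Strategic Γ Θ → WinsFirst (Θ ++ [])
    respond (inj₁ (Γ′ , m , f))   = f [] (after m)
    -- The position after Right's move in a number is at least the cooled sum plus ε, hence at least
    -- the position after the cheap move, where Left's reply is known.
    respond (inj₂ (ε , 0<ε , f)) = let Γ′ , m , g = cheap-move a in f [] (g ε 0<ε [] (after m))

-- Sums whose components are all frozen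

Constant : 𝔻 → 𝔻 → Game → Set
Constant σ t G = ∀ u → σ ≤ u → u ≤ t → λₜ u G ≃ λₜ t G

HotBelow : 𝔻 → List Game → Set
HotBelow t Γ = ∃ λ σ → -1𝔻 < σ × σ < t × Any (Live σ) Γ × All (Constant σ t) Γ

integer-constant : ∀ {σ t G} → IsInteger G → Constant σ t G
integer-constant {t = t} (n , p) u _ _ = ≃-trans (integer-λₜ n u p) (≃-sym (integer-λₜ n t p))

cold-constant : ∀ {t G} (c : Cold t G) → Constant (Cold.point c) t G
cold-constant c u p≤u _ = ≃-trans (Cold.λ-const c u p≤u) (≃-sym (Cold.λ≃x c))

-- The larger of two temperatures is kept at each step: its owner is live there, and the left walls
-- of the others are constant from there up to t.
cold-integers : ∀ {t Γ} → All (Cold t) Γ → All IsInteger Γ ⊎ HotBelow t Γ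
cold-integers []       = inj₁ []
cold-integers {t} {G ∷ Γ} (c ∷ cs) = combine (Cold.kind c) (cold-integers cs)
  where
  combine : IsInteger G ⊎ (Live (Cold.point c) G × -1𝔻 < Cold.point c) →
            All IsInteger Γ ⊎ HotBelow t Γ → All IsInteger (G ∷ Γ) ⊎ HotBelow t (G ∷ Γ)
  combine (inj₁ int) (inj₁ ints) = inj₁ (int ∷ ints)
  combine (inj₁ int) (inj₂ (σ , -1<σ , σ<t , a , ks)) =
    inj₂ (σ , -1<σ , σ<t , there a , integer-constant int ∷ ks)
  combine (inj₂ (l , -1<p)) (inj₁ ints) =
    inj₂ (_ , -1<p , Cold.point<t c , here l , cold-constant c ∷ All.map integer-constant ints)
  combine (inj₂ (l , -1<p)) (inj₂ (σ , -1<σ , σ<t , a , ks)) = [ above , below ] (≤-total (Cold.point c) σ)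
    where
    above : Cold.point c ≤ σ → All IsInteger (G ∷ Γ) ⊎ HotBelow t (G ∷ Γ)
    above p≤σ = inj₂ (σ , -1<σ , σ<t , there a , (λ u σ≤u → cold-constant c u (≤-trans p≤σ σ≤u)) ∷ ks)
    below : σ ≤ Cold.point c → All IsInteger (G ∷ Γ) ⊎ HotBelow t (G ∷ Γ)
    below σ≤p = inj₂ (_ , -1<p , Cold.point<t c , here l ,
      cold-constant c ∷ All.map (λ k u p≤u → k u (≤-trans σ≤p p≤u)) ks)

integers-improve : ∀ {t Γ} → All IsInteger Γ → Pointwise Improves Γ (map (cool t) Γ)
integers-improve []                = []
integers-improve {t} (_∷_ {x = G} (n , p) ints) =
  subst (Improves G) (sym (integer-cool n t p)) (exchange (≥ᴳ⇒second (proj₂ p))) ∷ integers-improve ints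

Approximated : 𝔻 → 𝔻 → List Game → 𝔻 → Set
Approximated σ t Γ S = ∀ ε → 0𝔻 < ε → ∃ λ Δ → ∃ λ y →
  Pointwise Improves (map (cool σ) Γ) Δ × Numbers Δ y × y ≤ S + ε

-- The left wall at σ is still the mast value x, so any number above x bounds the game cooled by σ
-- from above.
cold-sum : ∀ {σ t Γ} → -1𝔻 < σ → σ < t → All (Cold t) Γ → All (Constant σ t) Γ →
           ∃ λ S → Numbers (map (cool t) Γ) S × Approximated σ t Γ S
cold-sum -1<σ σ<t [] [] = 0𝔻 , Numbers-[] , λ ε 0<ε → [] , 0𝔻 , [] , Numbers-[] , by-≤ (<⇒≤ 0<ε) (lem ε)
  where
  lem : ∀ e → (0𝔻 + e) - 0𝔻 ≃ e - 0𝔻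
  lem = solve-∀ 𝔻-ring
cold-sum {σ} {t} -1<σ σ<t (_∷_ {x = G} c cs) (k ∷ ks) =
  let S , N , approx = cold-sum -1<σ σ<t cs ks in
  x + S , cold-number c ⊹ N , λ ε 0<ε →
    -- Half of ε is spent on this component and half on the rest, so the errors add up to at most ε.
    let Δ , y , vs , M , y≤ = approx (half ε) (half-positive 0<ε)
        z = x + half ε in
    canonical z ∷ Δ , z + y ,
    λ⇒second-⊖ -1<σ G (canonical-number z)
      (by-<₂ (half-positive 0<ε) (≤-reflexive (≃-trans (k σ ≤-refl (<⇒≤ σ<t)) λ≃x)) (lem₁ x (λₜ σ G) (half ε))) ∷ vs ,
    canonical-number z ⊹ M ,
    by-≤₂ y≤ (≤-reflexive (half+half ε)) (lem₂ x S y (half ε) ε)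
  where
  open Cold c
  lem₁ : ∀ x l h → (x + h) - l ≃ (h - 0𝔻) + (x - l)
  lem₁ = solve-∀ 𝔻-ring
  lem₂ : ∀ x S y h e → ((x + S) + e) - ((x + h) + y) ≃ ((S + h) - y) + (e - (h + h))
  lem₂ = solve-∀ 𝔻-ring

live-or-cold : ∀ {t} → -1𝔻 < t → ∀ Γ → Any (Live t) Γ ⊎ All (Cold t) Γ
live-or-cold -1<t []      = inj₂ []
live-or-cold -1<t (G ∷ Γ) = [ inj₁ ∘ here , (λ c → Sum.map there (c ∷_) (live-or-cold -1<t Γ)) ] (state -1<t G)

cool-second : ∀ {Γ} → WinsSecond Γ → ∀ {t} → -1𝔻 < t → WinsSecond (map (cool t) Γ)
cool-second v -1<t = go (◂-wellFounded _) v -1<t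
  where
  go : ∀ {Γ} → Acc _◂_ Γ → WinsSecond Γ → ∀ {t} → -1𝔻 < t → WinsSecond (map (cool t) Γ)
  go′ : ∀ {Γ} → (∀ {Γ′} → Γ′ ◂ Γ → Acc _◂_ Γ′) → WinsSecond Γ → ∀ {t} → -1𝔻 < t →
        Any (Live t) Γ ⊎ All (Cold t) Γ → WinsSecond (map (cool t) Γ)
  hot : ∀ {Γ} → (∀ {Γ′} → Γ′ ◂ Γ → Acc _◂_ Γ′) → WinsSecond Γ → ∀ {t} → -1𝔻 < t →
        Any (Live t) Γ → WinsSecond (map (cool t) Γ)
  again : ∀ {Γ Γ″} → Acc _◂_ Γ → LeftMove Γ Γ″ → WinsSecond Γ″ → ∀ {t} → -1𝔻 < t →
          WinsSecond (map (cool t) Γ″)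

  go {Γ} (acc rs) v -1<t = go′ rs v -1<t (live-or-cold -1<t Γ)
  again (acc rs) m v -1<t = go (rs (inj₁ m)) v -1<t
  hot rs v -1<t a = hot-case -1<t (λ m m′ w → again (rs (inj₂ m)) m′ w -1<t) a v
  go′ rs v -1<t (inj₁ a)  = hot rs v -1<t a
  go′ {Γ} rs v {t} -1<t (inj₂ cs) = [ (λ ints → improve-all (integers-improve ints) v) , below ] (cold-integers cs)
    where
    below : HotBelow t Γ → WinsSecond (map (cool t) Γ)
    below (σ , -1<σ , σ<t , a , ks) =
      let S , N , approx = cold-sum -1<σ σ<t cs ks in
      numbers-second N (0≤-limit λ ε 0<ε →
        let Δ , y , vs , M , y≤ = approx ε 0<ε in
        ≤-trans (second⇒0≤ M (improve-all vs (hot rs v -1<σ a))) y≤)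

theorem12 : ∀ (t : 𝔻) → -1𝔻 < t → ∀ (G H : Game) → cool t (G ⊕ H) ≈ᴳ cool t G ⊕ cool t H
theorem12 t -1<t G H = second⇒≥ᴳ ≥ , second⇒≥ᴳ ≤′
  where
  ⊖-cool : ∀ G {Γ} → WinsSecond (cool t (⊖ G) ∷ Γ) → WinsSecond (⊖ cool t G ∷ Γ)
  ⊖-cool G {Γ} w = replace (exchange (cool-⊖ t G)) w
  ≥ : WinsSecond (cool t (G ⊕ H) ∷ ⊖ (cool t G ⊕ cool t H) ∷ [])
  -- Here -G and -H are separate components while `G ⊕ H` is a single one; the other direction
  -- exchanges these roles.
  ≥ = merge-⊖ {cool t G} {cool t H} (exchange (⊖-cool H (exchange (⊖-cool G (cool-second
        (unmerge (Dual⇒second (Dual-sym (Dual-⊕ (Dual-⊖ G) (Dual-⊖ H))))) -1<t)))))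
  ≤′ : WinsSecond (cool t G ⊕ cool t H ∷ ⊖ cool t (G ⊕ H) ∷ [])
  ≤′ = merge (second-↭ (++-comm (⊖ cool t (G ⊕ H) ∷ []) _)
         (⊖-cool (G ⊕ H) (second-↭ (++-comm (cool t G ∷ cool t H ∷ []) _)
           (cool-second (unmerge (Dual⇒second (Dual-⊖ (G ⊕ H)))) -1<t))))
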